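{- Let $m\ge0$ be a fixed integer. As $n\to\infty$, the probability that a grand zigzag knight's path chosen uniformly at random among all grand zigzag knight's paths of size $n$ stays above the line $y=-m$ is asymptotically equivalent to $c_m/\sqrt n$, where $$c_m=\begin{cases}\dfrac{2+\sqrt5}{2}\sqrt{\dfrac{7\sqrt5-15}{\pi}}, & \text{if } m=0,\\[2ex] \dfrac{4m+3-\sqrt5}{4(\sqrt5-2)}\sqrt{\dfrac{7\sqrt5-15}{\pi}}, & \text{if } m\ge1.\end{cases}$$
   Context: A grand zigzag knight's path is a lattice path in $\mathbb{Z}^2$ starting at the origin, made of steps $N=(1,2)$, $\bar N=(1,-2)$, $E=(2,1)$, $\bar E=(2,-1)$, such that the vertical components of two consecutive steps never have the same direction (up-steps $N,E$ and down-steps $\bar N,\bar E$ alternate). The size is the $x$-coordinate of the last point. A path stays above the line $y=-m$ if all its points have $y$-coordinate $\ge -m$ (points on the line are allowed). -}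

module Defs where

open import Data.Nat.Base as ℕ using (ℕ; zero; suc)
import Data.Nat.Properties as ℕ
open import Data.Integer.Base as ℤ using (ℤ; +_; -[1+_])
import Data.Integer.Properties as ℤ
open import Data.Rational.Base as ℚ using (ℚ; 0ℚ; 1ℚ; ½; mkℚ)
import Data.Rational.Properties as ℚ
import Data.Rational.Unnormalised.Base as ℚᵘ
import Data.Rational.Unnormalised.Properties as ℚᵘ
open import Data.Rational.Solver using (module +-*-Solver)
open import Data.Sum.Base using (inj₁; inj₂)
open import Data.Product.Base using (∃-syntax; _×_; _,_; proj₁; proj₂)
open import Relation.Binary.PropositionalEquality
open import Relation.Nullary using (¬_; Dec; yes; no; ¬?)
open import Relation.Nullary.Negation using (contradiction)
open import Relation.Unary using (Decidable)
open import Relation.Nullary.Decidable using (toWitness; _×-dec_)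
open import Data.Unit.Base using (tt)
import Data.Sign.Properties as Sign
open import Data.List.Base using (List; []; _∷_; length; filter; cartesianProductWith)
open import Data.List.Properties using (∷-injective)
open import Data.List.Membership.Propositional using (_∈_)
open import Data.List.Membership.Propositional.Properties
  using (∈-filter⁺; ∈-filter⁻; ∈-cartesianProductWith⁺; ∈-cartesianProductWith⁻; ∈-length)
open import Data.List.Relation.Unary.All using (All; []; _∷_; all?)
import Data.List.Relation.Unary.All.Properties as All
open import Data.List.Relation.Unary.Any using (here; there)
open import Data.List.Relation.Unary.AllPairs using ([]; _∷_)
open import Data.List.Relation.Unary.Linked using (Linked; []; [-]; _∷_; linked?)
open import Data.List.Relation.Unary.Unique.Propositional using (Unique)
import Data.List.Relation.Unary.Unique.Propositional.Properties as Unique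
open import Function.Bundles using (_⇔_; mk⇔)

module ℚ-Lemmas where
  open import Data.Rational.Base
    using (_≤_; _<_; *<*; _+_; _*_; _-_; -_; ∣_∣; _⊔_; 1/_; _/_; nonNegative; positive; ≢-nonZero)
  open import Data.Rational.Properties
  open +-*-Solver using (solve; _:+_; _:*_; _:-_; :-_; _:=_; con)

  p≤∣p∣ : ∀ p → p ≤ ∣ p ∣
  p≤∣p∣ p with ≤-total 0ℚ p
  ... | inj₁ 0≤p = ≤-reflexive (sym (0≤p⇒∣p∣≡p 0≤p))
  ... | inj₂ p≤0 = ≤-trans p≤0 (0≤∣p∣ p)

  -p≤∣p∣ : ∀ p → - p ≤ ∣ p ∣
  -p≤∣p∣ p = subst (- p ≤_) (∣-p∣≡∣p∣ p) (p≤∣p∣ (- p))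

  ∣p∣≤ : ∀ {p q} → p ≤ q → - p ≤ q → ∣ p ∣ ≤ q
  ∣p∣≤ {p} p≤q -p≤q with ∣p∣≡p∨∣p∣≡-p p
  ... | inj₁ eq = subst (_≤ _) (sym eq) p≤q
  ... | inj₂ eq = subst (_≤ _) (sym eq) -p≤q

  p-q≤r⇒p≤q+r : ∀ {p q r} → p - q ≤ r → p ≤ q + r
  p-q≤r⇒p≤q+r {p} {q} {r} h =
    subst (_≤ q + r) (solve 2 (λ p q → q :+ (p :- q) := p) refl p q) (+-monoʳ-≤ q h)

  p≤q+r⇒p-q≤r : ∀ {p q r} → p ≤ q + r → p - q ≤ r
  p≤q+r⇒p-q≤r {p} {q} {r} h =
    subst (p - q ≤_) (solve 2 (λ q r → (q :+ r) :- q := r) refl q r) (+-monoˡ-≤ (- q) h)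

  neg-sub : ∀ p q → - (p - q) ≡ q - p
  neg-sub = solve 2 (λ p q → :- (p :- q) := q :- p) refl

  ∣p-q∣≤⁺ : ∀ {p q r} → p ≤ q + r → q ≤ p + r → ∣ p - q ∣ ≤ r
  ∣p-q∣≤⁺ {p} {q} {r} h₁ h₂ =
    ∣p∣≤ (p≤q+r⇒p-q≤r h₁) (subst (_≤ r) (sym (neg-sub p q)) (p≤q+r⇒p-q≤r h₂))

  ∣p-q∣≤⁻ : ∀ {p q r} → ∣ p - q ∣ ≤ r → p ≤ q + r
  ∣p-q∣≤⁻ {p} {q} h = p-q≤r⇒p≤q+r (≤-trans (p≤∣p∣ (p - q)) h)

  ∣p-q∣≤⁻′ : ∀ {p q r} → ∣ p - q ∣ ≤ r → q ≤ p + r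
  ∣p-q∣≤⁻′ {p} {q} h =
    p-q≤r⇒p≤q+r (≤-trans (subst (_≤ ∣ p - q ∣) (neg-sub p q) (-p≤∣p∣ (p - q))) h)

  *-mono-≤-nonNeg : ∀ p q r s → 0ℚ ≤ r → 0ℚ ≤ q → p ≤ q → r ≤ s → p * r ≤ q * s
  *-mono-≤-nonNeg p q r s 0≤r 0≤q p≤q r≤s =
    ≤-trans (*-monoʳ-≤-nonNeg r {{nonNegative 0≤r}} p≤q)
            (*-monoˡ-≤-nonNeg q {{nonNegative 0≤q}} r≤s)

  *-pos : ∀ {p q} → 0ℚ < p → 0ℚ < q → 0ℚ < p * q
  *-pos {p} {q} 0<p 0<q =
    positive⁻¹ (p * q) {{pos*pos⇒pos p {{positive 0<p}} q {{positive 0<q}}}}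

  +-pos : ∀ {p q} → 0ℚ < p → 0ℚ ≤ q → 0ℚ < p + q
  +-pos {p} {q} 0<p 0≤q = +-mono-<-≤ 0<p 0≤q

  *-nonNeg : ∀ {p q} → 0ℚ ≤ p → 0ℚ ≤ q → 0ℚ ≤ p * q
  *-nonNeg {p} {q} 0≤p 0≤q =
    nonNegative⁻¹ (p * q) {{nonNeg*nonNeg⇒nonNeg p {{nonNegative 0≤p}} q {{nonNegative 0≤q}}}}

  square-cancel-≤ : ∀ {p q} → 0ℚ ≤ q → p * p < q * q → p ≤ q
  square-cancel-≤ {p} {q} 0≤q pp<qq with ≤-total p q
  ... | inj₁ p≤q = p≤q
  ... | inj₂ q≤p = contradiction
    (<-≤-trans pp<qq (*-mono-≤-nonNeg q p q p 0≤q (≤-trans 0≤q q≤p) q≤p q≤p)) (<-irrefl refl)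

  0<½ : 0ℚ < ½
  0<½ = positive⁻¹ ½

  0<1 : 0ℚ < 1ℚ
  0<1 = positive⁻¹ 1ℚ

  halve-pos : ∀ {ε} → 0ℚ < ε → 0ℚ < ½ * ε
  halve-pos = *-pos 0<½

  halves : ∀ ε → ½ * ε + ½ * ε ≡ ε
  halves = solve 1 (λ ε → con ½ :* ε :+ con ½ :* ε := ε) refl

  -- Reciprocal extended by 0 ↦ 0.
  inv : ℚ → ℚ
  inv p with p ≟ 0ℚ
  ... | yes _  = 0ℚ
  ... | no p≢0 = (1/ p) {{≢-nonZero p≢0}}

  inv-inverseʳ : ∀ {p} → 0ℚ < p → p * inv p ≡ 1ℚ
  inv-inverseʳ {p} 0<p with p ≟ 0ℚ
  ... | yes refl = contradiction 0<p (<-irrefl refl)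
  ... | no p≢0   = *-inverseʳ p {{≢-nonZero p≢0}}

  inv-pos : ∀ {p} → 0ℚ < p → 0ℚ < inv p
  inv-pos {p} 0<p with p ≟ 0ℚ
  ... | yes refl = contradiction 0<p (<-irrefl refl)
  ... | no p≢0   = positive⁻¹ _ {{1/pos⇒pos p {{positive 0<p}}}}

  inv-anti : ∀ {p q} → 0ℚ < p → p ≤ q → inv q ≤ inv p
  inv-anti {p} {q} 0<p p≤q = subst₂ _≤_ e₁ e₂
    (*-monoˡ-≤-nonNeg (inv p * inv q) {{nonNegative (*-nonNeg (<⇒≤ (inv-pos 0<p)) (<⇒≤ (inv-pos 0<q)))}} p≤q)
    where
    0<q = <-≤-trans 0<p p≤q
    e₁ : inv p * inv q * p ≡ inv q
    e₁ = trans (solve 3 (λ a b c → a :* b :* c := (c :* a) :* b) refl (inv p) (inv q) p)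
               (trans (cong (_* inv q) (inv-inverseʳ 0<p)) (*-identityˡ (inv q)))
    e₂ : inv p * inv q * q ≡ inv p
    e₂ = trans (solve 3 (λ a b c → a :* b :* c := (c :* b) :* a) refl (inv p) (inv q) q)
               (trans (cong (_* inv p) (inv-inverseʳ 0<q)) (*-identityˡ (inv p)))

  inv-sub : ∀ {p q} → 0ℚ < p → 0ℚ < q → inv p - inv q ≡ (q - p) * (inv p * inv q)
  inv-sub {p} {q} 0<p 0<q = sym (begin
    (q - p) * (inv p * inv q)                         ≡⟨ solve 4 (λ p q a b → (q :- p) :* (a :* b) := (q :* b) :* a :- (p :* a) :* b) refl p q (inv p) (inv q) ⟩
    (q * inv q) * inv p - (p * inv p) * inv q         ≡⟨ cong₂ (λ u v → u * inv p - v * inv q) (inv-inverseʳ 0<q) (inv-inverseʳ 0<p) ⟩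
    1ℚ * inv p - 1ℚ * inv q                           ≡⟨ cong₂ _-_ (*-identityˡ (inv p)) (*-identityˡ (inv q)) ⟩
    inv p - inv q                                     ∎)
    where open ≡-Reasoning

  /-mono-≤ : ∀ i m j n → i ℤ.* + suc n ℤ.≤ j ℤ.* + suc m → i / suc m ≤ j / suc n
  /-mono-≤ i m j n h = toℚᵘ-cancel-≤
    (ℚᵘ.≤-respˡ-≃ (ℚᵘ.≃-sym (toℚᵘ-fromℚᵘ (ℚᵘ.mkℚᵘ i m)))
    (ℚᵘ.≤-respʳ-≃ (ℚᵘ.≃-sym (toℚᵘ-fromℚᵘ (ℚᵘ.mkℚᵘ j n)))
    (ℚᵘ.*≤* h)))

  ℕ/-mono-≤ : ∀ a m b n → a ℕ.* suc n ℕ.≤ b ℕ.* suc m → + a / suc m ≤ + b / suc n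
  ℕ/-mono-≤ a m b n h = /-mono-≤ (+ a) m (+ b) n
    (subst₂ ℤ._≤_ (ℤ.pos-* a (suc n)) (ℤ.pos-* b (suc m)) (ℤ.+≤+ h))

  ℕ/-* : ∀ a m b n → (+ a / suc m) * (+ b / suc n) ≡ + (a ℕ.* b) / (suc m ℕ.* suc n)
  ℕ/-* a m b n = toℚᵘ-injective
    (ℚᵘ.≃-trans (toℚᵘ-homo-* (+ a / suc m) (+ b / suc n))
    (ℚᵘ.≃-trans (ℚᵘ.*-cong (toℚᵘ-fromℚᵘ (ℚᵘ.mkℚᵘ (+ a) m)) (toℚᵘ-fromℚᵘ (ℚᵘ.mkℚᵘ (+ b) n)))
    (ℚᵘ.≃-trans (ℚᵘ.≃-reflexive (cong (λ i → ℚᵘ._/_ i (suc m ℕ.* suc n)) (sym (ℤ.pos-* a b))))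
    (ℚᵘ.≃-sym (toℚᵘ-fromℚᵘ (ℚᵘ.mkℚᵘ (+ (a ℕ.* b)) (n ℕ.+ m ℕ.* suc n)))))))

  suc/ : ∀ j k → + suc j / suc k ≡ + j / suc k + + 1 / suc k
  suc/ j k = toℚᵘ-injective
    (ℚᵘ.≃-trans (toℚᵘ-fromℚᵘ (ℚᵘ.mkℚᵘ (+ suc j) k))
    (ℚᵘ.≃-trans (ℚᵘ.*≡* (begin
       + suc j ℤ.* (+ suc k ℤ.* + suc k)                    ≡⟨ cong (ℤ._* (+ suc k ℤ.* + suc k)) (cong +_ (ℕ.+-comm 1 j)) ⟩
       (+ j ℤ.+ + 1) ℤ.* (+ suc k ℤ.* + suc k)              ≡⟨ sym (ℤ.*-assoc (+ j ℤ.+ + 1) (+ suc k) (+ suc k)) ⟩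
       (+ j ℤ.+ + 1) ℤ.* + suc k ℤ.* + suc k                ≡⟨ cong (ℤ._* + suc k) (ℤ.*-distribʳ-+ (+ suc k) (+ j) (+ 1)) ⟩
       (+ j ℤ.* + suc k ℤ.+ + 1 ℤ.* + suc k) ℤ.* + suc k    ∎))
    (ℚᵘ.≃-sym (ℚᵘ.≃-trans (toℚᵘ-homo-+ (+ j / suc k) (+ 1 / suc k))
       (ℚᵘ.+-cong (toℚᵘ-fromℚᵘ (ℚᵘ.mkℚᵘ (+ j) k)) (toℚᵘ-fromℚᵘ (ℚᵘ.mkℚᵘ (+ 1) k)))))))
    where open ≡-Reasoning

  archimedean : ∀ {δ} → 0ℚ < δ → ∃[ N ] (∀ n → N ℕ.≤ n → + 1 / suc n ≤ δ)
  archimedean {mkℚ (+ 0) d c} 0<δ = contradiction 0<δ λ { (*<* (ℤ.+<+ ())) }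
  archimedean {mkℚ (-[1+ k ]) d c} 0<δ = contradiction 0<δ λ { (*<* ()) }
  archimedean {δ@(mkℚ (+ suc k) d c)} 0<δ = d , λ n d≤n →
    subst (+ 1 / suc n ≤_) (↥p/↧p≡p δ)
      (ℕ/-mono-≤ 1 n (suc k) d
        (subst (ℕ._≤ suc k ℕ.* suc n) (sym (ℕ.*-identityˡ (suc d)))
          (ℕ.≤-trans (ℕ.s≤s d≤n) (ℕ.m≤m+n (suc n) (k ℕ.* suc n)))))

Cauchy : (ℕ → ℚ) → Set
Cauchy x = ∀ ε → 0ℚ ℚ.< ε →
  ∃[ N ] (∀ i j → N ℕ.≤ i → N ℕ.≤ j → ℚ.∣ x i ℚ.- x j ∣ ℚ.≤ ε)

module Cauchy-Proofs where
  open import Data.Rational.Base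
    using (_≤_; _<_; _+_; _*_; _-_; -_; ∣_∣; _⊔_; 1/_; _/_; nonNegative; positive)
  open import Data.Rational.Properties
  open +-*-Solver using (solve; _:+_; _:*_; _:-_; :-_; _:=_; con)
  open ℚ-Lemmas

  const-cauchy : ∀ q → Cauchy (λ _ → q)
  const-cauchy q ε 0<ε = 0 , λ _ _ _ _ →
    subst (λ z → ∣ z ∣ ≤ ε) (sym (+-inverseʳ q)) (<⇒≤ 0<ε)

  neg-cauchy : ∀ {x} → Cauchy x → Cauchy (λ n → - x n)
  neg-cauchy {x} cx ε 0<ε with cx ε 0<ε
  ... | N , h = N , λ i j N≤i N≤j →
    subst (_≤ ε) (trans (sym (∣-p∣≡∣p∣ (x i - x j))) (cong ∣_∣ (eq (x i) (x j)))) (h i j N≤i N≤j)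
    where
    eq : ∀ a b → - (a - b) ≡ - a - - b
    eq = solve 2 (λ a b → :- (a :- b) := :- a :- :- b) refl

  abs-cauchy : ∀ {x} → Cauchy x → Cauchy (λ n → ∣ x n ∣)
  abs-cauchy {x} cx ε 0<ε with cx ε 0<ε
  ... | N , h = N , λ i j N≤i N≤j → ∣p-q∣≤⁺ (step i j (h i j N≤i N≤j)) (step j i (h j i N≤j N≤i))
    where
    eq : ∀ a b → - (a - b) ≡ - a - - b
    eq = solve 2 (λ a b → :- (a :- b) := :- a :- :- b) refl
    step : ∀ i j → ∣ x i - x j ∣ ≤ ε → ∣ x i ∣ ≤ ∣ x j ∣ + ε
    step i j d = ∣p∣≤
      (≤-trans (∣p-q∣≤⁻ d) (+-monoˡ-≤ ε (p≤∣p∣ (x j))))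
      (≤-trans (p-q≤r⇒p≤q+r (subst (_≤ ε) (eq (x i) (x j)) (≤-trans (-p≤∣p∣ _) d)))
               (+-monoˡ-≤ ε (-p≤∣p∣ (x j))))

  +-cauchy : ∀ {x y} → Cauchy x → Cauchy y → Cauchy (λ n → x n + y n)
  +-cauchy {x} {y} cx cy ε 0<ε = M ℕ.⊔ N , λ i j ≤i ≤j → subst₂ _≤_
    (cong ∣_∣ (eq (x i) (x j) (y i) (y j))) (halves ε)
    (≤-trans (∣p+q∣≤∣p∣+∣q∣ (x i - x j) (y i - y j))
      (+-mono-≤ (g i j (ℕ.≤-trans (ℕ.m≤m⊔n M N) ≤i) (ℕ.≤-trans (ℕ.m≤m⊔n M N) ≤j))
                (h i j (ℕ.≤-trans (ℕ.m≤n⊔m M N) ≤i) (ℕ.≤-trans (ℕ.m≤n⊔m M N) ≤j))))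
    where
    cx′ = cx (½ * ε) (halve-pos 0<ε)
    cy′ = cy (½ * ε) (halve-pos 0<ε)
    M = proj₁ cx′
    g = proj₂ cx′
    N = proj₁ cy′
    h = proj₂ cy′
    eq : ∀ a b c d → (a - b) + (c - d) ≡ (a + c) - (b + d)
    eq = solve 4 (λ a b c d → (a :- b) :+ (c :- d) := (a :+ c) :- (b :+ d)) refl

  p≤p+q : ∀ p q → 0ℚ ≤ q → p ≤ p + q
  p≤p+q p q 0≤q = subst (_≤ p + q) (+-identityʳ p) (+-monoʳ-≤ p 0≤q)

  p≤q+p : ∀ p q → 0ℚ ≤ q → p ≤ q + p
  p≤q+p p q 0≤q = subst (p ≤_) (+-comm p q) (p≤p+q p q 0≤q)

  bounded : ∀ {x} → Cauchy x → ∃[ B ] (1ℚ ≤ B × ∃[ N ] (∀ n → N ℕ.≤ n → ∣ x n ∣ ≤ B))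
  bounded {x} cx = ∣ x N ∣ + 1ℚ , p≤q+p 1ℚ (∣ x N ∣) (0≤∣p∣ (x N)) , N ,
    λ n N≤n → ∣p-q∣≤⁻ {∣ x n ∣} {∣ x N ∣} (proj₂ bx n N N≤n ℕ.≤-refl)
    where
    bx = abs-cauchy {x} cx 1ℚ 0<1
    N = proj₁ bx

  ∣∣-cong-≤ : ∀ u v r → u ≡ v → ∣ v ∣ ≤ r → ∣ u ∣ ≤ r
  ∣∣-cong-≤ u .u r refl h = h

  ∣+∣≤ : ∀ u v p q → ∣ u ∣ ≤ p → ∣ v ∣ ≤ q → ∣ u + v ∣ ≤ p + q
  ∣+∣≤ u v p q h k = ≤-trans (∣p+q∣≤∣p∣+∣q∣ u v) (+-mono-≤ h k)

  ∣*∣≤ : ∀ u v p q → 0ℚ ≤ p → ∣ u ∣ ≤ p → ∣ v ∣ ≤ q → ∣ u * v ∣ ≤ p * q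
  ∣*∣≤ u v p q 0≤p h k = ≤-trans (≤-reflexive (∣p*q∣≡∣p∣*∣q∣ u v))
    (*-mono-≤-nonNeg (∣ u ∣) p (∣ v ∣) q (0≤∣p∣ v) 0≤p h k)

  *-diff : ∀ a b c d → a * c - b * d ≡ a * (c - d) + (a - b) * d
  *-diff = solve 4 (λ a b c d → a :* c :- b :* d := a :* (c :- d) :+ (a :- b) :* d) refl

  *-close : ∀ a b c d A B α β → 0ℚ ≤ A → 0ℚ ≤ β →
            ∣ a ∣ ≤ A → ∣ d ∣ ≤ B → ∣ c - d ∣ ≤ α → ∣ a - b ∣ ≤ β →
            ∣ a * c - b * d ∣ ≤ A * α + β * B
  *-close a b c d A B α β 0≤A 0≤β a≤A d≤B cd≤α ab≤β =
    ∣∣-cong-≤ (a * c - b * d) (a * (c - d) + (a - b) * d) (A * α + β * B) (*-diff a b c d)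
      (∣+∣≤ (a * (c - d)) ((a - b) * d) (A * α) (β * B)
        (∣*∣≤ a (c - d) A α 0≤A a≤A cd≤α)
        (∣*∣≤ (a - b) d β B 0≤β ab≤β d≤B))

  *-rotate : ∀ a e i → a * (e * i) ≡ e * (a * i)
  *-rotate = solve 3 (λ a e i → a :* (e :* i) := e :* (a :* i)) refl

  *-unit : ∀ e u → u ≡ 1ℚ → e * u ≡ e
  *-unit e .1ℚ refl = *-identityʳ e

  inv-cancelˡ : ∀ a e → 0ℚ < a → a * (e * inv a) ≡ e
  inv-cancelˡ a e 0<a = trans (*-rotate a e (inv a)) (*-unit e (a * inv a) (inv-inverseʳ 0<a))

  *-cauchy : ∀ {x y} → Cauchy x → Cauchy y → Cauchy (λ n → x n * y n)
  *-cauchy {x} {y} cx cy ε 0<ε = K , λ i j K≤i K≤j →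
    subst (∣ x i * y i - x j * y j ∣ ≤_) sum≡ε
      (*-close (x i) (x j) (y i) (y j) A B α β (<⇒≤ 0<A) (<⇒≤ 0<β)
        (hA i (ℕ.≤-trans K₁ K≤i)) (hB j (ℕ.≤-trans K₂ K≤j))
        (h i j (ℕ.≤-trans K₄ K≤i) (ℕ.≤-trans K₄ K≤j))
        (g i j (ℕ.≤-trans K₃ K≤i) (ℕ.≤-trans K₃ K≤j)))
    where
    bx = bounded {x} cx
    by = bounded {y} cy
    A = proj₁ bx
    B = proj₁ by
    0<A : 0ℚ < A
    0<A = <-≤-trans 0<1 (proj₁ (proj₂ bx))
    0<B : 0ℚ < B
    0<B = <-≤-trans 0<1 (proj₁ (proj₂ by))
    M₁ = proj₁ (proj₂ (proj₂ bx))
    M₂ = proj₁ (proj₂ (proj₂ by))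
    hA = proj₂ (proj₂ (proj₂ bx))
    hB = proj₂ (proj₂ (proj₂ by))
    α β : ℚ
    α = (½ * ε) * inv A
    β = (½ * ε) * inv B
    0<α : 0ℚ < α
    0<α = *-pos {½ * ε} {inv A} (halve-pos 0<ε) (inv-pos 0<A)
    0<β : 0ℚ < β
    0<β = *-pos {½ * ε} {inv B} (halve-pos 0<ε) (inv-pos 0<B)
    sum≡ε : A * α + β * B ≡ ε
    sum≡ε = trans (cong₂ _+_ (inv-cancelˡ A (½ * ε) 0<A)
                             (trans (*-comm β B) (inv-cancelˡ B (½ * ε) 0<B)))
                  (halves ε)
    cx′ = cx β 0<β
    cy′ = cy α 0<α
    N₁ = proj₁ cx′
    N₂ = proj₁ cy′
    g = proj₂ cx′
    h = proj₂ cy′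
    K = (M₁ ℕ.⊔ M₂) ℕ.⊔ (N₁ ℕ.⊔ N₂)
    K₁ : M₁ ℕ.≤ K
    K₁ = ℕ.≤-trans (ℕ.m≤m⊔n M₁ M₂) (ℕ.m≤m⊔n _ _)
    K₂ : M₂ ℕ.≤ K
    K₂ = ℕ.≤-trans (ℕ.m≤n⊔m M₁ M₂) (ℕ.m≤m⊔n _ _)
    K₃ : N₁ ℕ.≤ K
    K₃ = ℕ.≤-trans (ℕ.m≤m⊔n N₁ N₂) (ℕ.m≤n⊔m (M₁ ℕ.⊔ M₂) _)
    K₄ : N₂ ℕ.≤ K
    K₄ = ℕ.≤-trans (ℕ.m≤n⊔m N₁ N₂) (ℕ.m≤n⊔m (M₁ ℕ.⊔ M₂) _)

  inv-close : ∀ a b q ε → 0ℚ < q → 0ℚ < ε → q ≤ a → q ≤ b →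
              ∣ b - a ∣ ≤ ε * (q * q) → ∣ inv a - inv b ∣ ≤ ε
  inv-close a b q ε 0<q 0<ε q≤a q≤b h = begin
    ∣ inv a - inv b ∣                   ≡⟨ cong ∣_∣ (inv-sub 0<a 0<b) ⟩
    ∣ (b - a) * (inv a * inv b) ∣       ≡⟨ ∣p*q∣≡∣p∣*∣q∣ (b - a) (inv a * inv b) ⟩
    ∣ b - a ∣ * ∣ inv a * inv b ∣       ≡⟨ cong (∣ b - a ∣ *_) (0≤p⇒∣p∣≡p 0≤inv) ⟩
    ∣ b - a ∣ * (inv a * inv b)
      ≤⟨ *-mono-≤-nonNeg (∣ b - a ∣) (ε * (q * q)) (inv a * inv b) (inv q * inv q) 0≤inv
           (<⇒≤ (*-pos {ε} {q * q} 0<ε (*-pos {q} {q} 0<q 0<q))) h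
           (*-mono-≤-nonNeg (inv a) (inv q) (inv b) (inv q) (<⇒≤ (inv-pos 0<b)) (<⇒≤ (inv-pos 0<q))
             (inv-anti 0<q q≤a) (inv-anti 0<q q≤b)) ⟩
    ε * (q * q) * (inv q * inv q)       ≡⟨ solve 3 (λ e q r → e :* (q :* q) :* (r :* r) := e :* ((q :* r) :* (q :* r))) refl ε q (inv q) ⟩
    ε * ((q * inv q) * (q * inv q))     ≡⟨ cong (λ u → ε * (u * u)) (inv-inverseʳ 0<q) ⟩
    ε * 1ℚ                              ≡⟨ *-identityʳ ε ⟩
    ε                                   ∎
    where
    open ≤-Reasoning
    0<a : 0ℚ < a
    0<a = <-≤-trans 0<q q≤a
    0<b : 0ℚ < b
    0<b = <-≤-trans 0<q q≤b
    0≤inv : 0ℚ ≤ inv a * inv b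
    0≤inv = <⇒≤ (*-pos {inv a} {inv b} (inv-pos 0<a) (inv-pos 0<b))

  inv-cauchy : ∀ {x q} → 0ℚ < q → ∃[ N ] (∀ n → N ℕ.≤ n → q ≤ x n) →
               Cauchy x → Cauchy (λ n → inv (x n))
  inv-cauchy {x} {q} 0<q (M , q≤x) cx ε 0<ε = M ℕ.⊔ N , λ i j ≤i ≤j →
    inv-close (x i) (x j) q ε 0<q 0<ε
      (q≤x i (ℕ.≤-trans (ℕ.m≤m⊔n M N) ≤i)) (q≤x j (ℕ.≤-trans (ℕ.m≤m⊔n M N) ≤j))
      (h j i (ℕ.≤-trans (ℕ.m≤n⊔m M N) ≤j) (ℕ.≤-trans (ℕ.m≤n⊔m M N) ≤i))
    where
    cx′ = cx (ε * (q * q)) (*-pos {ε} {q * q} 0<ε (*-pos {q} {q} 0<q 0<q))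
    N = proj₁ cx′
    h = proj₂ cx′

  nested-cauchy : ∀ {l u w : ℕ → ℚ} →
    (∀ n → l n ≤ l (suc n)) → (∀ n → u (suc n) ≤ u n) → (∀ n → l n ≤ u n) →
    (∀ n → u n ≤ l n + w n) →
    (∀ ε → 0ℚ < ε → ∃[ N ] (∀ n → N ℕ.≤ n → w n ≤ ε)) → Cauchy l
  nested-cauchy {l} {u} {w} l↗ u↘ l≤u width w→0 ε 0<ε with w→0 ε 0<ε
  ... | N , h = N , λ i j N≤i N≤j → ∣p-q∣≤⁺ (step i j N≤j) (step j i N≤i)
    where
    l-mono : ∀ i d → l i ≤ l (d ℕ.+ i)
    l-mono i zero    = ≤-refl
    l-mono i (suc d) = ≤-trans (l-mono i d) (l↗ (d ℕ.+ i))
    u-anti : ∀ i d → u (d ℕ.+ i) ≤ u i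
    u-anti i zero    = ≤-refl
    u-anti i (suc d) = ≤-trans (u↘ (d ℕ.+ i)) (u-anti i d)
    l≤u′ : ∀ i j → l i ≤ u j
    l≤u′ i j = ≤-trans (subst (λ k → l i ≤ l k) (ℕ.+-comm j i) (l-mono i j))
               (≤-trans (l≤u (i ℕ.+ j)) (u-anti j i))
    step : ∀ i j → N ℕ.≤ j → l i ≤ l j + ε
    step i j N≤j = ≤-trans (l≤u′ i j) (≤-trans (width j) (+-monoʳ-≤ (l j) (h j N≤j)))

  greatest : ∀ {P : ℕ → Set} → Decidable P → ℕ → ℕ
  greatest P? zero    = zero
  greatest P? (suc b) with P? (suc b)
  ... | yes _ = suc b
  ... | no  _ = greatest P? b

  greatest-holds : ∀ {P : ℕ → Set} (P? : Decidable P) b → P 0 → P (greatest P? b)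
  greatest-holds P? zero    p₀ = p₀
  greatest-holds P? (suc b) p₀ with P? (suc b)
  ... | yes p = p
  ... | no  _ = greatest-holds P? b p₀

  greatest-maximal : ∀ {P : ℕ → Set} (P? : Decidable P) b → ¬ P (suc b) → ¬ P (suc (greatest P? b))
  greatest-maximal P? zero    ¬p = ¬p
  greatest-maximal P? (suc b) ¬p with P? (suc b)
  ... | yes _  = ¬p
  ... | no ¬p′ = greatest-maximal P? b ¬p′

  -- sqrt-approx k x is the largest multiple of 1/(k+1) whose square is at
  -- most max(x,0); the search bound (k+1)(∣numerator∣+1) is never too small.
  SquareBelow : ℕ → ℚ → ℕ → Set
  SquareBelow k x j = (+ j / suc k) * (+ j / suc k) ≤ 0ℚ ⊔ x

  squareBelow? : ∀ k x → Decidable (SquareBelow k x)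
  squareBelow? k x j = (+ j / suc k) * (+ j / suc k) ≤? 0ℚ ⊔ x

  search-bound : ℕ → ℚ → ℕ
  search-bound k x = suc ℤ.∣ ℚ.ℚ.numerator x ∣ ℕ.* suc k

  sqrt-approx : ℕ → ℚ → ℚ
  sqrt-approx k x = + greatest (squareBelow? k x) (search-bound k x) / suc k

  ≤suc∣num∣ : ∀ x → x ≤ + suc ℤ.∣ ℚ.ℚ.numerator x ∣ / 1
  ≤suc∣num∣ x@(mkℚ (+ n) d c) = subst (_≤ + suc n / 1) (↥p/↧p≡p x)
    (ℕ/-mono-≤ n d (suc n) 0 (ℕ.*-mono-≤ (ℕ.n≤1+n n) (ℕ.s≤s ℕ.z≤n)))
  ≤suc∣num∣ x@(mkℚ -[1+ n ] d c) =
    ≤-trans {x} {0ℚ} (nonPositive⁻¹ x) (ℕ/-mono-≤ 0 0 (suc (suc n)) 0 ℕ.z≤n)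

  search-bound-suffices : ∀ k x → ¬ SquareBelow k x (suc (search-bound k x))
  search-bound-suffices k x h = <-irrefl refl (<-≤-trans {0ℚ ⊔ x} {t} {0ℚ ⊔ x} max<t t≤max)
    where
    s t : ℚ
    s = + suc ℤ.∣ ℚ.ℚ.numerator x ∣ / 1
    t = + suc (search-bound k x) / suc k
    u = + search-bound k x / suc k
    1/k>0 : 0ℚ < + 1 / suc k
    1/k>0 = positive⁻¹ (+ 1 / suc k) {{normalize-pos 1 (suc k)}}
    s≤u : s ≤ u
    s≤u = ℕ/-mono-≤ (suc ℤ.∣ ℚ.ℚ.numerator x ∣) 0 (search-bound k x) k
            (ℕ.≤-reflexive (sym (ℕ.*-identityʳ (search-bound k x))))
    u<t : u < t
    u<t = subst₂ _<_ (+-identityʳ u) (sym (suc/ (search-bound k x) k)) (+-monoʳ-< u 1/k>0)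
    s<t : s < t
    s<t = ≤-<-trans {s} {u} {t} s≤u u<t
    1≤s : 1ℚ ≤ s
    1≤s = ℕ/-mono-≤ 1 0 (suc ℤ.∣ ℚ.ℚ.numerator x ∣) 0 (ℕ.s≤s ℕ.z≤n)
    1≤t : 1ℚ ≤ t
    1≤t = ≤-trans {1ℚ} {s} {t} 1≤s (<⇒≤ s<t)
    0≤t : 0ℚ ≤ t
    0≤t = ≤-trans {0ℚ} {1ℚ} {t} (<⇒≤ 0<1) 1≤t
    0≤s : 0ℚ ≤ s
    0≤s = ≤-trans {0ℚ} {1ℚ} {s} (<⇒≤ 0<1) 1≤s
    max<t : 0ℚ ⊔ x < t
    max<t = ≤-<-trans {0ℚ ⊔ x} {s} {t} (⊔-lub {s} {0ℚ} {x} 0≤s (≤suc∣num∣ x)) s<t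
    t≤max : t ≤ 0ℚ ⊔ x
    t≤max = ≤-trans {t} {t * t} {0ℚ ⊔ x}
      (subst (_≤ t * t) (*-identityˡ t) (*-mono-≤-nonNeg 1ℚ t t t 0≤t 0≤t 1≤t ≤-refl)) h

  sqrt-approx-nonNeg : ∀ k x → 0ℚ ≤ sqrt-approx k x
  sqrt-approx-nonNeg k x =
    ℕ/-mono-≤ 0 0 (greatest (squareBelow? k x) (search-bound k x)) k ℕ.z≤n

  sqrt-approx-lower : ∀ k x → sqrt-approx k x * sqrt-approx k x ≤ 0ℚ ⊔ x
  sqrt-approx-lower k x = greatest-holds {SquareBelow k x} (squareBelow? k x) (search-bound k x)
    (subst (λ q → q * q ≤ 0ℚ ⊔ x) (sym (0/n≡0 (suc k))) (p≤p⊔q 0ℚ x))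

  sqrt-approx-upper : ∀ k x →
    0ℚ ⊔ x < (sqrt-approx k x + + 1 / suc k) * (sqrt-approx k x + + 1 / suc k)
  sqrt-approx-upper k x = ≰⇒> λ h →
    greatest-maximal {SquareBelow k x} (squareBelow? k x) (search-bound k x)
      (search-bound-suffices k x)
      (subst (λ q → q * q ≤ 0ℚ ⊔ x)
             (sym (suc/ (greatest (squareBelow? k x) (search-bound k x)) k)) h)

  square-+ : ∀ s e → s * s + e * e + (s * e + s * e) ≡ (s + e) * (s + e)
  square-+ = solve 2 (λ s e → s :* s :+ e :* e :+ (s :* e :+ s :* e) := (s :+ e) :* (s :+ e)) refl

  root-close : ∀ r p u e a b → 0ℚ ≤ p → 0ℚ ≤ u → 0ℚ ≤ e → 0ℚ ≤ b →
               r * r ≤ a → b < (p + u) * (p + u) → a ≤ b + e * e → u ≤ e → r ≤ p + (e + e)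
  root-close r p u e a b 0≤p 0≤u 0≤e 0≤b rr≤a b<ss a≤b+ee u≤e =
    ≤-trans {r} {s + e} {p + (e + e)} (square-cancel-≤ {r} {s + e} 0≤s+e rr<)
      (subst (s + e ≤_) (+-assoc p e e) (+-monoˡ-≤ e s≤))
    where
    s : ℚ
    s = p + u
    s≤ : s ≤ p + e
    s≤ = +-monoʳ-≤ p u≤e
    0≤s : 0ℚ ≤ s
    0≤s = ≤-trans {0ℚ} {p} {s} 0≤p (p≤p+q p u 0≤u)
    0≤s+e : 0ℚ ≤ s + e
    0≤s+e = ≤-trans {0ℚ} {s} {s + e} 0≤s (p≤p+q s e 0≤e)
    0≤se : 0ℚ ≤ s * e
    0≤se = *-nonNeg {s} {e} 0≤s 0≤e
    0≤se+se : 0ℚ ≤ s * e + s * e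
    0≤se+se = ≤-trans {0ℚ} {s * e} {s * e + s * e} 0≤se (p≤p+q (s * e) (s * e) 0≤se)
    b+ee< : b + e * e < s * s + e * e
    b+ee< = +-monoˡ-< (e * e) b<ss
    ss+ee≤ : s * s + e * e ≤ (s + e) * (s + e)
    ss+ee≤ = subst (s * s + e * e ≤_) (square-+ s e) (p≤p+q (s * s + e * e) (s * e + s * e) 0≤se+se)
    rr≤ : r * r ≤ b + e * e
    rr≤ = ≤-trans {r * r} {a} {b + e * e} rr≤a a≤b+ee
    rr< : r * r < (s + e) * (s + e)
    rr< = ≤-<-trans {r * r} {b + e * e} {(s + e) * (s + e)} rr≤
            (<-≤-trans {b + e * e} {s * s + e * e} {(s + e) * (s + e)} b+ee< ss+ee≤)

  ⊔-+-mono : ∀ a b d → 0ℚ ≤ d → a ≤ b + d → 0ℚ ⊔ a ≤ (0ℚ ⊔ b) + d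
  ⊔-+-mono a b d 0≤d h = ⊔-lub {(0ℚ ⊔ b) + d} {0ℚ} {a}
    (≤-trans {0ℚ} {0ℚ ⊔ b} {(0ℚ ⊔ b) + d} (p≤p⊔q 0ℚ b) (p≤p+q (0ℚ ⊔ b) d 0≤d))
    (≤-trans {a} {b + d} {(0ℚ ⊔ b) + d} h (+-monoˡ-≤ d (p≤q⊔p 0ℚ b)))

  0≤1/suc : ∀ j → 0ℚ ≤ + 1 / suc j
  0≤1/suc j = ℕ/-mono-≤ 0 0 1 j ℕ.z≤n

  sqrt-close : ∀ i j a b e → 0ℚ ≤ e → a ≤ b + e * e → + 1 / suc j ≤ e →
               sqrt-approx i a ≤ sqrt-approx j b + (e + e)
  sqrt-close i j a b e 0≤e a≤b+ee 1/j≤e =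
    root-close (sqrt-approx i a) (sqrt-approx j b) (+ 1 / suc j) e (0ℚ ⊔ a) (0ℚ ⊔ b)
      (sqrt-approx-nonNeg j b) (0≤1/suc j) 0≤e (p≤p⊔q 0ℚ b)
      (sqrt-approx-lower i a) (sqrt-approx-upper j b)
      (⊔-+-mono a b (e * e) (*-nonNeg {e} {e} 0≤e 0≤e) a≤b+ee) 1/j≤e

  sqrt-cauchy : ∀ {x} → Cauchy x → Cauchy (λ n → sqrt-approx n (x n))
  sqrt-cauchy {x} cx ε 0<ε = M ℕ.⊔ N , λ i j ≤i ≤j →
    ∣p-q∣≤⁺ {sqrt-approx i (x i)} {sqrt-approx j (x j)} {ε} (step i j ≤i ≤j) (step j i ≤j ≤i)
    where
    e : ℚ
    e = ½ * ε
    0<e : 0ℚ < e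
    0<e = halve-pos 0<ε
    cx′ = cx (e * e) (*-pos {e} {e} 0<e 0<e)
    arch = archimedean {e} 0<e
    M = proj₁ cx′
    N = proj₁ arch
    step : ∀ i j → M ℕ.⊔ N ℕ.≤ i → M ℕ.⊔ N ℕ.≤ j →
           sqrt-approx i (x i) ≤ sqrt-approx j (x j) + ε
    step i j ≤i ≤j = subst (λ z → sqrt-approx i (x i) ≤ sqrt-approx j (x j) + z) (halves ε)
      (sqrt-close i j (x i) (x j) e (<⇒≤ 0<e)
        (∣p-q∣≤⁻ {x i} {x j} {e * e}
          (proj₂ cx′ i j (ℕ.≤-trans (ℕ.m≤m⊔n M N) ≤i) (ℕ.≤-trans (ℕ.m≤m⊔n M N) ≤j)))
        (proj₂ arch j (ℕ.≤-trans (ℕ.m≤n⊔m M N) ≤j)))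

  root-lower : ∀ q p u b → 0ℚ ≤ p → 0ℚ ≤ u → q * q ≤ b → b < (p + u) * (p + u) → q ≤ p + u
  root-lower q p u b 0≤p 0≤u qq≤b b< = square-cancel-≤ {q} {p + u}
    (≤-trans {0ℚ} {p} {p + u} 0≤p (p≤p+q p u 0≤u))
    (≤-<-trans {q * q} {b} {(p + u) * (p + u)} qq≤b b<)

  +-weaken : ∀ q p u δ → q ≤ p + u → u ≤ δ → q ≤ p + δ
  +-weaken q p u δ h k = ≤-trans {q} {p + u} {p + δ} h (+-monoʳ-≤ p k)

  sqrt-lower-at : ∀ n y q δ → q * q ≤ y → + 1 / suc n ≤ δ → q ≤ sqrt-approx n y + δ
  sqrt-lower-at n y q δ qq≤y 1/n≤δ =
    +-weaken q (sqrt-approx n y) (+ 1 / suc n) δ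
      (root-lower q (sqrt-approx n y) (+ 1 / suc n) (0ℚ ⊔ y)
        (sqrt-approx-nonNeg n y) (0≤1/suc n)
        (≤-trans {q * q} {y} {0ℚ ⊔ y} qq≤y (p≤q⊔p 0ℚ y))
        (sqrt-approx-upper n y))
      1/n≤δ

  sqrt-lower : ∀ (x : ℕ → ℚ) q → (∀ n → q * q ≤ x n) → ∀ δ → 0ℚ < δ →
               ∃[ N ] (∀ n → N ℕ.≤ n → q ≤ sqrt-approx n (x n) + δ)
  sqrt-lower x q qq≤x δ 0<δ = proj₁ arch , bound
    where
    arch : ∃[ N ] (∀ n → N ℕ.≤ n → + 1 / suc n ≤ δ)
    arch = archimedean {δ} 0<δ
    bound : ∀ n → proj₁ arch ℕ.≤ n → q ≤ sqrt-approx n (x n) + δ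
    bound n N≤n = sqrt-lower-at n (x n) q δ (qq≤x n) (proj₂ arch n N≤n)

  -- wallis n = 2 ∏_{j=1}^{n} (2j/(2j-1)) (2j/(2j+1)); wallis-odd k and
  -- wallis-even k are the two factors at j = k+1.  The products increase,
  -- and wallis-upper decreases, to the common limit π.
  wallis-odd wallis-even wallis wallis-upper : ℕ → ℚ
  wallis-odd k  = + (2 ℕ.* suc k) / suc (2 ℕ.* k)
  wallis-even k = + (2 ℕ.* suc k) / suc (2 ℕ.* suc k)
  wallis zero    = + 2 / 1
  wallis (suc k) = wallis k * wallis-odd k * wallis-even k
  wallis-upper k = wallis k * wallis-odd k

  *-increase : ∀ w r → 0ℚ ≤ w → 1ℚ ≤ r → w ≤ w * r
  *-increase w r 0≤w 1≤r =
    subst (_≤ w * r) (*-identityʳ w) (*-monoˡ-≤-nonNeg w {{nonNegative 0≤w}} 1≤r)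

  *-decrease : ∀ w r → 0ℚ ≤ w → r ≤ 1ℚ → w * r ≤ w
  *-decrease w r 0≤w r≤1 =
    subst (w * r ≤_) (*-identityʳ w) (*-monoˡ-≤-nonNeg w {{nonNegative 0≤w}} r≤1)

  2*suc : ∀ k → 2 ℕ.* suc k ≡ suc (suc (2 ℕ.* k))
  2*suc k = ℕ.*-suc 2 k

  n[n+2]≤[n+1]² : ∀ n → n ℕ.* suc (suc n) ℕ.≤ suc n ℕ.* suc n
  n[n+2]≤[n+1]² n = subst (n ℕ.* suc (suc n) ℕ.≤_) (sym (ℕ.*-suc (suc n) n))
    (subst (ℕ._≤ suc n ℕ.+ (n ℕ.+ n ℕ.* n)) (sym (trans (ℕ.*-suc n (suc n)) (cong (n ℕ.+_) (ℕ.*-suc n n))))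
      (ℕ.n≤1+n (n ℕ.+ (n ℕ.+ n ℕ.* n))))

  odd*even≥1 : ∀ k → 1ℚ ≤ wallis-odd k * wallis-even k
  odd*even≥1 k = subst (1ℚ ≤_) (sym (ℕ/-* a (2 ℕ.* k) a a))
    (ℕ/-mono-≤ 1 0 (a ℕ.* a) (a ℕ.+ (2 ℕ.* k) ℕ.* suc a)
      (subst₂ ℕ._≤_ (sym (ℕ.*-identityˡ (suc (2 ℕ.* k) ℕ.* suc a))) (sym (ℕ.*-identityʳ (a ℕ.* a)))
        (subst (λ z → suc (2 ℕ.* k) ℕ.* suc z ℕ.≤ z ℕ.* z) (sym (2*suc k)) (n[n+2]≤[n+1]² (suc (2 ℕ.* k))))))
    where a = 2 ℕ.* suc k

  even*odd≤1 : ∀ k → wallis-even k * wallis-odd (suc k) ≤ 1ℚ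
  even*odd≤1 k = subst (_≤ 1ℚ) (sym (ℕ/-* a a b a))
    (ℕ/-mono-≤ (a ℕ.* b) (a ℕ.+ a ℕ.* suc a) 1 0
      (subst₂ ℕ._≤_ (sym (ℕ.*-identityʳ (a ℕ.* b))) (sym (ℕ.*-identityˡ (suc a ℕ.* suc a)))
        (subst (λ z → a ℕ.* z ℕ.≤ suc a ℕ.* suc a) (sym (2*suc (suc k))) (n[n+2]≤[n+1]² a))))
    where
    a = 2 ℕ.* suc k
    b = 2 ℕ.* suc (suc k)

  odd≡ : ∀ k → wallis-odd k ≡ 1ℚ + + 1 / suc (2 ℕ.* k)
  odd≡ k = trans (cong (λ z → + z / suc (2 ℕ.* k)) (2*suc k))
    (trans (suc/ (suc (2 ℕ.* k)) (2 ℕ.* k)) (cong (_+ + 1 / suc (2 ℕ.* k)) n/n≡1))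
    where
    n/n≡1 : + suc (2 ℕ.* k) / suc (2 ℕ.* k) ≡ 1ℚ
    n/n≡1 = ≤-antisym
      (ℕ/-mono-≤ (suc (2 ℕ.* k)) (2 ℕ.* k) 1 0 (ℕ.≤-reflexive (ℕ.*-comm (suc (2 ℕ.* k)) 1)))
      (ℕ/-mono-≤ 1 0 (suc (2 ℕ.* k)) (2 ℕ.* k) (ℕ.≤-reflexive (ℕ.*-comm 1 (suc (2 ℕ.* k)))))

  1≤odd : ∀ k → 1ℚ ≤ wallis-odd k
  1≤odd k = subst (1ℚ ≤_) (sym (odd≡ k)) (p≤p+q 1ℚ (+ 1 / suc (2 ℕ.* k)) (0≤1/suc (2 ℕ.* k)))

  ↗-step : ∀ w a b → 0ℚ ≤ w → 1ℚ ≤ a * b → w ≤ w * a * b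
  ↗-step w a b 0≤w 1≤ab = subst (w ≤_) (sym (*-assoc w a b)) (*-increase w (a * b) 0≤w 1≤ab)

  ↘-step : ∀ w a b → 0ℚ ≤ w → a * b ≤ 1ℚ → w * a * b ≤ w
  ↘-step w a b 0≤w ab≤1 = subst (_≤ w) (sym (*-assoc w a b)) (*-decrease w (a * b) 0≤w ab≤1)

  2≤wallis : ∀ k → + 2 / 1 ≤ wallis k
  wallis-nonNeg : ∀ k → 0ℚ ≤ wallis k
  wallis-↗ : ∀ k → wallis k ≤ wallis (suc k)

  wallis-nonNeg k = ≤-trans {0ℚ} {+ 2 / 1} {wallis k} (ℕ/-mono-≤ 0 0 2 0 ℕ.z≤n) (2≤wallis k)
  wallis-↗ k = ↗-step (wallis k) (wallis-odd k) (wallis-even k) (wallis-nonNeg k) (odd*even≥1 k)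
  2≤wallis zero    = ≤-refl
  2≤wallis (suc k) = ≤-trans {+ 2 / 1} {wallis k} {wallis (suc k)} (2≤wallis k) (wallis-↗ k)

  wallis≤upper : ∀ k → wallis k ≤ wallis-upper k
  wallis≤upper k = *-increase (wallis k) (wallis-odd k) (wallis-nonNeg k) (1≤odd k)

  wallis-upper-nonNeg : ∀ k → 0ℚ ≤ wallis-upper k
  wallis-upper-nonNeg k = ≤-trans {0ℚ} {wallis k} {wallis-upper k} (wallis-nonNeg k) (wallis≤upper k)

  wallis-upper-↘ : ∀ k → wallis-upper (suc k) ≤ wallis-upper k
  wallis-upper-↘ k = ↘-step (wallis-upper k) (wallis-even k) (wallis-odd (suc k))
    (wallis-upper-nonNeg k) (even*odd≤1 k)

  wallis-upper≤4 : ∀ k → wallis-upper k ≤ + 4 / 1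
  wallis-upper≤4 zero    = ≤-refl
  wallis-upper≤4 (suc k) = ≤-trans {wallis-upper (suc k)} {wallis-upper k} {+ 4 / 1} (wallis-upper-↘ k) (wallis-upper≤4 k)

  *-1+ : ∀ w r → w * (1ℚ + r) ≡ w + w * r
  *-1+ w r = trans (*-distribˡ-+ w 1ℚ r) (cong (_+ w * r) (*-identityʳ w))

  wallis-width : ∀ k → wallis-upper k ≤ wallis k + + 4 / 1 * (+ 1 / suc k)
  wallis-width k = subst (_≤ wallis k + + 4 / 1 * (+ 1 / suc k))
    (sym (trans (cong (λ z → wallis k * z) (odd≡ k)) (*-1+ (wallis k) (+ 1 / suc (2 ℕ.* k)))))
    (+-monoʳ-≤ (wallis k) bound)
    where
    1/≤ : + 1 / suc (2 ℕ.* k) ≤ + 1 / suc k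
    1/≤ = ℕ/-mono-≤ 1 (2 ℕ.* k) 1 k (ℕ.*-monoʳ-≤ 1 (ℕ.s≤s (ℕ.m≤m+n k (k ℕ.+ 0))))
    bound : wallis k * (+ 1 / suc (2 ℕ.* k)) ≤ + 4 / 1 * (+ 1 / suc k)
    bound = *-mono-≤-nonNeg (wallis k) (+ 4 / 1) (+ 1 / suc (2 ℕ.* k)) (+ 1 / suc k)
      (0≤1/suc (2 ℕ.* k)) (ℕ/-mono-≤ 0 0 4 0 ℕ.z≤n)
      (≤-trans {wallis k} {wallis-upper k} {+ 4 / 1} (wallis≤upper k) (wallis-upper≤4 k)) 1/≤

  4/n→0 : ∀ ε → 0ℚ < ε → ∃[ N ] (∀ n → N ℕ.≤ n → + 4 / 1 * (+ 1 / suc n) ≤ ε)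
  4/n→0 ε 0<ε = proj₁ arch , λ n N≤n → subst (+ 4 / 1 * (+ 1 / suc n) ≤_) (4*¼ ε)
    (*-monoˡ-≤-nonNeg (+ 4 / 1) (proj₂ arch n N≤n))
    where
    4*¼ : ∀ ε → + 4 / 1 * ((+ 1 / 4) * ε) ≡ ε
    4*¼ ε = trans (sym (*-assoc (+ 4 / 1) (+ 1 / 4) ε)) (*-identityˡ ε)
    arch : ∃[ N ] (∀ n → N ℕ.≤ n → + 1 / suc n ≤ (+ 1 / 4) * ε)
    arch = archimedean {(+ 1 / 4) * ε} (*-pos {+ 1 / 4} {ε} (positive⁻¹ (+ 1 / 4)) 0<ε)

  wallis-cauchy : Cauchy wallis
  wallis-cauchy = nested-cauchy {wallis} {wallis-upper} {λ k → + 4 / 1 * (+ 1 / suc k)}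
    wallis-↗ wallis-upper-↘ wallis≤upper wallis-width 4/n→0

open ℚ-Lemmas using (0<½; inv; *-pos)
open Cauchy-Proofs

-- A real number is a Cauchy sequence of rationals; sequences with the same
-- limit represent the same real, and the relations below respect this.
record ℝ : Set where
  constructor mkℝ
  field
    seq    : ℕ → ℚ
    cauchy : Cauchy seq

open ℝ public

infix  4 _≤_ _<_
infixl 6 _+_ _-_
infixl 7 _*_ _/_[_]
infix  8 -_

_≤_ : ℝ → ℝ → Set
x ≤ y = ∀ ε → 0ℚ ℚ.< ε → ∃[ N ] (∀ n → N ℕ.≤ n → seq x n ℚ.≤ seq y n ℚ.+ ε)

_<_ : ℝ → ℝ → Set
x < y = ∃[ ε ] (0ℚ ℚ.< ε × ∃[ N ] (∀ n → N ℕ.≤ n → seq x n ℚ.+ ε ℚ.≤ seq y n))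

fromℚ : ℚ → ℝ
fromℚ q = mkℝ (λ _ → q) (const-cauchy q)

fromℕ : ℕ → ℝ
fromℕ n = fromℚ (+ n ℚ./ 1)

0ℝ : ℝ
0ℝ = fromℚ 0ℚ

-_ : ℝ → ℝ
- x = mkℝ (λ n → ℚ.- seq x n) (neg-cauchy {seq x} (cauchy x))

_+_ : ℝ → ℝ → ℝ
x + y = mkℝ (λ n → seq x n ℚ.+ seq y n) (+-cauchy {seq x} {seq y} (cauchy x) (cauchy y))

_-_ : ℝ → ℝ → ℝ
x - y = x + - y

_*_ : ℝ → ℝ → ℝ
x * y = mkℝ (λ n → seq x n ℚ.* seq y n) (*-cauchy {seq x} {seq y} (cauchy x) (cauchy y))

∣_∣ : ℝ → ℝ
∣ x ∣ = mkℝ (λ n → ℚ.∣ seq x n ∣) (abs-cauchy {seq x} (cauchy x))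

-- The positivity proof only supplies the Cauchy modulus; inv sends the finitely
-- many terms that may vanish to 0.
recip : (x : ℝ) → 0ℝ < x → ℝ
recip x (q , 0<q , N , q≤x) = mkℝ (λ n → inv (seq x n))
  (inv-cauchy {seq x} {q} 0<q
    (N , λ n N≤n → subst (ℚ._≤ seq x n) (ℚ.+-identityˡ q) (q≤x n N≤n)) (cauchy x))

_/_[_] : (x y : ℝ) → 0ℝ < y → ℝ
x / y [ 0<y ] = x * recip y 0<y

-- Negative reals have square root 0.
√ : ℝ → ℝ
√ x = mkℝ (λ n → sqrt-approx n (seq x n)) (sqrt-cauchy {seq x} (cauchy x))

-- Wallis' product π = 2 ∏_{j≥1} (2j/(2j-1)) (2j/(2j+1)).
π : ℝ
π = mkℝ wallis wallis-cauchy

-- f(n) ∼ g(n) as n → ∞, in the form f - g = o(g).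
infix 4 _∼_
_∼_ : (f g : (n : ℕ) → .{{ℕ.NonZero n}} → ℝ) → Set
f ∼ g = ∀ ε → 0ℚ ℚ.< ε →
  ∃[ N ] (∀ n → .{{_ : ℕ.NonZero n}} → N ℕ.≤ n → ∣ f n - g n ∣ ≤ fromℚ ε * ∣ g n ∣)

module Positivity where

  fromℚ-positive : ∀ q → 0ℚ ℚ.< q → 0ℝ < fromℚ q
  fromℚ-positive q 0<q = q , 0<q , 0 , λ _ _ → ℚ.≤-reflexive (ℚ.+-identityˡ q)

  *-positive : ∀ x y → 0ℝ < x → 0ℝ < y → 0ℝ < x * y
  *-positive x y (p , 0<p , M , hx) (q , 0<q , N , hy) =
    p ℚ.* q , *-pos {p} {q} 0<p 0<q , M ℕ.⊔ N , λ n ≤n →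
      product (seq x n) (seq y n) (hx n (ℕ.≤-trans (ℕ.m≤m⊔n M N) ≤n)) (hy n (ℕ.≤-trans (ℕ.m≤n⊔m M N) ≤n))
    where
    product : ∀ a b → 0ℚ ℚ.+ p ℚ.≤ a → 0ℚ ℚ.+ q ℚ.≤ b → 0ℚ ℚ.+ p ℚ.* q ℚ.≤ a ℚ.* b
    product a b hp hq = subst (ℚ._≤ a ℚ.* b) (sym (ℚ.+-identityˡ (p ℚ.* q)))
      (ℚ-Lemmas.*-mono-≤-nonNeg p a q b (ℚ.<⇒≤ 0<q)
        (ℚ.≤-trans {0ℚ} {p} {a} (ℚ.<⇒≤ 0<p) p≤a) p≤a (subst (ℚ._≤ b) (ℚ.+-identityˡ q) hq))
      where
      p≤a : p ℚ.≤ a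
      p≤a = subst (ℚ._≤ a) (ℚ.+-identityˡ p) hp

  √-lower : ∀ x p δ → 0ℚ ℚ.< δ → (∀ n → (p ℚ.+ δ ℚ.+ δ) ℚ.* (p ℚ.+ δ ℚ.+ δ) ℚ.≤ seq x n) →
            fromℚ p < √ x
  √-lower x p δ 0<δ h = δ , 0<δ , proj₁ lower , λ n N≤n →
    cancel (sqrt-approx n (seq x n)) (proj₂ lower n N≤n)
    where
    lower : ∃[ N ] (∀ n → N ℕ.≤ n → p ℚ.+ δ ℚ.+ δ ℚ.≤ sqrt-approx n (seq x n) ℚ.+ δ)
    lower = sqrt-lower (seq x) (p ℚ.+ δ ℚ.+ δ) h δ 0<δ
    cancel : ∀ r → p ℚ.+ δ ℚ.+ δ ℚ.≤ r ℚ.+ δ → p ℚ.+ δ ℚ.≤ r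
    cancel r le = subst₂ ℚ._≤_ (add-sub (p ℚ.+ δ)) (add-sub r) (ℚ.+-monoˡ-≤ (ℚ.- δ) le)
      where
      add-sub : ∀ q → q ℚ.+ δ ℚ.- δ ≡ q
      add-sub q = trans (ℚ.+-assoc q δ (ℚ.- δ)) (trans (cong (q ℚ.+_) (ℚ.+-inverseʳ δ)) (ℚ.+-identityʳ q))

  √-positive : ∀ n → .{{ℕ.NonZero n}} → 0ℝ < √ (fromℕ n)
  √-positive n = √-lower (fromℕ n) 0ℚ ½ 0<½ (λ _ → 1≤n)
    where
    1≤n : 1ℚ ℚ.≤ + n ℚ./ 1
    1≤n = ℚ-Lemmas.ℕ/-mono-≤ 1 0 n 0 (ℕ.*-monoˡ-≤ 1 (ℕ.>-nonZero⁻¹ n))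

  π-positive : 0ℝ < π
  π-positive = + 2 ℚ./ 1 , toWitness {a? = 0ℚ ℚ.<? + 2 ℚ./ 1} tt , 0 , λ n _ → 2≤wallis n

  √5>2 : fromℕ 2 < √ (fromℕ 5)
  √5>2 = √-lower (fromℕ 5) (+ 2 ℚ./ 1) (+ 1 ℚ./ 10) (toWitness {a? = 0ℚ ℚ.<? + 1 ℚ./ 10} tt)
    (λ _ → toWitness {a? = (+ 11 ℚ./ 5) ℚ.* (+ 11 ℚ./ 5) ℚ.≤? + 5 ℚ./ 1} tt)

  √5-2-positive : 0ℝ < √ (fromℕ 5) - fromℕ 2
  √5-2-positive = ε , proj₁ (proj₂ √5>2) , proj₁ (proj₂ (proj₂ √5>2)) , λ n N≤n →
    shift (sqrt-approx n (+ 5 ℚ./ 1)) (proj₂ (proj₂ (proj₂ √5>2)) n N≤n)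
    where
    ε = proj₁ √5>2
    shift : ∀ r → + 2 ℚ./ 1 ℚ.+ ε ℚ.≤ r → 0ℚ ℚ.+ ε ℚ.≤ r ℚ.- + 2 ℚ./ 1
    shift r h = subst₂ ℚ._≤_
      (trans (cong (ℚ._- + 2 ℚ./ 1) (ℚ.+-comm (+ 2 ℚ./ 1) ε))
        (trans (ℚ.+-assoc ε (+ 2 ℚ./ 1) (ℚ.- (+ 2 ℚ./ 1))) (ℚ.+-comm ε 0ℚ)))
      refl (ℚ.+-monoˡ-≤ (ℚ.- (+ 2 ℚ./ 1)) h)

open Positivity

√5 : ℝ
√5 = √ (fromℕ 5)

c : ℕ → ℝ
c zero =
  (fromℕ 2 + √5) / fromℕ 2 [ fromℚ-positive (+ 2 ℚ./ 1) (toWitness {a? = 0ℚ ℚ.<? + 2 ℚ./ 1} tt) ]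
    * √ ((fromℕ 7 * √5 - fromℕ 15) / π [ π-positive ])
c m@(suc _) =
  (fromℕ 4 * fromℕ m + fromℕ 3 - √5) / (fromℕ 4 * (√5 - fromℕ 2))
      [ *-positive (fromℕ 4) (√5 - fromℕ 2)
          (fromℚ-positive (+ 4 ℚ./ 1) (toWitness {a? = 0ℚ ℚ.<? + 4 ℚ./ 1} tt)) √5-2-positive ]
    * √ ((fromℕ 7 * √5 - fromℕ 15) / π [ π-positive ])

data Step : Set where
  N N̄ E Ē : Step

vector : Step → ℤ × ℤ
vector N = + 1 , + 2
vector N̄ = + 1 , ℤ.- + 2
vector E = + 2 , + 1
vector Ē = + 2 , ℤ.- + 1

origin : ℤ × ℤ
origin = + 0 , + 0

move : ℤ × ℤ → Step → ℤ × ℤ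
move (x , y) s = x ℤ.+ proj₁ (vector s) , y ℤ.+ proj₂ (vector s)

points : ℤ × ℤ → List Step → List (ℤ × ℤ)
points a []      = a ∷ []
points a (s ∷ p) = a ∷ points (move a s) p

endpoint : ℤ × ℤ → List Step → ℤ × ℤ
endpoint a []      = a
endpoint a (s ∷ p) = endpoint (move a s) p

size : List Step → ℤ
size p = proj₁ (endpoint origin p)

Alternating : Step → Step → Set
Alternating s t = ℤ.sign (proj₂ (vector s)) ≢ ℤ.sign (proj₂ (vector t))

Zigzag : List Step → Set
Zigzag = Linked Alternating

StaysAbove : ℕ → List Step → Set
StaysAbove m p = All (λ a → ℤ.- + m ℤ.≤ proj₂ a) (points origin p)

alternating? : ∀ s t → Dec (Alternating s t)
alternating? s t = ¬? (ℤ.sign (proj₂ (vector s)) Sign.≟ ℤ.sign (proj₂ (vector t)))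

staysAbove? : ∀ m → Decidable (StaysAbove m)
staysAbove? m p = all? (λ a → ℤ.- + m ℤ.≤? proj₂ a) (points origin p)

ZigzagOfSize : ℕ → List Step → Set
ZigzagOfSize n p = Zigzag p × size p ≡ + n

zigzagOfSize? : ∀ n → Decidable (ZigzagOfSize n)
zigzagOfSize? n p = linked? alternating? p ×-dec (size p ℤ.≟ + n)

steps : List Step
steps = N ∷ N̄ ∷ E ∷ Ē ∷ []

wordsUpTo : ℕ → List (List Step)
wordsUpTo zero    = [] ∷ []
wordsUpTo (suc k) = [] ∷ cartesianProductWith _∷_ steps (wordsUpTo k)

-- A path of size n has at most n steps, so nothing is missed; ∈-paths and
-- paths-unique show that each path of size n is listed exactly once.
paths : ℕ → List (List Step)
paths n = filter (zigzagOfSize? n) (wordsUpTo n)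

∈-steps : ∀ s → s ∈ steps
∈-steps N = here refl
∈-steps N̄ = there (here refl)
∈-steps E = there (there (here refl))
∈-steps Ē = there (there (there (here refl)))

∈-wordsUpTo : ∀ k p → length p ℕ.≤ k → p ∈ wordsUpTo k
∈-wordsUpTo zero    []      _          = here refl
∈-wordsUpTo (suc k) []      _          = here refl
∈-wordsUpTo (suc k) (s ∷ p) (ℕ.s≤s le) =
  there (∈-cartesianProductWith⁺ _∷_ (∈-steps s) (∈-wordsUpTo k p le))

1≤dx : ∀ s → + 1 ℤ.≤ proj₁ (vector s)
1≤dx N = ℤ.≤-refl
1≤dx N̄ = ℤ.≤-refl
1≤dx E = ℤ.+≤+ (ℕ.s≤s ℕ.z≤n)
1≤dx Ē = ℤ.+≤+ (ℕ.s≤s ℕ.z≤n)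

endpoint-≥ : ∀ x y p → x ℤ.+ + length p ℤ.≤ proj₁ (endpoint (x , y) p)
endpoint-≥ x y []      = ℤ.≤-reflexive (ℤ.+-identityʳ x)
endpoint-≥ x y (s ∷ p) = ℤ.≤-trans
  (ℤ.≤-trans (ℤ.≤-reflexive (sym (ℤ.+-assoc x (+ 1) (+ length p))))
             (ℤ.+-monoˡ-≤ (+ length p) (ℤ.+-monoʳ-≤ x (1≤dx s))))
  (endpoint-≥ (x ℤ.+ proj₁ (vector s)) (y ℤ.+ proj₂ (vector s)) p)

length≤size : ∀ n p → size p ≡ + n → length p ℕ.≤ n
length≤size n p eq = ℤ.drop‿+≤+ (subst (+ length p ℤ.≤_) eq (endpoint-≥ (+ 0) (+ 0) p))

∈-paths : ∀ n p → p ∈ paths n ⇔ ZigzagOfSize n p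
∈-paths n p = mk⇔
  (λ p∈ → proj₂ (∈-filter⁻ (zigzagOfSize? n) {xs = wordsUpTo n} p∈))
  (λ (zz , eq) → ∈-filter⁺ (zigzagOfSize? n) (∈-wordsUpTo n p (length≤size n p eq)) (zz , eq))

steps-unique : Unique steps
steps-unique = ((λ ()) ∷ (λ ()) ∷ (λ ()) ∷ []) ∷ ((λ ()) ∷ (λ ()) ∷ []) ∷ ((λ ()) ∷ []) ∷ [] ∷ []

wordsUpTo-unique : ∀ k → Unique (wordsUpTo k)
wordsUpTo-unique zero    = [] ∷ []
wordsUpTo-unique (suc k) =
  All.¬Any⇒All¬ _ []∉ ∷ Unique.cartesianProductWith⁺ _∷_ ∷-injective steps-unique (wordsUpTo-unique k)
  where
  []∉ : ¬ ([] ∈ cartesianProductWith _∷_ steps (wordsUpTo k))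
  []∉ []∈ with ∈-cartesianProductWith⁻ _∷_ steps (wordsUpTo k) []∈
  ... | _ , _ , _ , _ , ()

paths-unique : ∀ n → Unique (paths n)
paths-unique n = Unique.filter⁺ (zigzagOfSize? n) (wordsUpTo-unique n)

-- N, N̄, N, N̄, … with n steps shows that paths of every size exist.
upDown downUp : ℕ → List Step
upDown zero    = []
upDown (suc n) = N ∷ downUp n
downUp zero    = []
downUp (suc n) = N̄ ∷ upDown n

upDown-zigzag : ∀ n → Zigzag (upDown n)
downUp-zigzag : ∀ n → Zigzag (downUp n)
upDown-zigzag zero          = []
upDown-zigzag (suc zero)    = [-]
upDown-zigzag (suc (suc n)) = (λ ()) ∷ downUp-zigzag (suc n)
downUp-zigzag zero          = []
downUp-zigzag (suc zero)    = [-]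
downUp-zigzag (suc (suc n)) = (λ ()) ∷ upDown-zigzag (suc n)

upDown-size : ∀ x y n → proj₁ (endpoint (x , y) (upDown n)) ≡ x ℤ.+ + n
downUp-size : ∀ x y n → proj₁ (endpoint (x , y) (downUp n)) ≡ x ℤ.+ + n
upDown-size x y zero    = sym (ℤ.+-identityʳ x)
upDown-size x y (suc n) = trans (downUp-size (x ℤ.+ + 1) (y ℤ.+ + 2) n) (ℤ.+-assoc x (+ 1) (+ n))
downUp-size x y zero    = sym (ℤ.+-identityʳ x)
downUp-size x y (suc n) = trans (upDown-size (x ℤ.+ + 1) (y ℤ.- + 2) n) (ℤ.+-assoc x (+ 1) (+ n))

paths-nonEmpty : ∀ n → ℕ.NonZero (length (paths n))
paths-nonEmpty n = ℕ.>-nonZero (∈-length (∈-filter⁺ (zigzagOfSize? n)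
  (∈-wordsUpTo n (upDown n) (length≤size n (upDown n) (upDown-size (+ 0) (+ 0) n)))
  (upDown-zigzag n , upDown-size (+ 0) (+ 0) n)))

-- Probability of the event P under the uniform distribution on a nonempty
-- duplicate-free list of outcomes.
ℙ : ∀ {A : Set} (Ω : List A) → .{{ℕ.NonZero (length Ω)}} → {P : A → Set} → Decidable P → ℚ
ℙ Ω P? = + length (filter P? Ω) ℚ./ length Ω

probStaysAbove : ℕ → ℕ → ℚ
probStaysAbove m n = ℙ (paths n) {{paths-nonEmpty n}} (staysAbove? m)

{-# OPTIONS --safe #-}
-- A path alternates up- and down-steps, and an up-step followed by a down-step changes the
-- height by -1, 0 or 1.  The generating functions U h of the paths that start upwards and
-- never descend by more than h therefore satisfy U h = c + a U h + b (U (h+1) + U (h-1)),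
-- where a = z² + z⁴, b = z³, c = 1 + z + z².  Splitting a path at its first descent below the
-- initial level gives U (h+1) = U 0 + Y U h with Y = 1 - (1 - z - z²) U 0, hence a quadratic
-- equation for U 0, which is solved by
--   c + 2 b U 0 = c (1 - a + 2 b) α(z²),   α(w) = ((1 - 3w + w²) (1 + w + w²))^(-1/2).
-- With φ the golden ratio, α(x/φ²) is (1 - x)^(-1/2) times a series g of radius of convergence
-- greater than 1, so that its coefficients are b k (g(1) + O(1/k)), where b k = (2k choose k) / 4ᵏ.
-- Here g(1)² is algebraic, and Wallis' product expresses (b k)² through π.  The recursion in h
-- propagates the asymptotics to all h with a factor h + 1, and the paths that start downwards
-- reduce to those that start upwards.  Only g(1)² is ever needed, so the estimates are made
-- for partial sums of g and the square root is taken at the very end.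
module Submission where

open import Algebra.Bundles using (CommutativeRing)
open import Algebra.Structures using (IsCommutativeRing)
open import Algebra.Solver.Ring.AlmostCommutativeRing using (_-Raw-AlmostCommutative⟶_; fromCommutativeRing)
import Algebra.Solver.Ring as RingSolver
import Data.Integer.Base as ℤ
import Data.Integer.Properties as ℤ
open import Data.List.Base using ([]; _∷_; length; filter)
open import Data.List.Properties using (filter-accept)
open import Data.List.Relation.Unary.All using ([]; _∷_)
open import Data.Maybe.Base using (Maybe; just; nothing)
open import Data.Nat.Base as ℕ using (ℕ; zero; suc; ⌊_/2⌋)
import Data.Nat.Properties as ℕ
open import Data.Product.Base using (∃-syntax; _×_; _,_; proj₁; proj₂)
open import Data.Rational.Base as ℚ using (ℚ; 0ℚ; 1ℚ; ½; nonNegative)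
import Data.Rational.Properties as ℚ
open import Data.Rational.Solver using (module +-*-Solver)
open import Data.Sum.Base using (_⊎_; inj₁; inj₂)
open import Data.Unit.Base using (tt)
open import Function.Base using (_∘_; id)
open import Level using (0ℓ)
open import Relation.Binary.PropositionalEquality as ≡ using (_≡_)
open import Relation.Binary.Structures using (IsEquivalence)
open import Relation.Nullary using (yes; no)
open import Relation.Nullary.Decidable using (toWitness)
open import Relation.Nullary.Negation using (contradiction)
open import Defs using (module ℚ-Lemmas; module Cauchy-Proofs)
open ℚ-Lemmas using (inv; inv-inverseʳ; inv-pos; *-nonNeg; *-pos; halve-pos; halves; archimedean; square-cancel-≤; ℕ/-mono-≤; *-mono-≤-nonNeg)
open Cauchy-Proofs using (bounded; *-diff; sqrt-approx-nonNeg; sqrt-approx-lower; sqrt-approx-upper; 0≤1/suc; wallis; wallis-upper; wallis-nonNeg; 2≤wallis; wallis-↗; wallis-upper-↘; wallis≤upper; wallis-upper≤4; wallis-width)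

-- The first direction and the horizontal step lengths determine a nonempty zigzag path, so the
-- total number of paths of size n ≥ 1 is twice a Fibonacci number. It grows like φⁿ, as the number
-- of restricted paths does up to a factor 1/√n; in the quotient the exponentials cancel, and only b
-- ⌊n/2⌋ and algebraic constants survive. The obstacle that shapes the proof is that the reals of
-- the statement are Cauchy sequences, equal only up to null sequences. The analysis is therefore
-- done in an abstract commutative ring with a homomorphism `ι` from ℚ and a relation `x ⊑ q` that
-- bounds an absolute value by a rational. Every error bound is an explicit rational, and every
-- limit inside the ring is replaced by a finite sum. The power series over such a ring again form a
-- ring over ℚ, so one ring solver with rational coefficients serves numbers and series alike. What
-- is matched in the end are the limit of p² n π and c² π, two elements of ℚ(√5). Only the last step
-- returns from squares to p and c/√n.

record ℚ-Algebra : Set₁ where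
  field
    commutativeRing : CommutativeRing 0ℓ 0ℓ
  open CommutativeRing commutativeRing public
  field
    ι   : ℚ → Carrier
    ι-+ : ∀ p q → ι (p ℚ.+ q) ≈ ι p + ι q
    ι-* : ∀ p q → ι (p ℚ.* q) ≈ ι p * ι q
    ι-‿ : ∀ p → ι (ℚ.- p) ≈ - ι p
    ι-0 : ι 0ℚ ≈ 0#
    ι-1 : ι 1ℚ ≈ 1#

  morphism : CommutativeRing.rawRing ℚ.+-*-commutativeRing -Raw-AlmostCommutative⟶ fromCommutativeRing commutativeRing
  morphism = record
    { ⟦_⟧ = ι ; +-homo = ι-+ ; *-homo = ι-* ; -‿homo = ι-‿ ; 0-homo = ι-0 ; 1-homo = ι-1 }

  ι-cong : ∀ {p q} → p ≡ q → ι p ≈ ι q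
  ι-cong eq = reflexive (≡.cong ι eq)

  ι-≟ : ∀ p q → Maybe (ι p ≈ ι q)
  ι-≟ p q with p ℚ.≟ q
  ... | yes eq = just (ι-cong eq)
  ... | no _   = nothing

  module Solver = RingSolver (CommutativeRing.rawRing ℚ.+-*-commutativeRing) (fromCommutativeRing commutativeRing) morphism ι-≟

-- Formal power series over a ring containing the rationals.

module PowerSeries (A : ℚ-Algebra) where
  open ℚ-Algebra A
  open import Relation.Binary.Reasoning.Setoid setoid
  open Solver using (solve; _:+_; _:*_; _:=_)

  Series : Set
  Series = ℕ → Carrier

  open import Algebra.Properties.Ring ring using (-0#≈0#)

  infix 4 _≋_
  _≋_ : Series → Series → Set
  x ≋ y = ∀ n → x n ≈ y n

  tail : Series → Series
  tail x n = x (suc n)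

  infixl 6 _⊕_
  infixl 7 _⊛_ _·_

  -- The Cauchy product by structural recursion on the degree, from x = x 0 + z (tail x). Inductive
  -- proofs then need neither finite sums nor subtraction of indices.
  _⊕_ _⊛_ : Series → Series → Series
  (x ⊕ y) n = x n + y n
  (x ⊛ y) zero    = x 0 * y 0
  (x ⊛ y) (suc n) = x 0 * y (suc n) + (tail x ⊛ y) n

  _·_ : Carrier → Series → Series
  (k · x) n = k * x n

  ⊖_ : Series → Series
  (⊖ x) n = - x n

  constant : Carrier → Series
  constant k zero    = k
  constant k (suc _) = 0#

  ⊛-cong : ∀ {x x′ y y′} → x ≋ x′ → y ≋ y′ → x ⊛ y ≋ x′ ⊛ y′
  ⊛-cong p q zero    = *-cong (p 0) (q 0)
  ⊛-cong p q (suc n) = +-cong (*-cong (p 0) (q (suc n))) (⊛-cong (p ∘ suc) q n)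

  -- The mirror image of the defining recursion, splitting off the head of the right factor;
  -- commutativity rests on it.
  ⊛-suc : ∀ x y n → (x ⊛ y) (suc n) ≈ (x ⊛ tail y) n + x (suc n) * y 0
  ⊛-suc x y zero    = refl
  ⊛-suc x y (suc n) = trans (+-congˡ (⊛-suc (tail x) y n)) (sym (+-assoc _ _ _))

  ⊛-comm : ∀ x y → x ⊛ y ≋ y ⊛ x
  ⊛-comm x y zero    = *-comm _ _
  ⊛-comm x y (suc n) = begin
    x 0 * y (suc n) + (tail x ⊛ y) n   ≈⟨ +-cong (*-comm _ _) (⊛-comm (tail x) y n) ⟩
    y (suc n) * x 0 + (y ⊛ tail x) n   ≈⟨ +-comm _ _ ⟩
    (y ⊛ tail x) n + y (suc n) * x 0   ≈⟨ ⊛-suc y x n ⟨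
    (y ⊛ x) (suc n)                    ∎

  ⊛-distribʳ : ∀ x y z → (y ⊕ z) ⊛ x ≋ y ⊛ x ⊕ z ⊛ x
  ⊛-distribʳ x y z zero    = distribʳ _ _ _
  ⊛-distribʳ x y z (suc n) = trans (+-congˡ (⊛-distribʳ x (tail y) (tail z) n))
    (solve 5 (λ a b c d e → (a :+ b) :* c :+ (d :+ e) := a :* c :+ d :+ (b :* c :+ e)) refl _ _ _ _ _)

  ⊛-·ˡ : ∀ k x y → (k · x) ⊛ y ≋ k · (x ⊛ y)
  ⊛-·ˡ k x y zero    = *-assoc _ _ _
  ⊛-·ˡ k x y (suc n) = trans (+-congˡ (⊛-·ˡ k (tail x) y n))
    (solve 4 (λ k a b c → k :* a :* b :+ k :* c := k :* (a :* b :+ c)) refl _ _ _ _)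

  ⊛-assoc : ∀ x y z → (x ⊛ y) ⊛ z ≋ x ⊛ (y ⊛ z)
  ⊛-assoc x y z zero    = *-assoc _ _ _
  ⊛-assoc x y z (suc n) = begin
    x 0 * y 0 * z (suc n) + ((x 0 · tail y ⊕ tail x ⊛ y) ⊛ z) n
      ≈⟨ +-congˡ (⊛-distribʳ z (x 0 · tail y) (tail x ⊛ y) n) ⟩
    x 0 * y 0 * z (suc n) + (((x 0 · tail y) ⊛ z) n + ((tail x ⊛ y) ⊛ z) n)
      ≈⟨ +-congˡ (+-cong (⊛-·ˡ (x 0) (tail y) z n) (⊛-assoc (tail x) y z n)) ⟩
    x 0 * y 0 * z (suc n) + (x 0 * (tail y ⊛ z) n + (tail x ⊛ (y ⊛ z)) n)
      ≈⟨ solve 5 (λ a b c d e → a :* b :* c :+ (a :* d :+ e) := a :* (b :* c :+ d) :+ e) refl _ _ _ _ _ ⟩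
    x 0 * (y 0 * z (suc n) + (tail y ⊛ z) n) + (tail x ⊛ (y ⊛ z)) n ∎

  zero-⊛ : ∀ x y → (∀ n → x n ≈ 0#) → x ⊛ y ≋ (λ _ → 0#)
  zero-⊛ x y x≈0 zero    = trans (*-congʳ (x≈0 0)) (zeroˡ _)
  zero-⊛ x y x≈0 (suc n) = trans (+-cong (trans (*-congʳ (x≈0 0)) (zeroˡ _)) (zero-⊛ (tail x) y (x≈0 ∘ suc) n)) (+-identityˡ 0#)

  constant-⊛ : ∀ k x → constant k ⊛ x ≋ k · x
  constant-⊛ k x zero    = refl
  constant-⊛ k x (suc n) = trans (+-congˡ (zero-⊛ (tail (constant k)) x (λ _ → refl) n)) (+-identityʳ _)

  ⊛-identityˡ : ∀ x → constant 1# ⊛ x ≋ x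
  ⊛-identityˡ x n = trans (constant-⊛ 1# x n) (*-identityˡ _)

  ≋-isEquivalence : IsEquivalence _≋_
  ≋-isEquivalence = record
    { refl  = λ _ → refl
    ; sym   = λ p n → sym (p n)
    ; trans = λ p q n → trans (p n) (q n)
    }

  seriesRing : CommutativeRing 0ℓ 0ℓ
  seriesRing = record
    { Carrier = Series ; _≈_ = _≋_ ; _+_ = _⊕_ ; _*_ = _⊛_ ; -_ = ⊖_
    ; 0# = λ _ → 0# ; 1# = constant 1#
    ; isCommutativeRing = record
      { isRing = record
        { +-isAbelianGroup = record
          { isGroup = record
            { isMonoid = record
              { isSemigroup = record
                { isMagma = record
                  { isEquivalence = ≋-isEquivalence
                  ; ∙-cong        = λ p q n → +-cong (p n) (q n)
                  }
                ; assoc = λ x y z n → +-assoc (x n) (y n) (z n)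
                }
              ; identity = (λ x n → +-identityˡ (x n)) , (λ x n → +-identityʳ (x n))
              }
            ; inverse = (λ x n → -‿inverseˡ (x n)) , (λ x n → -‿inverseʳ (x n))
            ; ⁻¹-cong = λ p n → -‿cong (p n)
            }
          ; comm = λ x y n → +-comm (x n) (y n)
          }
        ; *-cong     = ⊛-cong
        ; *-assoc    = ⊛-assoc
        ; *-identity = ⊛-identityˡ , (λ x n → trans (⊛-comm x _ n) (⊛-identityˡ x n))
        ; distrib    =
            (λ x y z n → trans (⊛-comm x (y ⊕ z) n)
              (trans (⊛-distribʳ x y z n) (+-cong (⊛-comm y x n) (⊛-comm z x n))))
          , ⊛-distribʳ
        }
      ; *-comm = ⊛-comm
      }
    }

  constant-⊕ : ∀ k l → constant (k + l) ≋ constant k ⊕ constant l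
  constant-⊕ k l zero    = refl
  constant-⊕ k l (suc n) = sym (+-identityˡ 0#)

  constant-cong : ∀ {k l} → k ≈ l → constant k ≋ constant l
  constant-cong eq zero    = eq
  constant-cong eq (suc n) = refl

  -- Makes the ring solver, with its rational constants, available for identities between series.
  seriesAlgebra : ℚ-Algebra
  seriesAlgebra = record
    { commutativeRing = seriesRing
    ; ι   = constant ∘ ι
    ; ι-+ = λ p q n → trans (constant-cong (ι-+ p q) n) (constant-⊕ (ι p) (ι q) n)
    ; ι-* = λ { p q zero → ι-* p q
              ; p q (suc n) → sym (trans (constant-⊛ (ι p) (constant (ι q)) (suc n)) (zeroʳ _)) }
    ; ι-‿ = λ { p zero → ι-‿ p ; p (suc n) → sym -0#≈0# }
    ; ι-0 = λ { zero → ι-0 ; (suc n) → refl }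
    ; ι-1 = λ { zero → ι-1 ; (suc n) → refl }
    }

-- Normalised central binomial coefficients and Wallis' product.

module CentralBinomials where

  open import Defs using (module ℚ-Lemmas; module Cauchy-Proofs)
  open import Data.Rational.Base
  open import Data.Rational.Properties
  open import Relation.Binary.PropositionalEquality
  open +-*-Solver using (solve; _:+_; _:*_; _:-_; :-_; _:=_; con)
  open ℚ-Lemmas using (ℕ/-*; suc/; ℕ/-mono-≤; *-nonNeg; *-pos)
  open Cauchy-Proofs using (wallis; wallis-odd; wallis-even)

  infix 9 #_
  #_ : ℕ → ℚ
  # n = ℤ.+ n / 1

  -- Sealed so that type checking never unfolds the reduction of fractions to lowest terms.
  opaque
    ♮ : ℕ → ℚ
    ♮ n = ℤ.+ n / 1

    ♮-/1 : ∀ n → ♮ n ≡ ℤ.+ n / 1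
    ♮-/1 n = refl

    ♮-0 : ♮ 0 ≡ 0ℚ
    ♮-0 = refl

    ♮-suc : ∀ n → ♮ (suc n) ≡ 1ℚ + ♮ n
    ♮-suc n = trans (suc/ n 0) (+-comm (♮ n) 1ℚ)

    ♮-* : ∀ m n → ♮ (m ℕ.* n) ≡ ♮ m * ♮ n
    ♮-* m n = sym (ℕ/-* m 0 n 0)

    ♮-mono : ∀ {m n} → m ℕ.≤ n → ♮ m ≤ ♮ n
    ♮-mono {m} {n} h = ℕ/-mono-≤ m 0 n 0 (ℕ.*-monoˡ-≤ 1 h)

    /-♮ : ∀ a d → (ℤ.+ a / suc d) * ♮ (suc d) ≡ ♮ a
    /-♮ a d = trans (ℕ/-* a d (suc d) 0) (≤-antisym
      (ℕ/-mono-≤ (a ℕ.* suc d) (d ℕ.* 1) a 0 (ℕ.≤-reflexive eq))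
      (ℕ/-mono-≤ a 0 (a ℕ.* suc d) (d ℕ.* 1) (ℕ.≤-reflexive (sym eq))))
      where
      eq : a ℕ.* suc d ℕ.* 1 ≡ a ℕ.* suc (d ℕ.* 1)
      eq = trans (ℕ.*-identityʳ (a ℕ.* suc d)) (cong (λ e → a ℕ.* suc e) (sym (ℕ.*-identityʳ d)))

  ♮-+ : ∀ m n → ♮ (m ℕ.+ n) ≡ ♮ m + ♮ n
  ♮-+ zero    n = sym (trans (cong (_+ ♮ n) ♮-0) (+-identityˡ (♮ n)))
  ♮-+ (suc m) n = begin
    ♮ (suc (m ℕ.+ n))    ≡⟨ ♮-suc (m ℕ.+ n) ⟩
    1ℚ + ♮ (m ℕ.+ n)     ≡⟨ cong (1ℚ +_) (♮-+ m n) ⟩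
    1ℚ + (♮ m + ♮ n)     ≡⟨ +-assoc 1ℚ (♮ m) (♮ n) ⟨
    1ℚ + ♮ m + ♮ n       ≡⟨ cong (_+ ♮ n) (♮-suc m) ⟨
    ♮ (suc m) + ♮ n      ∎
    where open ≡-Reasoning

  0≤♮ : ∀ n → 0ℚ ≤ ♮ n
  0≤♮ n = subst (_≤ ♮ n) ♮-0 (♮-mono ℕ.z≤n)

  0<1+ : ∀ {p} → 0ℚ ≤ p → 0ℚ < 1ℚ + p
  0<1+ {p} 0≤p = +-mono-<-≤ {0ℚ} {1ℚ} {0ℚ} {p} (positive⁻¹ 1ℚ) 0≤p

  0<♮suc : ∀ n → 0ℚ < ♮ (suc n)
  0<♮suc n = subst (0ℚ <_) (sym (♮-suc n)) (0<1+ (0≤♮ n))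

  ≤-by : ∀ {p q} r → 0ℚ ≤ r → p + r ≡ q → p ≤ q
  ≤-by {p} {q} r 0≤r eq = subst₂ _≤_ (+-identityʳ p) eq (+-monoʳ-≤ p 0≤r)

  0≤-+ : ∀ {p q} → 0ℚ ≤ p → 0ℚ ≤ q → 0ℚ ≤ p + q
  0≤-+ {p} {q} = +-mono-≤ {0ℚ} {p} {0ℚ} {q}

  *-cancel-≤ : ∀ r {p q} → 0ℚ < r → r * p ≤ r * q → p ≤ q
  *-cancel-≤ r 0<r = *-cancelˡ-≤-pos r {{positive 0<r}}

  *-cancel-≡ : ∀ r {p q} → 0ℚ < r → r * p ≡ r * q → p ≡ q
  *-cancel-≡ r 0<r eq = ≤-antisym (*-cancel-≤ r 0<r (≤-reflexive eq)) (*-cancel-≤ r 0<r (≤-reflexive (sym eq)))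

  two : ℚ
  two = # 2

  ♮-2k+1 : ∀ k → ♮ (suc (2 ℕ.* k)) ≡ 1ℚ + two * ♮ k
  ♮-2k+1 k = trans (♮-suc (2 ℕ.* k)) (cong (1ℚ +_) (trans (♮-* 2 k) (cong (_* ♮ k) (♮-/1 2))))

  ♮-2k+2 : ∀ k → ♮ (suc (suc (2 ℕ.* k))) ≡ two + two * ♮ k
  ♮-2k+2 k = trans (♮-suc (suc (2 ℕ.* k))) (trans (cong (1ℚ +_) (♮-2k+1 k)) (sym (+-assoc 1ℚ 1ℚ (two * ♮ k))))

  opaque
    -- b k = (2k choose k) / 4ᵏ, the coefficients of (1 - w)^(-1/2).
    b : ℕ → ℚ
    b zero    = 1ℚ
    b (suc k) = b k * (ℤ.+ suc (2 ℕ.* k) / suc (suc (2 ℕ.* k)))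

    b-0 : b 0 ≡ 1ℚ
    b-0 = refl

    b-suc : ∀ k → (two + two * ♮ k) * b (suc k) ≡ (1ℚ + two * ♮ k) * b k
    b-suc k = begin
      (two + two * ♮ k) * (b k * r)              ≡⟨ cong (_* (b k * r)) (♮-2k+2 k) ⟨
      ♮ (suc (suc (2 ℕ.* k))) * (b k * r)        ≡⟨ solve 3 (λ x y z → x :* (y :* z) := (z :* x) :* y) refl (♮ (suc (suc (2 ℕ.* k)))) (b k) r ⟩
      r * ♮ (suc (suc (2 ℕ.* k))) * b k          ≡⟨ cong (_* b k) (/-♮ (suc (2 ℕ.* k)) (suc (2 ℕ.* k))) ⟩
      ♮ (suc (2 ℕ.* k)) * b k                    ≡⟨ cong (_* b k) (♮-2k+1 k) ⟩
      (1ℚ + two * ♮ k) * b k                     ∎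
      where
      open ≡-Reasoning
      r : ℚ
      r = ℤ.+ suc (2 ℕ.* k) / suc (suc (2 ℕ.* k))

    0<b : ∀ k → 0ℚ < b k
    0<b zero    = positive⁻¹ 1ℚ
    0<b (suc k) = *-pos (0<b k) (positive⁻¹ _ {{normalize-pos (suc (2 ℕ.* k)) (suc (suc (2 ℕ.* k)))}})

  0<2k+2 : ∀ k → 0ℚ < two + two * ♮ k
  0<2k+2 k = subst (0ℚ <_) (♮-2k+2 k) (0<♮suc (suc (2 ℕ.* k)))

  0≤b : ∀ k → 0ℚ ≤ b k
  0≤b k = <⇒≤ (0<b k)

  b-anti : ∀ k → b (suc k) ≤ b k
  b-anti k = *-cancel-≤ (two + two * ♮ k) (0<2k+2 k)
    (≤-by (b k) (0≤b k) (trans (cong (_+ b k) (b-suc k))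
      (solve 2 (λ t x → (con 1ℚ :+ con two :* t) :* x :+ x := (con two :+ con two :* t) :* x) refl (♮ k) (b k))))

  b≤1 : ∀ k → b k ≤ 1ℚ
  b≤1 zero    = ≤-reflexive b-0
  b≤1 (suc k) = ≤-trans (b-anti k) (b≤1 k)

  -- The ratio of consecutive values of `b` is (2k+1)/(2k+2), which is at least (k+1)/(k+2): the
  -- cross products differ by k. Together with `b-anti` this controls the decay of `b` from both
  -- sides without knowing its asymptotics.
  [k+1]b-mono : ∀ k → (1ℚ + ♮ k) * b k ≤ (two + ♮ k) * b (suc k)
  [k+1]b-mono k = *-cancel-≤ (two + two * ♮ k) (0<2k+2 k)
    (≤-by (♮ k * b k) (*-nonNeg (0≤♮ k) (0≤b k)) (begin
      (two + two * t) * ((1ℚ + t) * x) + t * x  ≡⟨ solve 2 (λ t x → (con two :+ con two :* t) :* ((con 1ℚ :+ t) :* x) :+ t :* x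
                                                             := (con two :+ t) :* ((con 1ℚ :+ con two :* t) :* x)) refl t x ⟩
      (two + t) * ((1ℚ + two * t) * x)          ≡⟨ cong ((two + t) *_) (b-suc k) ⟨
      (two + t) * ((two + two * t) * y)         ≡⟨ solve 3 (λ p q r → p :* (q :* r) := q :* (p :* r)) refl (two + t) (two + two * t) y ⟩
      (two + two * t) * ((two + t) * y)         ∎))
    where
    open ≡-Reasoning
    t = ♮ k
    x = b k
    y = b (suc k)

  [k+1]b-mono-+ : ∀ j k → (1ℚ + ♮ k) * b k ≤ (1ℚ + ♮ (j ℕ.+ k)) * b (j ℕ.+ k)
  [k+1]b-mono-+ zero    k = ≤-refl
  [k+1]b-mono-+ (suc j) k = ≤-trans ([k+1]b-mono-+ j k)
    (subst (λ s → (1ℚ + ♮ (j ℕ.+ k)) * b (j ℕ.+ k) ≤ s * b (suc (j ℕ.+ k)))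
      (trans (+-assoc 1ℚ 1ℚ (♮ (j ℕ.+ k))) (cong (1ℚ +_) (sym (♮-suc (j ℕ.+ k)))))
      ([k+1]b-mono (j ℕ.+ k)))

  b-anti-+ : ∀ j k → b (j ℕ.+ k) ≤ b k
  b-anti-+ zero    k = ≤-refl
  b-anti-+ (suc j) k = ≤-trans (b-anti (j ℕ.+ k)) (b-anti-+ j k)

  -- (k+1) (b k - b (j+k)) ≤ j b (j+k), scaled by (j+k+1)/(k+1) ≤ j+1.
  b-close : ∀ j k → (1ℚ + ♮ (j ℕ.+ k)) * (b k - b (j ℕ.+ k)) ≤ ♮ j * (1ℚ + ♮ j) * b (j ℕ.+ k)
  b-close j k = ≤-trans step₁ (≤-trans (≤-reflexive step₂) step₃)
    where
    s = ♮ j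
    t = ♮ k
    x = b k
    y = b (j ℕ.+ k)
    0≤d : 0ℚ ≤ x - y
    0≤d = subst (_≤ x - y) (+-inverseʳ y) (+-monoˡ-≤ (- y) (b-anti-+ j k))
    step₁ : (1ℚ + ♮ (j ℕ.+ k)) * (x - y) ≤ (1ℚ + s) * (1ℚ + t) * (x - y)
    step₁ = *-monoʳ-≤-nonNeg (x - y) {{nonNegative 0≤d}}
      (≤-by {1ℚ + ♮ (j ℕ.+ k)} {(1ℚ + s) * (1ℚ + t)} (s * t) (*-nonNeg (0≤♮ j) (0≤♮ k))
        (trans (cong (λ u → 1ℚ + u + s * t) (♮-+ j k))
          (solve 2 (λ s t → con 1ℚ :+ (s :+ t) :+ s :* t := (con 1ℚ :+ s) :* (con 1ℚ :+ t)) refl s t)))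
    step₂ : (1ℚ + s) * (1ℚ + t) * (x - y) ≡ (1ℚ + s) * ((1ℚ + t) * x - (1ℚ + t) * y)
    step₂ = solve 4 (λ s t x y → (con 1ℚ :+ s) :* (con 1ℚ :+ t) :* (x :- y)
                      := (con 1ℚ :+ s) :* ((con 1ℚ :+ t) :* x :- (con 1ℚ :+ t) :* y)) refl s t x y
    step₃ : (1ℚ + s) * ((1ℚ + t) * x - (1ℚ + t) * y) ≤ s * (1ℚ + s) * y
    step₃ = ≤-trans (*-monoˡ-≤-nonNeg (1ℚ + s) {{nonNegative (<⇒≤ (0<1+ (0≤♮ j)))}}
        (+-monoˡ-≤ (- ((1ℚ + t) * y)) ([k+1]b-mono-+ j k)))
      (≤-reflexive (trans (cong (λ u → (1ℚ + s) * ((1ℚ + u) * y - (1ℚ + t) * y)) (♮-+ j k))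
        (solve 3 (λ s t y → (con 1ℚ :+ s) :* ((con 1ℚ :+ (s :+ t)) :* y :- (con 1ℚ :+ t) :* y) := s :* (con 1ℚ :+ s) :* y) refl s t y)))

  b≤2b : ∀ k → b k ≤ two * b (suc k)
  b≤2b k = *-cancel-≤ (1ℚ + ♮ k) (0<1+ (0≤♮ k)) (≤-trans ([k+1]b-mono k)
    (≤-by (♮ k * b (suc k)) (*-nonNeg (0≤♮ k) (0≤b (suc k)))
      (solve 2 (λ t x → (con two :+ t) :* x :+ t :* x := (con 1ℚ :+ t) :* (con two :* x)) refl (♮ k) (b (suc k)))))

  -- Each pair of factors of Wallis' product exactly undoes the change of (b k)² (2k+1). This exact
  -- identity, in place of an estimate of Stirling type, is what brings π in.
  b²-wallis : ∀ k → b k * b k * (1ℚ + two * ♮ k) * wallis k ≡ two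
  b²-wallis zero    = cong₂ (λ x t → x * x * (1ℚ + two * t) * wallis 0) b-0 ♮-0
  b²-wallis (suc k) = *-cancel-≡ (2k+2 * 2k+2) (*-pos (0<2k+2 k) (0<2k+2 k)) (begin
    2k+2 * 2k+2 * (y * y * (1ℚ + two * ♮ (suc k)) * (w * o * e))
      ≡⟨ solve 6 (λ z y s w o e → z :* z :* (y :* y :* s :* (w :* o :* e)) := (z :* y) :* (z :* y) :* w :* o :* (e :* s)) refl 2k+2 y (1ℚ + two * ♮ (suc k)) w o e ⟩
    (2k+2 * y) * (2k+2 * y) * w * o * (e * (1ℚ + two * ♮ (suc k)))
      ≡⟨ cong₂ (λ u v → u * u * w * o * v) (b-suc k) even≡ ⟩
    (2k+1 * x) * (2k+1 * x) * w * o * 2k+2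
      ≡⟨ solve 5 (λ s x w o z → (s :* x) :* (s :* x) :* w :* o :* z := (x :* x :* s :* w) :* (o :* s) :* z) refl 2k+1 x w o 2k+2 ⟩
    (x * x * 2k+1 * w) * (o * 2k+1) * 2k+2
      ≡⟨ cong₂ (λ u v → u * v * 2k+2) (b²-wallis k) odd≡ ⟩
    two * 2k+2 * 2k+2
      ≡⟨ solve 2 (λ t z → t :* z :* z := z :* z :* t) refl two 2k+2 ⟩
    2k+2 * 2k+2 * two ∎)
    where
    open ≡-Reasoning
    x = b k
    y = b (suc k)
    w = wallis k
    o = wallis-odd k
    e = wallis-even k
    2k+1 = 1ℚ + two * ♮ k
    2k+2 = two + two * ♮ k
    2[k+1] : ♮ (2 ℕ.* suc k) ≡ 2k+2
    2[k+1] = trans (cong ♮ (ℕ.*-suc 2 k)) (♮-2k+2 k)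
    odd≡ : o * 2k+1 ≡ 2k+2
    odd≡ = trans (cong (o *_) (sym (♮-2k+1 k))) (trans (/-♮ (2 ℕ.* suc k) (2 ℕ.* k)) 2[k+1])
    even≡ : e * (1ℚ + two * ♮ (suc k)) ≡ 2k+2
    even≡ = trans (cong (e *_) (sym (♮-2k+1 (suc k)))) (trans (/-♮ (2 ℕ.* suc k) (2 ℕ.* suc k)) 2[k+1])

open CentralBinomials

-- Substitutions, the Euler derivation and the series (1 - z)^(-1/2).

module SeriesCalculus (A : ℚ-Algebra) where
  private module A = ℚ-Algebra A
  open PowerSeries A
  open ℚ-Algebra seriesAlgebra
  open import Algebra.Properties.Semiring.Exp A.semiring public using (_^_)
  open import Algebra.Properties.CommutativeSemiring.Exp A.commutativeSemiring using (^-distrib-*)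
  open Solver using (solve; _:+_; _:*_; _:-_; :-_; _:=_; con)
  private module A-Solver = A.Solver

  Z : Series
  Z 0             = A.0#
  Z 1             = A.1#
  Z (suc (suc _)) = A.0#

  tail-Z : tail Z ≈ 1#
  tail-Z zero    = A.refl
  tail-Z (suc n) = A.refl

  Z*-zero : ∀ x → (Z * x) 0 A.≈ A.0#
  Z*-zero x = A.zeroˡ (x 0)

  Z*-suc : ∀ x n → (Z * x) (suc n) A.≈ x n
  Z*-suc x n = A.trans (A.+-cong (A.zeroˡ _) (A.trans (*-congʳ {x} tail-Z n) (*-identityˡ x n))) (A.+-identityˡ _)

  ≈-suc : ∀ {x y} → x 0 A.≈ y 0 → tail x ≈ tail y → x ≈ y
  ≈-suc p q zero    = p
  ≈-suc p q (suc n) = q n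

  -- The coefficients form only a ring, so the inverse `i` of the constant term of `y` is supplied
  -- explicitly; the coefficients of `x` then vanish one after the other.
  *-cancelʳ-0 : ∀ y i → y 0 A.* i A.≈ A.1# → ∀ x → x * y ≈ 0# → x ≈ 0#
  *-cancelʳ-0 y i yi≈1 x xy≈0 = λ { zero → head≈0 ; (suc n) → *-cancelʳ-0 y i yi≈1 (tail x) tail≈0 n }
    where
    head≈0 : x 0 A.≈ A.0#
    head≈0 = A.trans (A.sym (A.*-identityʳ _)) (A.trans (A.*-congˡ (A.sym yi≈1))
      (A.trans (A.sym (A.*-assoc _ _ _)) (A.trans (A.*-congʳ (xy≈0 0)) (A.zeroˡ i))))
    tail≈0 : tail x * y ≈ 0#
    tail≈0 n = A.trans (A.sym (A.+-identityˡ _))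
      (A.trans (A.+-congʳ (A.sym (A.trans (A.*-congʳ head≈0) (A.zeroˡ _)))) (xy≈0 (suc n)))

  *-cancelʳ : ∀ z i → z 0 A.* i A.≈ A.1# → ∀ x y → x * z ≈ y * z → x ≈ y
  *-cancelʳ z i zi≈1 x y eq = begin
    x              ≈⟨ solve 2 (λ x y → x := (x :- y) :+ y) refl x y ⟩
    x - y + y      ≈⟨ +-congʳ {y} (*-cancelʳ-0 z i zi≈1 (x - y) (begin
      (x - y) * z    ≈⟨ solve 3 (λ x y z → (x :- y) :* z := x :* z :- y :* z) refl x y z ⟩
      x * z - y * z  ≈⟨ +-congʳ {⊖ (y * z)} eq ⟩
      y * z - y * z  ≈⟨ -‿inverseʳ (y * z) ⟩
      0#             ∎)) ⟩
    0# + y         ≈⟨ +-identityˡ y ⟩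
    y              ∎
    where open import Relation.Binary.Reasoning.Setoid setoid

  -- The product (x - y)(x + y) vanishes, and x + y has the invertible constant term 2.
  sqrt-unique : ∀ x y → x 0 A.≈ A.1# → y 0 A.≈ A.1# → x * x ≈ y * y → x ≈ y
  sqrt-unique x y x₀≈1 y₀≈1 eq = begin
    x              ≈⟨ solve 2 (λ x y → x := (x :- y) :+ y) refl x y ⟩
    x - y + y      ≈⟨ +-congʳ {y} (*-cancelʳ-0 (x + y) (A.ι ½) half (x - y) (begin
      (x - y) * (x + y)  ≈⟨ solve 2 (λ x y → (x :- y) :* (x :+ y) := x :* x :- y :* y) refl x y ⟩
      x * x - y * y      ≈⟨ +-congʳ {⊖ (y * y)} eq ⟩
      y * y - y * y      ≈⟨ -‿inverseʳ (y * y) ⟩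
      0#                 ∎)) ⟩
    0# + y         ≈⟨ +-identityˡ y ⟩
    y              ∎
    where
    open import Relation.Binary.Reasoning.Setoid setoid
    half : (x 0 A.+ y 0) A.* A.ι ½ A.≈ A.1#
    half = A.trans (A.*-congʳ (A.+-cong (A.trans x₀≈1 (A.sym A.ι-1)) (A.trans y₀≈1 (A.sym A.ι-1))))
      (A.trans (A.*-congʳ (A.sym (A.ι-+ 1ℚ 1ℚ))) (A.trans (A.sym (A.ι-* (1ℚ ℚ.+ 1ℚ) ½)) A.ι-1))

  -- The substitution z ↦ c z.
  dilate : A.Carrier → Series → Series
  dilate c x n = c ^ n A.* x n

  tail-dilate : ∀ c x → tail (dilate c x) ≈ c · dilate c (tail x)
  tail-dilate c x n = A.*-assoc c (c ^ n) (x (suc n))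

  dilate-cong : ∀ c {x y} → x ≈ y → dilate c x ≈ dilate c y
  dilate-cong c p n = A.*-congˡ (p n)

  dilate-* : ∀ c x y → dilate c (x * y) ≈ dilate c x * dilate c y
  dilate-* c x y zero = A.trans (A.*-identityˡ _) (A.sym (A.*-cong (A.*-identityˡ _) (A.*-identityˡ _)))
  dilate-* c x y (suc n) = begin
    c A.* c ^ n A.* (x 0 A.* y (suc n) A.+ (tail x * y) n)
      ≈⟨ A-solve 5 (λ c d x y z → c ∙ d ∙ (x ∙ y ∔ z) ≔ x ∙ (c ∙ d ∙ y) ∔ c ∙ (d ∙ z)) A.refl c (c ^ n) (x 0) (y (suc n)) ((tail x * y) n) ⟩
    x 0 A.* (c A.* c ^ n A.* y (suc n)) A.+ c A.* dilate c (tail x * y) n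
      ≈⟨ A.+-cong (A.*-congʳ (A.sym (A.*-identityˡ (x 0)))) (A.*-congˡ (dilate-* c (tail x) y n)) ⟩
    dilate c x 0 A.* dilate c y (suc n) A.+ c A.* (dilate c (tail x) * dilate c y) n
      ≈⟨ A.+-congˡ (⊛-·ˡ c (dilate c (tail x)) (dilate c y) n) ⟨
    dilate c x 0 A.* dilate c y (suc n) A.+ ((c · dilate c (tail x)) * dilate c y) n
      ≈⟨ A.+-congˡ (*-congʳ {dilate c y} (tail-dilate c x) n) ⟨
    (dilate c x * dilate c y) (suc n) ∎
    where
    open import Relation.Binary.Reasoning.Setoid A.setoid
    open A-Solver using () renaming (solve to A-solve; _:*_ to _∙_; _:+_ to _∔_; _:=_ to _≔_)

  dilate-+ : ∀ c x y → dilate c (x + y) ≈ dilate c x + dilate c y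
  dilate-+ c x y n = A.distribˡ (c ^ n) (x n) (y n)

  dilate-constant : ∀ c k → dilate c (constant k) ≈ constant k
  dilate-constant c k zero    = A.*-identityˡ k
  dilate-constant c k (suc n) = A.zeroʳ _

  dilate-Z : ∀ c → dilate c Z ≈ constant c * Z
  dilate-Z c n = A.trans (lemma n) (A.sym (constant-⊛ c Z n))
    where
    lemma : dilate c Z ≈ c · Z
    lemma zero          = A.trans (A.zeroʳ _) (A.sym (A.zeroʳ _))
    lemma (suc zero)    = A.*-congʳ (A.*-identityʳ c)
    lemma (suc (suc n)) = A.trans (A.zeroʳ _) (A.sym (A.zeroʳ _))

  dilate-dilate : ∀ c d x → dilate c (dilate d x) ≈ dilate (c A.* d) x
  dilate-dilate c d x n = A.trans (A.sym (A.*-assoc (c ^ n) (d ^ n) (x n))) (A.*-congʳ (A.sym (^-distrib-* c d n)))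

  1^ : ∀ {c} → c A.≈ A.1# → ∀ n → c ^ n A.≈ A.1#
  1^ c≈1 zero    = A.refl
  1^ c≈1 (suc n) = A.trans (A.*-cong c≈1 (1^ c≈1 n)) (A.*-identityˡ A.1#)

  dilate-1 : ∀ {c} → c A.≈ A.1# → ∀ x → dilate c x ≈ x
  dilate-1 c≈1 x n = A.trans (A.*-congʳ (1^ c≈1 n)) (A.*-identityˡ (x n))

  -- stretch₂ x and stretch₃ x are x(z²) and x(z³).
  stretch₂ stretch₃ : Series → Series
  stretch₂ x 0             = x 0
  stretch₂ x 1             = A.0#
  stretch₂ x (suc (suc n)) = stretch₂ (tail x) n
  stretch₃ x 0                   = x 0
  stretch₃ x 1                   = A.0#
  stretch₃ x 2                   = A.0#
  stretch₃ x (suc (suc (suc n))) = stretch₃ (tail x) n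

  stretch₂-cong : ∀ {x y} → x ≈ y → stretch₂ x ≈ stretch₂ y
  stretch₂-cong p 0             = p 0
  stretch₂-cong p 1             = A.refl
  stretch₂-cong p (suc (suc n)) = stretch₂-cong (p ∘ suc) n

  stretch₃-cong : ∀ {x y} → x ≈ y → stretch₃ x ≈ stretch₃ y
  stretch₃-cong p 0                   = p 0
  stretch₃-cong p 1                   = A.refl
  stretch₃-cong p 2                   = A.refl
  stretch₃-cong p (suc (suc (suc n))) = stretch₃-cong (p ∘ suc) n

  0*+ : ∀ x y → A.0# A.* x A.+ y A.≈ y
  0*+ x y = A.trans (A.+-congʳ (A.zeroˡ x)) (A.+-identityˡ y)

  stretch₂-+ : ∀ x y → stretch₂ (x + y) ≈ stretch₂ x + stretch₂ y
  stretch₂-+ x y 0             = A.refl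
  stretch₂-+ x y 1             = A.sym (A.+-identityˡ A.0#)
  stretch₂-+ x y (suc (suc n)) = stretch₂-+ (tail x) (tail y) n

  stretch₃-+ : ∀ x y → stretch₃ (x + y) ≈ stretch₃ x + stretch₃ y
  stretch₃-+ x y 0                   = A.refl
  stretch₃-+ x y 1                   = A.sym (A.+-identityˡ A.0#)
  stretch₃-+ x y 2                   = A.sym (A.+-identityˡ A.0#)
  stretch₃-+ x y (suc (suc (suc n))) = stretch₃-+ (tail x) (tail y) n

  stretch₂-· : ∀ c x → stretch₂ (c · x) ≈ c · stretch₂ x
  stretch₂-· c x 0             = A.refl
  stretch₂-· c x 1             = A.sym (A.zeroʳ c)
  stretch₂-· c x (suc (suc n)) = stretch₂-· c (tail x) n

  stretch₃-· : ∀ c x → stretch₃ (c · x) ≈ c · stretch₃ x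
  stretch₃-· c x 0                   = A.refl
  stretch₃-· c x 1                   = A.sym (A.zeroʳ c)
  stretch₃-· c x 2                   = A.sym (A.zeroʳ c)
  stretch₃-· c x (suc (suc (suc n))) = stretch₃-· c (tail x) n

  stretch₂-* : ∀ x y → stretch₂ (x * y) ≈ stretch₂ x * stretch₂ y
  stretch₂-* x y 0 = A.refl
  stretch₂-* x y 1 = A.sym (A.trans (A.+-cong (A.zeroʳ _) (A.zeroˡ _)) (A.+-identityˡ _))
  stretch₂-* x y (suc (suc n)) = A.trans (stretch₂-+ (x 0 · tail y) (tail x * y) n)
    (A.+-cong (stretch₂-· (x 0) (tail y) n) (A.trans (stretch₂-* (tail x) y n) (A.sym (0*+ _ _))))

  stretch₃-* : ∀ x y → stretch₃ (x * y) ≈ stretch₃ x * stretch₃ y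
  stretch₃-* x y 0 = A.refl
  stretch₃-* x y 1 = A.sym (A.trans (A.+-cong (A.zeroʳ _) (A.zeroˡ _)) (A.+-identityˡ _))
  stretch₃-* x y 2 = A.sym (A.trans (A.+-cong (A.zeroʳ _) (A.trans (0*+ _ _) (A.zeroˡ _))) (A.+-identityˡ _))
  stretch₃-* x y (suc (suc (suc n))) = A.trans (stretch₃-+ (x 0 · tail y) (tail x * y) n)
    (A.+-cong (stretch₃-· (x 0) (tail y) n)
      (A.trans (stretch₃-* (tail x) y n) (A.sym (A.trans (0*+ _ _) (0*+ _ _)))))

  stretch₂-constant : ∀ k → stretch₂ (constant k) ≈ constant k
  stretch₂-constant k 0             = A.refl
  stretch₂-constant k 1             = A.refl
  stretch₂-constant k (suc (suc n)) = go n
    where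
    go : ∀ n → stretch₂ 0# n A.≈ A.0#
    go 0             = A.refl
    go 1             = A.refl
    go (suc (suc n)) = go n

  stretch₃-constant : ∀ k → stretch₃ (constant k) ≈ constant k
  stretch₃-constant k 0                   = A.refl
  stretch₃-constant k 1                   = A.refl
  stretch₃-constant k 2                   = A.refl
  stretch₃-constant k (suc (suc (suc n))) = go n
    where
    go : ∀ n → stretch₃ 0# n A.≈ A.0#
    go 0                   = A.refl
    go 1                   = A.refl
    go 2                   = A.refl
    go (suc (suc (suc n))) = go n

  stretch₂-Z : stretch₂ Z ≈ Z * Z
  stretch₂-Z 0             = A.sym (A.zeroˡ _)
  stretch₂-Z 1             = A.sym (Z*-suc Z 0)
  stretch₂-Z (suc (suc n)) = A.trans (stretch₂-cong tail-Z n) (A.trans (stretch₂-constant A.1# n)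
    (A.sym (A.trans (Z*-suc Z (suc n)) (tail-Z n))))

  stretch₃-Z : stretch₃ Z ≈ Z * (Z * Z)
  stretch₃-Z 0                   = A.sym (A.zeroˡ _)
  stretch₃-Z 1                   = A.sym (A.trans (Z*-suc (Z * Z) 0) (Z*-zero Z))
  stretch₃-Z 2                   = A.sym (A.trans (Z*-suc (Z * Z) 1) (Z*-suc Z 0))
  stretch₃-Z (suc (suc (suc n))) = A.trans (stretch₃-cong tail-Z n) (A.trans (stretch₃-constant A.1# n)
    (A.sym (A.trans (Z*-suc (Z * Z) (suc (suc n))) (A.trans (Z*-suc Z (suc n)) (tail-Z n)))))

  -- The Euler derivation z d/dz.
  ϑ : Series → Series
  ϑ x n = A.ι (♮ n) A.* x n

  ι♮-suc : ∀ n → A.ι (♮ (suc n)) A.≈ A.1# A.+ A.ι (♮ n)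
  ι♮-suc n = A.trans (A.ι-cong (♮-suc n)) (A.trans (A.ι-+ 1ℚ (♮ n)) (A.+-congʳ A.ι-1))

  ι♮-0 : A.ι (♮ 0) A.≈ A.0#
  ι♮-0 = A.trans (A.ι-cong ♮-0) A.ι-0

  tail-ϑ : ∀ x → tail (ϑ x) ≈ tail x + ϑ (tail x)
  tail-ϑ x n = A.trans (A.*-congʳ (ι♮-suc n)) (A.trans (A.distribʳ _ _ _) (A.+-congʳ (A.*-identityˡ _)))

  ϑ-* : ∀ x y → ϑ (x * y) ≈ ϑ x * y + x * ϑ y
  ϑ-* x y zero = A.trans (0*≈ (x 0 A.* y 0)) (A.sym (A.trans (A.+-cong
      (A.trans (A.*-congʳ (0*≈ (x 0))) (A.zeroˡ _)) (A.trans (A.*-congˡ (0*≈ (y 0))) (A.zeroʳ _))) (A.+-identityˡ A.0#)))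
    where
    0*≈ : ∀ u → A.ι (♮ 0) A.* u A.≈ A.0#
    0*≈ u = A.trans (A.*-congʳ ι♮-0) (A.zeroˡ u)
  ϑ-* x y (suc n) = begin
    s A.* (x 0 A.* y (suc n) A.+ (tail x * y) n)
      ≈⟨ A-solve 4 (λ s u v w → s ∙ (u ∙ v ∔ w) ≔ u ∙ (s ∙ v) ∔ s ∙ w) A.refl s (x 0) (y (suc n)) ((tail x * y) n) ⟩
    x 0 A.* ϑ y (suc n) A.+ s A.* (tail x * y) n
      ≈⟨ A.+-congˡ (tail-ϑ′ (tail x * y) n) ⟩
    x 0 A.* ϑ y (suc n) A.+ ((tail x * y) n A.+ ϑ (tail x * y) n)
      ≈⟨ A.+-congˡ (A.+-congˡ (ϑ-* (tail x) y n)) ⟩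
    x 0 A.* ϑ y (suc n) A.+ ((tail x * y) n A.+ ((ϑ (tail x) * y) n A.+ (tail x * ϑ y) n))
      ≈⟨ A-solve 4 (λ u v w z → u ∔ (v ∔ (w ∔ z)) ≔ (v ∔ w) ∔ (u ∔ z)) A.refl (x 0 A.* ϑ y (suc n)) ((tail x * y) n) ((ϑ (tail x) * y) n) ((tail x * ϑ y) n) ⟩
    ((tail x * y) n A.+ (ϑ (tail x) * y) n) A.+ (x 0 A.* ϑ y (suc n) A.+ (tail x * ϑ y) n)
      ≈⟨ A.+-congʳ (⊛-distribʳ y (tail x) (ϑ (tail x)) n) ⟨
    ((tail x + ϑ (tail x)) * y) n A.+ (x * ϑ y) (suc n)
      ≈⟨ A.+-congʳ (*-congʳ {y} (tail-ϑ x) n) ⟨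
    (tail (ϑ x) * y) n A.+ (x * ϑ y) (suc n)
      ≈⟨ A.+-congʳ (A.trans (A.+-congʳ (A.trans (A.*-congʳ (A.trans (A.*-congʳ ι♮-0) (A.zeroˡ _))) (A.zeroˡ _))) (A.+-identityˡ _)) ⟨
    (ϑ x * y) (suc n) A.+ (x * ϑ y) (suc n) ∎
    where
    open import Relation.Binary.Reasoning.Setoid A.setoid
    open A-Solver using () renaming (solve to A-solve; _:*_ to _∙_; _:+_ to _∔_; _:=_ to _≔_)
    s : A.Carrier
    s = A.ι (♮ (suc n))
    tail-ϑ′ : ∀ z n → A.ι (♮ (suc n)) A.* z n A.≈ z n A.+ ϑ z n
    tail-ϑ′ z n = A.trans (A.*-congʳ (ι♮-suc n)) (A.trans (A.distribʳ _ _ _) (A.+-congʳ (A.*-identityˡ _)))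

  -- The derivation multiplies the coefficient of degree n + 1 by n + 1, which is invertible because
  -- the ring contains the rationals.
  ϑ-0⇒constant : ∀ x → ϑ x ≈ 0# → x ≈ constant (x 0)
  ϑ-0⇒constant x ϑx≈0 zero    = A.refl
  ϑ-0⇒constant x ϑx≈0 (suc n) = begin
    x (suc n)                                         ≈⟨ A.*-identityˡ _ ⟨
    A.1# A.* x (suc n)                                ≈⟨ A.*-congʳ inverse ⟨
    A.ι r A.* A.ι (♮ (suc n)) A.* x (suc n)           ≈⟨ A.*-assoc _ _ _ ⟩
    A.ι r A.* ϑ x (suc n)                             ≈⟨ A.*-congˡ (ϑx≈0 (suc n)) ⟩
    A.ι r A.* A.0#                                    ≈⟨ A.zeroʳ _ ⟩
    A.0#                                              ∎
    where
    open import Relation.Binary.Reasoning.Setoid A.setoid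
    r : ℚ
    r = ℤ.+ 1 ℚ./ suc n
    inverse : A.ι r A.* A.ι (♮ (suc n)) A.≈ A.1#
    inverse = A.trans (A.sym (A.ι-* r (♮ (suc n)))) (A.trans (A.ι-cong (≡.trans (/-♮ 1 n) (♮-/1 1))) A.ι-1)

  B : Series
  B n = A.ι (b n)

  B-0 : B 0 A.≈ A.1#
  B-0 = A.trans (A.ι-cong b-0) A.ι-1

  ι-two*-suc : ∀ n → A.ι two A.* (ϑ B (suc n) A.+ A.- ϑ B n) A.≈ B n
  ι-two*-suc n = begin
    A.ι two A.* (A.ι (♮ (suc n)) A.* A.ι y A.+ A.- (A.ι t A.* A.ι x))
      ≈⟨ A.*-congˡ (A.+-congʳ (A.*-congʳ (A.trans (ι♮-suc n) (A.+-congʳ (A.sym A.ι-1))))) ⟩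
    A.ι two A.* ((A.ι 1ℚ A.+ A.ι t) A.* A.ι y A.+ A.- (A.ι t A.* A.ι x))
      ≈⟨ A-solve 3 (λ t x y → con′ two ∙ ((con′ 1ℚ ∔ t) ∙ y ∔ (⊝ (t ∙ x)))
            ≔ (con′ two ∔ con′ two ∙ t) ∙ y ∔ (⊝ ((con′ two ∙ t) ∙ x))) A.refl (A.ι t) (A.ι x) (A.ι y) ⟩
    (A.ι two A.+ A.ι two A.* A.ι t) A.* A.ι y A.+ A.- (A.ι two A.* A.ι t A.* A.ι x)
      ≈⟨ A.+-congʳ recurrence ⟩
    (A.1# A.+ A.ι two A.* A.ι t) A.* A.ι x A.+ A.- (A.ι two A.* A.ι t A.* A.ι x)
      ≈⟨ A-solve 3 (λ o u x → (o ∔ u) ∙ x ∔ (⊝ (u ∙ x)) ≔ o ∙ x) A.refl A.1# (A.ι two A.* A.ι t) (A.ι x) ⟩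
    A.1# A.* A.ι x
      ≈⟨ A.*-identityˡ _ ⟩
    A.ι x ∎
    where
    open import Relation.Binary.Reasoning.Setoid A.setoid
    open A-Solver using () renaming (solve to A-solve; con to con′; :-_ to ⊝_; _:*_ to _∙_; _:+_ to _∔_; _:=_ to _≔_)
    t x y : ℚ
    t = ♮ n
    x = b n
    y = b (suc n)
    ι-linear : ∀ r s u → A.ι ((r ℚ.+ s ℚ.* t) ℚ.* u) A.≈ (A.ι r A.+ A.ι s A.* A.ι t) A.* A.ι u
    ι-linear r s u = A.trans (A.ι-* (r ℚ.+ s ℚ.* t) u) (A.*-congʳ (A.trans (A.ι-+ r (s ℚ.* t)) (A.+-congˡ (A.ι-* s t))))
    recurrence : (A.ι two A.+ A.ι two A.* A.ι t) A.* A.ι y A.≈ (A.1# A.+ A.ι two A.* A.ι t) A.* A.ι x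
    recurrence = A.trans (A.sym (ι-linear two two y)) (A.trans (A.ι-cong (b-suc n))
      (A.trans (ι-linear 1ℚ two x) (A.*-congʳ (A.+-congʳ A.ι-1))))

  -- The differential equation of (1 - z)^(-1/2); coefficientwise it is the recurrence `b-suc`.
  ϑB : ι two * ((1# - Z) * ϑ B) ≈ Z * B
  ϑB = begin
    ι two * ((1# - Z) * ϑ B)
      ≈⟨ *-congˡ {ι two} (*-congʳ {ϑ B} (+-congʳ {⊖ Z} (sym ι-1))) ⟩
    ι two * ((ι 1ℚ - Z) * ϑ B)
      ≈⟨ solve 2 (λ z d → con two :* ((con 1ℚ :- z) :* d) := con two :* (d :- z :* d)) refl Z (ϑ B) ⟩
    ι two * (ϑ B - Z * ϑ B)
      ≈⟨ constant-⊛ (A.ι two) (ϑ B - Z * ϑ B) ⟩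
    A.ι two · (ϑ B - Z * ϑ B)
      ≈⟨ ≈-suc
        (A.trans (A.*-congˡ (A.trans (A.+-cong (A.trans (A.*-congʳ ι♮-0) (A.zeroˡ _)) (A.-‿cong (Z*-zero (ϑ B)))) (A.-‿inverseʳ A.0#)))
          (A.trans (A.zeroʳ _) (A.sym (Z*-zero B))))
        (λ n → A.trans (A.*-congˡ (A.+-congˡ (A.-‿cong (Z*-suc (ϑ B) n)))) (A.trans (ι-two*-suc n) (A.sym (Z*-suc B n)))) ⟩
    Z * B ∎
    where open import Relation.Binary.Reasoning.Setoid setoid

  ϑ-Z : ϑ Z ≈ Z
  ϑ-Z 0             = A.zeroʳ _
  ϑ-Z 1             = A.trans (A.*-identityʳ _) (A.trans (A.ι-cong (♮-/1 1)) A.ι-1)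
  ϑ-Z (suc (suc n)) = A.zeroʳ _

  ϑ-[1-Z] : ϑ (1# - Z) ≈ - Z
  ϑ-[1-Z] n = A.trans (A.distribˡ _ _ _) (A.trans (A.+-cong (ϑ-1 n)
      (A.trans (A.sym (-‿distribʳ-* _ _)) (A.-‿cong (ϑ-Z n)))) (A.+-identityˡ _))
    where
    open import Algebra.Properties.Ring A.ring using (-‿distribʳ-*)
    ϑ-1 : ϑ 1# ≈ 0#
    ϑ-1 zero    = A.trans (A.*-congʳ ι♮-0) (A.zeroˡ _)
    ϑ-1 (suc n) = A.zeroʳ _

  -- By the differential equation the derivation annihilates the left side, so it equals its
  -- constant term. This takes the place of a direct proof of the convolution identity Σ b i b (n -
  -- i) = 1.
  B²[1-Z] : B * B * (1# - Z) ≈ 1#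
  B²[1-Z] = trans (ϑ-0⇒constant (B * B * (1# - Z)) (begin
    ϑ (B * B * (1# - Z))
      ≈⟨ ϑ-* (B * B) (1# - Z) ⟩
    ϑ (B * B) * (1# - Z) + B * B * ϑ (1# - Z)
      ≈⟨ +-cong (*-congʳ {1# - Z} (ϑ-* B B)) (*-congˡ {B * B} ϑ-[1-Z]) ⟩
    (ϑ B * B + B * ϑ B) * (1# - Z) + B * B * (- Z)
      ≈⟨ solve 4 (λ d b e z → (d :* b :+ b :* d) :* e :+ b :* b :* (:- z) := b :* (con two :* (e :* d)) :- b :* (z :* b)) refl (ϑ B) B (1# - Z) Z ⟩
    B * (ι two * ((1# - Z) * ϑ B)) - B * (Z * B)
      ≈⟨ +-congʳ {⊖ (B * (Z * B))} (*-congˡ {B} ϑB) ⟩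
    B * (Z * B) - B * (Z * B)
      ≈⟨ -‿inverseʳ (B * (Z * B)) ⟩
    0# ∎)) (constant-cong (A.trans (A.*-cong (A.trans (A.*-cong B-0 B-0) (A.*-identityˡ _))
      (A.trans (A.+-congˡ (A.trans (A.sym (A.+-identityˡ _)) (A.-‿inverseʳ _))) (A.+-identityʳ _))) (A.*-identityˡ _)))
    where open import Relation.Binary.Reasoning.Setoid setoid

-- up h n and down h n count the zigzag paths of size n that are empty or
-- start with an up-step (down-step) and never descend by more than h.
up down : ℕ → ℕ → ℕ
up h 0             = 1
up h 1             = down (2 ℕ.+ h) 0
up h (suc (suc n)) = down (2 ℕ.+ h) (suc n) ℕ.+ down (1 ℕ.+ h) n
down h             0             = 1
down 0             (suc n)       = 0
down 1             1             = 0
down 1             (suc (suc n)) = up 0 n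
down (suc (suc h)) 1             = up h 0
down (suc (suc h)) (suc (suc n)) = up h (suc n) ℕ.+ up (suc h) n

double : ℕ → ℕ
double zero    = zero
double (suc k) = suc (suc (double k))

-- Generating functions of restricted paths and their closed form.

module GeneratingFunctions (A : ℚ-Algebra) where
  private module A = ℚ-Algebra A
  open PowerSeries A
  open SeriesCalculus A
  open ℚ-Algebra seriesAlgebra
  open Solver using (solve; _:+_; _:*_; _:-_; :-_; _:=_; con)
  open import Relation.Binary.Reasoning.Setoid setoid

  ι♮-1 : A.ι (♮ 1) A.≈ A.1#
  ι♮-1 = A.trans (A.ι-cong (♮-/1 1)) A.ι-1

  ι♮-+ : ∀ m n → A.ι (♮ (m ℕ.+ n)) A.≈ A.ι (♮ m) A.+ A.ι (♮ n)
  ι♮-+ m n = A.trans (A.ι-cong (♮-+ m n)) (A.ι-+ (♮ m) (♮ n))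

  U D : ℕ → Series
  U h n = A.ι (♮ (up h n))
  D h n = A.ι (♮ (down h n))

  step-eq : ∀ {F x y} → F 0 A.≈ A.1# → F 1 A.≈ x 0 → (∀ n → F (suc (suc n)) A.≈ x (suc n) A.+ y n) →
            F ≈ ι 1ℚ + Z * x + Z * (Z * y)
  step-eq {F} {x} {y} p q r = ≈-suc
    (A.trans p (A.sym (A.trans (A.+-cong (A.trans (A.+-cong A.ι-1 (Z*-zero x)) (A.+-identityʳ _)) (Z*-zero (Z * y))) (A.+-identityʳ _))))
    (≈-suc
      (A.trans q (A.sym (A.trans (A.+-cong (A.trans (A.+-identityˡ _) (Z*-suc x 0)) (A.trans (Z*-suc (Z * y) 0) (Z*-zero y))) (A.+-identityʳ _))))
      (λ n → A.trans (r n) (A.sym (A.+-cong (A.trans (A.+-identityˡ _) (Z*-suc x (suc n))) (A.trans (Z*-suc (Z * y) (suc n)) (Z*-suc y n))))))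

  U-step : ∀ h → U h ≈ ι 1ℚ + Z * D (2 ℕ.+ h) + Z * (Z * D (1 ℕ.+ h))
  U-step h = step-eq ι♮-1 A.refl (λ n → ι♮-+ (down (2 ℕ.+ h) (suc n)) (down (1 ℕ.+ h) n))

  D-step : ∀ h → D (2 ℕ.+ h) ≈ ι 1ℚ + Z * U h + Z * (Z * U (suc h))
  D-step h = step-eq ι♮-1 A.refl (λ n → ι♮-+ (up h (suc n)) (up (suc h) n))

  ι♮-0′ : A.ι (♮ 0) A.≈ A.0#
  ι♮-0′ = A.trans (A.ι-cong ♮-0) A.ι-0

  D-1 : D 1 ≈ ι 1ℚ + Z * 0# + Z * (Z * U 0)
  D-1 = step-eq ι♮-1 ι♮-0′ (λ n → A.sym (A.+-identityˡ _))

  -- W (1+h) is the generating function of the paths that start upwards and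
  -- never descend by more than h; W 0 = 0 corresponds to h = -1.
  W : ℕ → Series
  W zero    = 0#
  W (suc h) = U h

  -- a, b and c of the equation for U, and the factors e, p of (c e) p = (1 - a)² - 4 b².
  pa pb pc pe pp : Series
  pa = Z * Z + Z * Z * (Z * Z)
  pb = Z * (Z * Z)
  pc = ι 1ℚ + Z + Z * Z
  pe = ι 1ℚ - Z - Z * Z
  pp = ι 1ℚ - pa + (pb + pb)

  D-W : ∀ h → D (suc h) ≈ ι 1ℚ + Z * W h + Z * (Z * W (suc h))
  D-W zero    = D-1
  D-W (suc h) = D-step h

  W-step : ∀ h → W (suc h) ≈ pc + pa * W (suc h) + pb * (W (suc (suc h)) + W h)
  W-step h = begin
    W (suc h)
      ≈⟨ U-step h ⟩
    ι 1ℚ + Z * D (2 ℕ.+ h) + Z * (Z * D (1 ℕ.+ h))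
      ≈⟨ +-cong (+-congˡ {ι 1ℚ} (*-congˡ {Z} (D-W (suc h)))) (*-congˡ {Z} (*-congˡ {Z} (D-W h))) ⟩
    ι 1ℚ + Z * (ι 1ℚ + Z * u + Z * (Z * v)) + Z * (Z * (ι 1ℚ + Z * w + Z * (Z * u)))
      ≈⟨ solve 4 (λ z u v w →
           con 1ℚ :+ z :* (con 1ℚ :+ z :* u :+ z :* (z :* v)) :+ z :* (z :* (con 1ℚ :+ z :* w :+ z :* (z :* u)))
           := con 1ℚ :+ z :+ z :* z :+ (z :* z :+ z :* z :* (z :* z)) :* u :+ z :* (z :* z) :* (v :+ w)) refl Z u v w ⟩
    pc + pa * u + pb * (v + w) ∎
    where
    u v w : Series
    u = W (suc h)
    v = W (suc (suc h))
    w = W h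

  -- Divisibility by zⁿ.
  Vanishes : ℕ → Series → Set
  Vanishes n x = ∀ i → i ℕ.< n → x i A.≈ A.0#

  vanishes-+ : ∀ {n x y} → Vanishes n x → Vanishes n y → Vanishes n (x + y)
  vanishes-+ p q i i<n = A.trans (A.+-cong (p i i<n) (q i i<n)) (A.+-identityˡ _)

  vanishes-Z* : ∀ {n x} → Vanishes n x → Vanishes (suc n) (Z * x)
  vanishes-Z* {x = x} p zero    _           = Z*-zero x
  vanishes-Z* {x = x} p (suc i) (ℕ.s≤s i<n) = A.trans (Z*-suc x i) (p i i<n)

  vanishes-weaken : ∀ {n x} → Vanishes (suc n) x → Vanishes n x
  vanishes-weaken p i i<n = p i (ℕ.m<n⇒m<1+n i<n)

  -- Both `pa` and `pb` are divisible by z², so if all `Δ h` are divisible by zⁿ, all are divisible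
  -- by the next power. One boundary value therefore determines a solution of this second-order
  -- recursion in `h`.
  homogeneous-0 : ∀ (Δ : ℕ → Series) → Δ 0 ≈ 0# →
    (∀ h → Δ (suc h) ≈ pa * Δ (suc h) + pb * (Δ (suc (suc h)) + Δ h)) → ∀ h → Δ h ≈ 0#
  homogeneous-0 Δ Δ₀ step h n = vanishes (suc n) h n (ℕ.n<1+n n)
    where
    vanishes : ∀ n h → Vanishes n (Δ h)
    vanishes zero    h       i ()
    vanishes (suc n) zero    i _   = Δ₀ i
    vanishes (suc n) (suc h) i i<n = A.trans (step h i) (A.trans (regroup i)
      (vanishes-Z* {x = Z * (x + Z * (y + Z * x))} (vanishes-weaken (vanishes-Z* {x = x + Z * (y + Z * x)}
        (vanishes-+ {x = x} (vanishes n (suc h)) (vanishes-weaken (vanishes-Z* {x = y + Z * x}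
          (vanishes-+ {x = y} (vanishes-+ {x = Δ (suc (suc h))} (vanishes n (suc (suc h))) (vanishes n h))
            (vanishes-weaken (vanishes-Z* {x = x} (vanishes n (suc h)))))))))) i i<n))
      where
      x y : Series
      x = Δ (suc h)
      y = Δ (suc (suc h)) + Δ h
      regroup : pa * x + pb * y ≈ Z * (Z * (x + Z * (y + Z * x)))
      regroup = solve 3 (λ z x y → (z :* z :+ z :* z :* (z :* z)) :* x :+ z :* (z :* z) :* y
        := z :* (z :* (x :+ z :* (y :+ z :* x)))) refl Z x y

  -- The generating function of the paths that start upwards and stop at their first
  -- point below the initial level.
  Y : Series
  Y = ι 1ℚ - pe * W 1

  -- Proved without cutting any path: the defect of the equation vanishes at h = 0 and satisfies the
  -- homogeneous recursion. The inhomogeneous terms cancel because c e = 1 - a - 2b, and this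
  -- dictates the form of `Y`.
  W-suc : ∀ h → W (suc h) ≈ W 1 + Y * W h
  W-suc h = begin
    W (suc h)                                     ≈⟨ solve 2 (λ x y → x := (x :- y) :+ y) refl (W (suc h)) (W 1 + Y * W h) ⟩
    W (suc h) - (W 1 + Y * W h) + (W 1 + Y * W h) ≈⟨ +-congʳ {W 1 + Y * W h} (homogeneous-0 Δ Δ₀ step h) ⟩
    0# + (W 1 + Y * W h)                          ≈⟨ +-identityˡ (W 1 + Y * W h) ⟩
    W 1 + Y * W h                                 ∎
    where
    Δ : ℕ → Series
    Δ h = W (suc h) - (W 1 + Y * W h)
    Δ₀ : Δ 0 ≈ 0#
    Δ₀ = trans (+-congˡ {W 1} (-‿cong {W 1 + Y * 0#} (trans (+-congˡ {W 1} (zeroʳ Y)) (+-identityʳ (W 1))))) (-‿inverseʳ (W 1))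
    step : ∀ h → Δ (suc h) ≈ pa * Δ (suc h) + pb * (Δ (suc (suc h)) + Δ h)
    step h = begin
      x - (u + Y * v)
        ≈⟨ +-cong (W-step (suc h)) (-‿cong (+-congˡ {u} (*-congˡ {Y} (W-step h)))) ⟩
      pc + pa * x + pb * (t + v) - (u + Y * (pc + pa * v + pb * (x + w)))
        ≈⟨ solve 6 (λ z t x u v w →
             let a = z :* z :+ z :* z :* (z :* z); b = z :* (z :* z)
                 c = con 1ℚ :+ z :+ z :* z
                 Y = con 1ℚ :- (con 1ℚ :- z :- z :* z) :* u
             in c :+ a :* x :+ b :* (t :+ v) :- (u :+ Y :* (c :+ a :* v :+ b :* (x :+ w)))
                := a :* (x :- (u :+ Y :* v)) :+ b :* (t :- (u :+ Y :* x) :+ (v :- (u :+ Y :* w)))) refl Z t x u v w ⟩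
      pa * (x - (u + Y * v)) + pb * (t - (u + Y * x) + (v - (u + Y * w))) ∎
      where
      t x u v w : Series
      t = W (suc (suc (suc h)))
      x = W (suc (suc h))
      u = W 1
      v = W (suc h)
      w = W h

  -- With `W 2` eliminated by `W-suc 1` and c e = 1 - a - 2b, the equation `W-step 0` becomes b e u²
  -- + c e u = c for u = `W 1`. Multiplying by 4b completes the square.
  W₁-quadratic : pe * ((pc + ι two * pb * W 1) * (pc + ι two * pb * W 1)) ≈ pc * pp
  W₁-quadratic = begin
    pe * ((pc + ι two * pb * u) * (pc + ι two * pb * u))
      ≈⟨ solve 2 (λ z u →
           let c = con 1ℚ :+ z :+ z :* z; e = con 1ℚ :- z :- z :* z; b = z :* (z :* z)
               a = z :* z :+ z :* z :* (z :* z); four = con two :* con two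
           in e :* ((c :+ con two :* b :* u) :* (c :+ con two :* b :* u))
              := c :* c :* e :+ four :* b :* (u :- (c :+ a :* u :+ b :* ((u :+ (con 1ℚ :- e :* u) :* u) :+ con 0ℚ)) :+ c)) refl Z u ⟩
    pc * pc * pe + ι two * ι two * pb * (u - (pc + pa * u + pb * ((u + Y * u) + ι 0ℚ)) + pc)
      ≈⟨ +-congˡ {pc * pc * pe} (*-congˡ {ι two * ι two * pb} (+-congʳ {pc} (begin
           u - (pc + pa * u + pb * ((u + Y * u) + ι 0ℚ))
             ≈⟨ +-congˡ {u} (-‿cong (+-congˡ {pc + pa * u} (*-congˡ {pb} (+-cong (sym (W-suc 1)) ι-0)))) ⟩
           u - (pc + pa * u + pb * (W 2 + W 0))
             ≈⟨ +-congˡ {u} (-‿cong (W-step 0)) ⟨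
           u - u
             ≈⟨ -‿inverseʳ u ⟩
           0# ∎))) ⟩
    pc * pc * pe + ι two * ι two * pb * (0# + pc)
      ≈⟨ +-congˡ {pc * pc * pe} (*-congˡ {ι two * ι two * pb} (+-identityˡ pc)) ⟩
    pc * pc * pe + ι two * ι two * pb * pc
      ≈⟨ solve 1 (λ z →
           let c = con 1ℚ :+ z :+ z :* z; e = con 1ℚ :- z :- z :* z; b = z :* (z :* z)
               a = z :* z :+ z :* z :* (z :* z); four = con two :* con two
           in c :* c :* e :+ four :* b :* c := c :* (con 1ℚ :- a :+ (b :+ b))) refl Z ⟩
    pc * pp ∎
    where
    u : Series
    u = W 1

  -- β, θ, ψ are 1/φ, 1/φ², φ² for the golden ratio φ.
  module Golden (β : A.Carrier) (β²+β≈1 : β A.* β A.+ β A.≈ A.1#) where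
    θ ψ : A.Carrier
    θ = A.1# A.- β
    ψ = A.ι two A.+ β

    ψθ≈1 : ψ A.* θ A.≈ A.1#
    ψθ≈1 = A.trans (A.*-congˡ (A.+-congʳ (A.sym A.ι-1))) (A.trans
      (A.Solver.solve 1 (λ β → (A.Solver.con two ∔ β) ∙ (A.Solver.con 1ℚ ∸ β) ≔ A.Solver.con two ∸ (β ∙ β ∔ β)) A.refl β)
      (A.trans (A.+-congˡ (A.-‿cong (A.trans β²+β≈1 (A.sym A.ι-1)))) (A.trans (A.+-congˡ (A.sym (A.ι-‿ 1ℚ)))
        (A.trans (A.sym (A.ι-+ two (ℚ.- 1ℚ))) A.ι-1))))
      where open A.Solver using () renaming (_:*_ to _∙_; _:+_ to _∔_; _:=_ to _≔_; _:-_ to _∸_)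

    ψ+θ≈3 : ψ A.+ θ A.≈ A.ι (two ℚ.+ 1ℚ)
    ψ+θ≈3 = A.trans (A.+-congˡ (A.+-congʳ (A.sym A.ι-1)))
      (A.Solver.solve 1 (λ β → A.Solver.con two ∔ β ∔ (A.Solver.con 1ℚ ∸ β) ≔ A.Solver.con (two ℚ.+ 1ℚ)) A.refl β)
      where open A.Solver using () renaming (_:*_ to _∙_; _:+_ to _∔_; _:=_ to _≔_; _:-_ to _∸_)

    -- `H` is (1 + z + z²)^(-1/2), written through 1 + z + z² = (1 - z³)/(1 - z) so that every
    -- square root comes from `B`. `g` is ((1 - θ²z)(1 + θz + θ²z²))^(-1/2). As ψθ = 1, dilating `α`
    -- by θ gives `B * g`, which separates the dominant singularity from the rest.
    H g α : Series
    H = (ι 1ℚ - Z) * B * stretch₃ B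
    g = dilate θ (dilate θ B * H)
    α = dilate ψ (B * g)

    B²[1-Z]′ : B * B * (ι 1ℚ - Z) ≈ ι 1ℚ
    B²[1-Z]′ = trans (*-congˡ {B * B} (+-congʳ {⊖ Z} ι-1)) (trans B²[1-Z] (sym ι-1))

    dilate-B² : ∀ c → dilate c B * dilate c B * (ι 1ℚ - constant c * Z) ≈ ι 1ℚ
    dilate-B² c = begin
      dilate c B * dilate c B * (ι 1ℚ - constant c * Z)
        ≈⟨ *-cong (dilate-* c B B) (+-cong (dilate-constant c (A.ι 1ℚ)) (⊖-dilate-Z)) ⟨
      dilate c (B * B) * (dilate c (ι 1ℚ) + dilate c (⊖ Z))
        ≈⟨ *-congˡ {dilate c (B * B)} (dilate-+ c (ι 1ℚ) (⊖ Z)) ⟨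
      dilate c (B * B) * dilate c (ι 1ℚ - Z)
        ≈⟨ dilate-* c (B * B) (ι 1ℚ - Z) ⟨
      dilate c (B * B * (ι 1ℚ - Z))
        ≈⟨ dilate-cong c B²[1-Z]′ ⟩
      dilate c (ι 1ℚ)
        ≈⟨ dilate-constant c (A.ι 1ℚ) ⟩
      ι 1ℚ ∎
      where
      open import Algebra.Properties.Ring A.ring using (-‿distribʳ-*)
      ⊖-dilate-Z : dilate c (⊖ Z) ≈ - (constant c * Z)
      ⊖-dilate-Z n = A.trans (A.sym (-‿distribʳ-* _ _)) (A.-‿cong (dilate-Z c n))

    stretch₃-B² : stretch₃ B * stretch₃ B * (ι 1ℚ - Z * (Z * Z)) ≈ ι 1ℚ
    stretch₃-B² = begin
      stretch₃ B * stretch₃ B * (ι 1ℚ - Z * (Z * Z))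
        ≈⟨ *-cong (stretch₃-* B B) (+-cong (stretch₃-constant (A.ι 1ℚ)) stretch₃-⊖Z) ⟨
      stretch₃ (B * B) * (stretch₃ (ι 1ℚ) + stretch₃ (⊖ Z))
        ≈⟨ *-congˡ {stretch₃ (B * B)} (stretch₃-+ (ι 1ℚ) (⊖ Z)) ⟨
      stretch₃ (B * B) * stretch₃ (ι 1ℚ - Z)
        ≈⟨ stretch₃-* (B * B) (ι 1ℚ - Z) ⟨
      stretch₃ (B * B * (ι 1ℚ - Z))
        ≈⟨ stretch₃-cong B²[1-Z]′ ⟩
      stretch₃ (ι 1ℚ)
        ≈⟨ stretch₃-constant (A.ι 1ℚ) ⟩
      ι 1ℚ ∎
      where
      open import Algebra.Properties.Ring A.ring using (-1*x≈-x)
      stretch₃-⊖Z : stretch₃ (⊖ Z) ≈ - (Z * (Z * Z))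
      stretch₃-⊖Z n = A.trans (stretch₃-cong (λ i → A.sym (-1*x≈-x (Z i))) n) (A.trans (stretch₃-· (A.- A.1#) Z n)
        (A.trans (-1*x≈-x _) (A.-‿cong (stretch₃-Z n))))

    *-ι1 : ∀ {x y} → x ≈ ι 1ℚ → y ≈ ι 1ℚ → x * y ≈ ι 1ℚ
    *-ι1 p q = trans (*-cong (trans p ι-1) (trans q ι-1)) (trans (*-identityˡ 1#) (sym ι-1))

    H² : H * H * (ι 1ℚ + Z + Z * Z) ≈ ι 1ℚ
    H² = trans
      (solve 3 (λ z b s → (con 1ℚ :- z) :* b :* s :* ((con 1ℚ :- z) :* b :* s) :* (con 1ℚ :+ z :+ z :* z)
        := (b :* b :* (con 1ℚ :- z)) :* (s :* s :* (con 1ℚ :- z :* (z :* z)))) refl Z B (stretch₃ B))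
      (*-ι1 B²[1-Z]′ stretch₃-B²)

    dilate-H² : ∀ c → dilate c H * dilate c H * (ι 1ℚ + constant c * Z + constant c * Z * (constant c * Z)) ≈ ι 1ℚ
    dilate-H² c = begin
      dilate c H * dilate c H * (ι 1ℚ + constant c * Z + constant c * Z * (constant c * Z))
        ≈⟨ *-cong (dilate-* c H H) (+-cong (+-cong (dilate-constant c (A.ι 1ℚ)) (dilate-Z c))
             (trans (dilate-* c Z Z) (*-cong (dilate-Z c) (dilate-Z c)))) ⟨
      dilate c (H * H) * (dilate c (ι 1ℚ) + dilate c Z + dilate c (Z * Z))
        ≈⟨ *-congˡ {dilate c (H * H)} (trans (dilate-+ c (ι 1ℚ + Z) (Z * Z)) (+-congʳ {dilate c (Z * Z)} (dilate-+ c (ι 1ℚ) Z))) ⟨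
      dilate c (H * H) * dilate c (ι 1ℚ + Z + Z * Z)
        ≈⟨ dilate-* c (H * H) (ι 1ℚ + Z + Z * Z) ⟨
      dilate c (H * H * (ι 1ℚ + Z + Z * Z))
        ≈⟨ dilate-cong c H² ⟩
      dilate c (ι 1ℚ)
        ≈⟨ dilate-constant c (A.ι 1ℚ) ⟩
      ι 1ℚ ∎

    -- The polynomial 1/g². Its value at 1 makes g(1)² accessible although no value g(1) is ever
    -- formed.
    κ : Series
    κ = (ι 1ℚ - constant (θ A.* θ) * Z) * (ι 1ℚ + constant θ * Z + constant θ * Z * (constant θ * Z))

    g²κ : g * g * κ ≈ ι 1ℚ
    g²κ = begin
      g * g * κ
        ≈⟨ *-congʳ {κ} (*-cong factor factor) ⟩
      x * y * (x * y) * κ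
        ≈⟨ solve 4 (λ x y u v → x :* y :* (x :* y) :* (u :* v) := (x :* x :* u) :* (y :* y :* v)) refl x y
             (ι 1ℚ - constant (θ A.* θ) * Z) (ι 1ℚ + constant θ * Z + constant θ * Z * (constant θ * Z)) ⟩
      (x * x * (ι 1ℚ - constant (θ A.* θ) * Z)) * (y * y * (ι 1ℚ + constant θ * Z + constant θ * Z * (constant θ * Z)))
        ≈⟨ *-ι1 (dilate-B² (θ A.* θ)) (dilate-H² θ) ⟩
      ι 1ℚ ∎
      where
      x y : Series
      x = dilate (θ A.* θ) B
      y = dilate θ H
      factor : g ≈ x * y
      factor = trans (dilate-* θ (dilate θ B) H) (*-congʳ {y} (dilate-dilate θ θ B))

    α≈ : α ≈ dilate ψ B * (dilate θ B * H)
    α≈ = trans (dilate-* ψ B g) (*-congˡ {dilate ψ B} (trans (dilate-dilate ψ θ (dilate θ B * H)) (dilate-1 ψθ≈1 (dilate θ B * H))))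

    dilate-θ-α : dilate θ α ≈ B * g
    dilate-θ-α = trans (dilate-dilate θ ψ (B * g)) (dilate-1 (A.trans (A.*-comm θ ψ) ψθ≈1) (B * g))

    constant-* : ∀ k l → constant k * constant l ≈ constant (k A.* l)
    constant-* k l zero    = A.refl
    constant-* k l (suc n) = A.trans (constant-⊛ k (constant l) (suc n)) (A.zeroʳ k)

    α² : α * α * ((ι 1ℚ - ι (two ℚ.+ 1ℚ) * Z + Z * Z) * (ι 1ℚ + Z + Z * Z)) ≈ ι 1ℚ
    α² = begin
      α * α * ((ι 1ℚ - ι (two ℚ.+ 1ℚ) * Z + Z * Z) * (ι 1ℚ + Z + Z * Z))
        ≈⟨ *-cong (*-cong α≈ α≈) (*-congʳ {ι 1ℚ + Z + Z * Z} quadratic) ⟩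
      x * (y * H) * (x * (y * H)) * ((ι 1ℚ - u * Z) * (ι 1ℚ - v * Z) * (ι 1ℚ + Z + Z * Z))
        ≈⟨ solve 6 (λ x y h p q r → x :* (y :* h) :* (x :* (y :* h)) :* (p :* q :* r)
             := (x :* x :* p) :* ((y :* y :* q) :* (h :* h :* r))) refl x y H (ι 1ℚ - u * Z) (ι 1ℚ - v * Z) (ι 1ℚ + Z + Z * Z) ⟩
      (x * x * (ι 1ℚ - u * Z)) * ((y * y * (ι 1ℚ - v * Z)) * (H * H * (ι 1ℚ + Z + Z * Z)))
        ≈⟨ *-ι1 (dilate-B² ψ) (*-ι1 (dilate-B² θ) H²) ⟩
      ι 1ℚ ∎
      where
      x y u v : Series
      x = dilate ψ B
      y = dilate θ B
      u = constant ψ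
      v = constant θ
      quadratic : ι 1ℚ - ι (two ℚ.+ 1ℚ) * Z + Z * Z ≈ (ι 1ℚ - u * Z) * (ι 1ℚ - v * Z)
      quadratic = sym (begin
        (ι 1ℚ - u * Z) * (ι 1ℚ - v * Z)
          ≈⟨ solve 3 (λ z u v → (con 1ℚ :- u :* z) :* (con 1ℚ :- v :* z) := con 1ℚ :- (u :+ v) :* z :+ (u :* v) :* (z :* z)) refl Z u v ⟩
        ι 1ℚ - (u + v) * Z + (u * v) * (Z * Z)
          ≈⟨ +-cong (+-congˡ {ι 1ℚ} (-‿cong (*-congʳ {Z} (trans (sym (constant-⊕ ψ θ)) (constant-cong ψ+θ≈3)))))
               (*-congʳ {Z * Z} (trans (constant-* ψ θ) (constant-cong ψθ≈1))) ⟩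
        ι 1ℚ - ι (two ℚ.+ 1ℚ) * Z + 1# * (Z * Z)
          ≈⟨ +-congˡ {ι 1ℚ - ι (two ℚ.+ 1ℚ) * Z} (*-identityˡ (Z * Z)) ⟩
        ι 1ℚ - ι (two ℚ.+ 1ℚ) * Z + Z * Z ∎)

    α-0 : α 0 A.≈ A.1#
    α-0 = A.trans (A.*-identityˡ _) (A.trans (A.*-cong B-0 g-0) (A.*-identityˡ _))
      where
      g-0 : g 0 A.≈ A.1#
      g-0 = A.trans (A.*-identityˡ _) (A.trans (A.*-cong (A.trans (A.*-identityˡ _) B-0)
        (A.trans (A.*-cong (A.trans (A.*-cong (A.trans (A.+-cong A.ι-1 -0#≈0#) (A.+-identityʳ _)) B-0) (A.*-identityˡ _)) B-0)
          (A.*-identityˡ _))) (A.*-identityˡ _))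
        where open import Algebra.Properties.Ring A.ring using (-0#≈0#)

    A₂ : Series
    A₂ = stretch₂ α

    -- Although `pc`, `pe` and `pp` contain odd powers, their product (1 - a)² - 4b² is a polynomial
    -- in w = z², and it factors as (1 - 3w + w²)(1 + w + w²).
    A₂² : A₂ * A₂ * (pc * pe * pp) ≈ ι 1ℚ
    A₂² = begin
      A₂ * A₂ * (pc * pe * pp)
        ≈⟨ solve 2 (λ z x →
             let c = con 1ℚ :+ z :+ z :* z; e = con 1ℚ :- z :- z :* z; b = z :* (z :* z)
                 a = z :* z :+ z :* z :* (z :* z); w = z :* z
             in x :* x :* (c :* e :* (con 1ℚ :- a :+ (b :+ b)))
                := x :* x :* ((con 1ℚ :+ :- con (two ℚ.+ 1ℚ) :* w :+ w :* w) :* (con 1ℚ :+ w :+ w :* w))) refl Z A₂ ⟩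
      A₂ * A₂ * ((ι 1ℚ + - ι (two ℚ.+ 1ℚ) * (Z * Z) + Z * Z * (Z * Z)) * (ι 1ℚ + Z * Z + Z * Z * (Z * Z)))
        ≈⟨ *-cong (stretch₂-* α α) (trans (stretch₂-* P Q) (*-cong stretch₂-P stretch₂-Q)) ⟨
      stretch₂ (α * α) * stretch₂ (P * Q)
        ≈⟨ stretch₂-* (α * α) (P * Q) ⟨
      stretch₂ (α * α * (P * Q))
        ≈⟨ stretch₂-cong (trans (*-congˡ {α * α} (*-congʳ {Q} (+-congʳ {Z * Z} (+-congˡ {ι 1ℚ} (sym (-‿distribˡ-* (ι (two ℚ.+ 1ℚ)) Z)))))) α²) ⟩
      stretch₂ (ι 1ℚ)
        ≈⟨ stretch₂-constant (A.ι 1ℚ) ⟩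
      ι 1ℚ ∎
      where
      open import Algebra.Properties.Ring ring using (-‿distribˡ-*)
      P Q : Series
      P = ι 1ℚ + - ι (two ℚ.+ 1ℚ) * Z + Z * Z
      Q = ι 1ℚ + Z + Z * Z
      stretch₂-Z² : stretch₂ (Z * Z) ≈ Z * Z * (Z * Z)
      stretch₂-Z² = trans (stretch₂-* Z Z) (*-cong stretch₂-Z stretch₂-Z)
      stretch₂-3Z : stretch₂ (- ι (two ℚ.+ 1ℚ) * Z) ≈ - ι (two ℚ.+ 1ℚ) * (Z * Z)
      stretch₂-3Z = trans (stretch₂-* (- ι (two ℚ.+ 1ℚ)) Z)
        (*-cong (trans (stretch₂-cong (sym (ι-‿ (two ℚ.+ 1ℚ)))) (trans (stretch₂-constant (A.ι (ℚ.- (two ℚ.+ 1ℚ)))) (ι-‿ (two ℚ.+ 1ℚ)))) stretch₂-Z)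
      stretch₂-P : stretch₂ P ≈ ι 1ℚ + - ι (two ℚ.+ 1ℚ) * (Z * Z) + Z * Z * (Z * Z)
      stretch₂-P = trans (stretch₂-+ (ι 1ℚ + - ι (two ℚ.+ 1ℚ) * Z) (Z * Z))
        (+-cong (trans (stretch₂-+ (ι 1ℚ) (- ι (two ℚ.+ 1ℚ) * Z)) (+-cong (stretch₂-constant (A.ι 1ℚ)) stretch₂-3Z)) stretch₂-Z²)
      stretch₂-Q : stretch₂ Q ≈ ι 1ℚ + Z * Z + Z * Z * (Z * Z)
      stretch₂-Q = trans (stretch₂-+ (ι 1ℚ + Z) (Z * Z))
        (+-cong (trans (stretch₂-+ (ι 1ℚ) Z) (+-cong (stretch₂-constant (A.ι 1ℚ)) stretch₂-Z)) stretch₂-Z²)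

    -- Squared and multiplied by `pe`, both sides become `pc * pp`; the constant term 1 on either
    -- side selects the branch of the square root.
    W₁-closed-form : pc + ι two * pb * W 1 ≈ pc * pp * A₂
    W₁-closed-form = sqrt-unique (pc + ι two * pb * W 1) (pc * pp * A₂) x₀ y₀
      (*-cancelʳ pe A.1# (A.trans (A.*-identityʳ _) e₀) _ _ (begin
        x * x * pe                          ≈⟨ *-comm (x * x) pe ⟩
        pe * (x * x)                        ≈⟨ W₁-quadratic ⟩
        pc * pp                             ≈⟨ *-identityʳ (pc * pp) ⟨
        pc * pp * 1#                        ≈⟨ *-congˡ {pc * pp} (trans A₂² ι-1) ⟨
        pc * pp * (A₂ * A₂ * (pc * pe * pp)) ≈⟨ solve 4 (λ c e p a → c :* p :* (a :* a :* (c :* e :* p)) := c :* p :* a :* (c :* p :* a) :* e) refl pc pe pp A₂ ⟩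
        y * y * pe                          ∎))
      where
      x y : Series
      x = pc + ι two * pb * W 1
      y = pc * pp * A₂
      open import Algebra.Properties.Ring A.ring using (-0#≈0#)
      ⊞_ : ∀ {u v : A.Carrier} → u A.≈ A.1# → v A.≈ A.0# → u A.+ v A.≈ A.1#
      ⊞_ p q = A.trans (A.+-cong p q) (A.+-identityʳ _)
      c₀ : pc 0 A.≈ A.1#
      c₀ = ⊞_ (⊞_ A.ι-1 A.refl) (Z*-zero Z)
      e₀ : pe 0 A.≈ A.1#
      e₀ = ⊞_ (⊞_ A.ι-1 -0#≈0#) (A.trans (A.-‿cong (Z*-zero Z)) -0#≈0#)
      b₀ : pb 0 A.≈ A.0#
      b₀ = Z*-zero (Z * Z)
      x₀ : x 0 A.≈ A.1#
      x₀ = ⊞_ c₀ (A.trans (A.*-congʳ (A.trans (A.*-congˡ b₀) (A.zeroʳ _))) (A.zeroˡ _))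
      a₀ : pa 0 A.≈ A.0#
      a₀ = A.trans (A.+-cong (Z*-zero Z) (A.trans (A.*-congʳ (Z*-zero Z)) (A.zeroˡ _))) (A.+-identityˡ _)
      p₀ : pp 0 A.≈ A.1#
      p₀ = ⊞_ (⊞_ A.ι-1 (A.trans (A.-‿cong a₀) -0#≈0#)) (A.trans (A.+-cong b₀ b₀) (A.+-identityˡ _))
      y₀ : y 0 A.≈ A.1#
      y₀ = A.trans (A.*-cong (A.trans (A.*-cong c₀ p₀) (A.*-identityˡ _)) α-0) (A.*-identityˡ _)

    -- Here c p = 1 + z + z³ + z⁵ - z⁶. The closed form is read off at degree 6 + n, where `pc` no
    -- longer contributes and the factor b = z³ has shifted `U 0` by three.
    W₁-coefficients : ∀ n → A.ι two A.* U 0 (3 ℕ.+ n) A.≈ A₂ (6 ℕ.+ n) A.+ A₂ (5 ℕ.+ n) A.+ A₂ (3 ℕ.+ n) A.+ A₂ (1 ℕ.+ n) A.- A₂ n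
    W₁-coefficients n = A.trans (A.sym left) (A.trans (expanded (6 ℕ.+ n)) right)
      where
      Z³ : Series → Series
      Z³ x = Z * (Z * (Z * x))
      Z³-suc : ∀ x n → Z³ x (3 ℕ.+ n) A.≈ x n
      Z³-suc x n = A.trans (Z*-suc (Z * (Z * x)) _) (A.trans (Z*-suc (Z * x) _) (Z*-suc x _))
      expanded : ι two * Z³ (U 0) + pc ≈ A₂ + Z * A₂ + Z³ A₂ + Z * (Z * Z³ A₂) - Z³ (Z³ A₂)
      expanded = begin
        ι two * Z³ (U 0) + pc
          ≈⟨ solve 2 (λ z u → con two :* (z :* (z :* (z :* u))) :+ (con 1ℚ :+ z :+ z :* z) := con 1ℚ :+ z :+ z :* z :+ con two :* (z :* (z :* z)) :* u) refl Z (U 0) ⟩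
        pc + ι two * pb * U 0
          ≈⟨ W₁-closed-form ⟩
        pc * pp * A₂
          ≈⟨ solve 2 (λ z x →
               let c = con 1ℚ :+ z :+ z :* z; b = z :* (z :* z); a = z :* z :+ z :* z :* (z :* z)
                   z³ = λ y → z :* (z :* (z :* y))
               in c :* (con 1ℚ :- a :+ (b :+ b)) :* x
                  := x :+ z :* x :+ z³ x :+ z :* (z :* z³ x) :- z³ (z³ x)) refl Z A₂ ⟩
        A₂ + Z * A₂ + Z³ A₂ + Z * (Z * Z³ A₂) - Z³ (Z³ A₂) ∎
      left : (ι two * Z³ (U 0) + pc) (6 ℕ.+ n) A.≈ A.ι two A.* U 0 (3 ℕ.+ n)
      left = A.trans (A.+-cong (A.trans (constant-⊛ (A.ι two) (Z³ (U 0)) (6 ℕ.+ n)) (A.*-congˡ (Z³-suc (U 0) (3 ℕ.+ n))))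
        (A.trans (A.+-cong (A.+-identityˡ _) (Z*-suc Z (5 ℕ.+ n))) (A.+-identityˡ _))) (A.+-identityʳ _)
      right : (A₂ + Z * A₂ + Z³ A₂ + Z * (Z * Z³ A₂) - Z³ (Z³ A₂)) (6 ℕ.+ n)
        A.≈ A₂ (6 ℕ.+ n) A.+ A₂ (5 ℕ.+ n) A.+ A₂ (3 ℕ.+ n) A.+ A₂ (1 ℕ.+ n) A.- A₂ n
      right = A.+-cong (A.+-cong (A.+-cong (A.+-congˡ (Z*-suc A₂ (5 ℕ.+ n))) (Z³-suc A₂ (3 ℕ.+ n)))
        (A.trans (Z*-suc (Z * Z³ A₂) (5 ℕ.+ n)) (A.trans (Z*-suc (Z³ A₂) (4 ℕ.+ n)) (Z³-suc A₂ (1 ℕ.+ n)))))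
        (A.-‿cong (A.trans (Z³-suc (Z³ A₂) (3 ℕ.+ n)) (Z³-suc A₂ n)))

    stretch₂-double : ∀ x k → stretch₂ x (double k) A.≈ x k
    stretch₂-double x zero    = A.refl
    stretch₂-double x (suc k) = stretch₂-double (tail x) k

    stretch₂-suc-double : ∀ x k → stretch₂ x (suc (double k)) A.≈ A.0#
    stretch₂-suc-double x zero    = A.refl
    stretch₂-suc-double x (suc k) = stretch₂-suc-double (tail x) k

    -- Since α(z²) has only even powers, the parity of the degree decides which of the five terms
    -- survive.
    U₀-odd : ∀ k → A.ι two A.* U 0 (3 ℕ.+ double k) A.≈ α (3 ℕ.+ k) A.- α k
    U₀-odd k = A.trans (W₁-coefficients (double k)) (A.+-cong
      (A.trans (A.+-cong (A.trans (A.+-cong (A.trans (A.+-cong (stretch₂-double α (3 ℕ.+ k)) (stretch₂-suc-double α (2 ℕ.+ k)))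
        (A.+-identityʳ _)) (stretch₂-suc-double α (1 ℕ.+ k))) (A.+-identityʳ _)) (stretch₂-suc-double α k)) (A.+-identityʳ _))
      (A.-‿cong (stretch₂-double α k)))

    U₀-even : ∀ k → A.ι two A.* U 0 (4 ℕ.+ double k) A.≈ α (3 ℕ.+ k) A.+ α (2 ℕ.+ k) A.+ α (1 ℕ.+ k)
    U₀-even k = A.trans (W₁-coefficients (suc (double k))) (A.trans (A.+-cong
      (A.+-cong (A.+-cong (A.trans (A.+-cong (stretch₂-suc-double α (3 ℕ.+ k)) (stretch₂-double α (3 ℕ.+ k))) (A.+-identityˡ _))
        (stretch₂-double α (2 ℕ.+ k))) (stretch₂-double α (1 ℕ.+ k)))
      (A.trans (A.-‿cong (stretch₂-suc-double α k)) -0#≈0#)) (A.+-identityʳ _))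
      where open import Algebra.Properties.Ring A.ring using (-0#≈0#)

-- Finite sums of rationals and geometric decay.

module RationalSums where

  open import Data.Rational.Base
  open import Data.Rational.Properties
  open import Relation.Binary.PropositionalEquality

  *-mono-≤ : ∀ {p q r s} → 0ℚ ≤ p → 0ℚ ≤ r → p ≤ q → r ≤ s → p * r ≤ q * s
  *-mono-≤ {p} {q} {r} {s} 0≤p 0≤r p≤q r≤s = *-mono-≤-nonNeg p q r s 0≤r (≤-trans 0≤p p≤q) p≤q r≤s

  *-monoˡ-≤ : ∀ {q r s} → 0ℚ ≤ q → r ≤ s → q * r ≤ q * s
  *-monoˡ-≤ {q} 0≤q = *-monoˡ-≤-nonNeg q {{nonNegative 0≤q}}

  *-monoʳ-≤ : ∀ {q r s} → 0ℚ ≤ q → r ≤ s → r * q ≤ s * q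
  *-monoʳ-≤ {q} 0≤q = *-monoʳ-≤-nonNeg q {{nonNegative 0≤q}}

  opaque
    rec : ℕ → ℚ
    rec n = ℤ.+ 1 / suc n

    0≤rec : ∀ n → 0ℚ ≤ rec n
    0≤rec n = ℕ/-mono-≤ 0 0 1 n ℕ.z≤n

    rec-anti : ∀ {m n} → m ℕ.≤ n → rec n ≤ rec m
    rec-anti {m} {n} m≤n = ℕ/-mono-≤ 1 n 1 m (ℕ.*-monoʳ-≤ 1 (ℕ.s≤s m≤n))

    rec-0 : rec 0 ≡ 1ℚ
    rec-0 = refl

    rec-inverse : ∀ n → rec n * (1ℚ + ♮ n) ≡ 1ℚ
    rec-inverse n = trans (cong (rec n *_) (sym (♮-suc n))) (trans (/-♮ 1 n) (♮-/1 1))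

    rec-/ : ∀ n → rec n ≡ ℤ.+ 1 / suc n
    rec-/ n = refl

  rec≤1 : ∀ n → rec n ≤ 1ℚ
  rec≤1 n = subst (rec n ≤_) rec-0 (rec-anti ℕ.z≤n)

  -- Sums of the terms with indices 0, …, n.
  Σ : (ℕ → ℚ) → ℕ → ℚ
  Σ m zero    = m 0
  Σ m (suc n) = m 0 + Σ (m ∘ suc) n

  0≤Σ : ∀ {m} → (∀ i → 0ℚ ≤ m i) → ∀ n → 0ℚ ≤ Σ m n
  0≤Σ 0≤m zero    = 0≤m 0
  0≤Σ 0≤m (suc n) = 0≤-+ (0≤m 0) (0≤Σ (0≤m ∘ suc) n)

  Σ-mono : ∀ {m l} n → (∀ i → i ℕ.≤ n → m i ≤ l i) → Σ m n ≤ Σ l n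
  Σ-mono zero    h = h 0 ℕ.z≤n
  Σ-mono (suc n) h = +-mono-≤ (h 0 ℕ.z≤n) (Σ-mono n (λ i i≤n → h (suc i) (ℕ.s≤s i≤n)))

  Σ-+ : ∀ m l n → Σ (λ i → m i + l i) n ≡ Σ m n + Σ l n
  Σ-+ m l zero    = refl
  Σ-+ m l (suc n) = trans (cong (m 0 + l 0 +_) (Σ-+ (m ∘ suc) (l ∘ suc) n))
    (solve 4 (λ a b c d → a :+ b :+ (c :+ d) := (a :+ c) :+ (b :+ d)) refl (m 0) (l 0) (Σ (m ∘ suc) n) (Σ (l ∘ suc) n))
    where open +-*-Solver

  Σ-*ʳ : ∀ m c n → Σ (λ i → m i * c) n ≡ Σ m n * c
  Σ-*ʳ m c zero    = refl
  Σ-*ʳ m c (suc n) = trans (cong (m 0 * c +_) (Σ-*ʳ (m ∘ suc) c n)) (sym (*-distribʳ-+ c (m 0) _))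

  Σ-suc : ∀ m n → Σ m (suc n) ≡ Σ m n + m (suc n)
  Σ-suc m zero    = refl
  Σ-suc m (suc n) = trans (cong (m 0 +_) (Σ-suc (m ∘ suc) n)) (sym (+-assoc (m 0) _ _))

  Σ-0 : ∀ n → Σ (λ _ → 0ℚ) n ≡ 0ℚ
  Σ-0 zero    = refl
  Σ-0 (suc n) = trans (cong (0ℚ +_) (Σ-0 n)) (+-identityˡ 0ℚ)

  ℚ-algebra : ℚ-Algebra
  ℚ-algebra = record
    { commutativeRing = +-*-commutativeRing ; ι = id
    ; ι-+ = λ _ _ → refl ; ι-* = λ _ _ → refl ; ι-‿ = λ _ → refl ; ι-0 = refl ; ι-1 = refl }

  module ℚ-Series where
    open PowerSeries ℚ-algebra public using (_⊛_; ⊛-cong)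
    open SeriesCalculus ℚ-algebra public using (_^_; dilate; dilate-*; tail-dilate)
  open ℚ-Series

  ⊛-nonNeg : ∀ {m l} → (∀ i → 0ℚ ≤ m i) → (∀ i → 0ℚ ≤ l i) → ∀ n → 0ℚ ≤ (m ⊛ l) n
  ⊛-nonNeg 0≤m 0≤l zero    = *-nonNeg (0≤m 0) (0≤l 0)
  ⊛-nonNeg 0≤m 0≤l (suc n) = 0≤-+ (*-nonNeg (0≤m 0) (0≤l (suc n))) (⊛-nonNeg (0≤m ∘ suc) 0≤l n)

  -- The products with i + j ≤ n are among those with i ≤ n and j ≤ n, and all terms are
  -- nonnegative.
  Σ-⊛-≤ : ∀ m l → (∀ i → 0ℚ ≤ m i) → (∀ i → 0ℚ ≤ l i) → ∀ n → Σ (m ⊛ l) n ≤ Σ m n * Σ l n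
  Σ-⊛-≤ m l 0≤m 0≤l zero    = ≤-refl
  Σ-⊛-≤ m l 0≤m 0≤l (suc n) = begin
    m 0 * l 0 + Σ (λ i → m 0 * l (suc i) + (m ∘ suc ⊛ l) i) n
      ≡⟨ cong (m 0 * l 0 +_) (Σ-+ (λ i → m 0 * l (suc i)) (m ∘ suc ⊛ l) n) ⟩
    m 0 * l 0 + (Σ (λ i → m 0 * l (suc i)) n + Σ (m ∘ suc ⊛ l) n)
      ≡⟨ cong (λ z → m 0 * l 0 + (z + Σ (m ∘ suc ⊛ l) n)) (Σ-*ˡ (m 0) (l ∘ suc) n) ⟩
    m 0 * l 0 + (m 0 * Σ (l ∘ suc) n + Σ (m ∘ suc ⊛ l) n)
      ≡⟨ solve 4 (λ x y z w → x :* y :+ (x :* z :+ w) := x :* (y :+ z) :+ w) refl (m 0) (l 0) (Σ (l ∘ suc) n) (Σ (m ∘ suc ⊛ l) n) ⟩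
    m 0 * Σ l (suc n) + Σ (m ∘ suc ⊛ l) n
      ≤⟨ +-monoʳ-≤ (m 0 * Σ l (suc n)) (≤-trans (Σ-⊛-≤ (m ∘ suc) l (0≤m ∘ suc) 0≤l n)
           (*-monoˡ-≤ (0≤Σ (0≤m ∘ suc) n) (≤-trans (≤-by {Σ l n} {Σ l n + l (suc n)} (l (suc n)) (0≤l (suc n)) refl) (≤-reflexive (sym (Σ-suc l n)))))) ⟩
    m 0 * Σ l (suc n) + Σ (m ∘ suc) n * Σ l (suc n)
      ≡⟨ *-distribʳ-+ (Σ l (suc n)) (m 0) (Σ (m ∘ suc) n) ⟨
    Σ m (suc n) * Σ l (suc n) ∎
    where
    open ≤-Reasoning
    open +-*-Solver
    Σ-*ˡ : ∀ c m n → Σ (λ i → c * m i) n ≡ c * Σ m n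
    Σ-*ˡ c m zero    = refl
    Σ-*ˡ c m (suc n) = trans (cong (c * m 0 +_) (Σ-*ˡ c (m ∘ suc) n)) (sym (*-distribˡ-+ c (m 0) _))

  ^-nonNeg : ∀ {q} → 0ℚ ≤ q → ∀ n → 0ℚ ≤ q ^ n
  ^-nonNeg 0≤q zero    = nonNegative⁻¹ 1ℚ
  ^-nonNeg 0≤q (suc n) = *-nonNeg 0≤q (^-nonNeg 0≤q n)

  0≤½^ : ∀ n → 0ℚ ≤ ½ ^ n
  0≤½^ = ^-nonNeg (nonNegative⁻¹ ½)

  ½^-anti : ∀ j k → ½ ^ (j ℕ.+ k) ≤ ½ ^ k
  ½^-anti zero    k = ≤-refl
  ½^-anti (suc j) k = ≤-trans (≤-by {½ * x} {x} (½ * x) (*-nonNeg (nonNegative⁻¹ ½) (0≤½^ (j ℕ.+ k)))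
      (solve 1 (λ x → con ½ :* x :+ con ½ :* x := x) refl x)) (½^-anti j k)
    where
    open +-*-Solver
    x = ½ ^ (j ℕ.+ k)

  ½^-+ : ∀ j k → ½ ^ (j ℕ.+ k) ≡ ½ ^ j * ½ ^ k
  ½^-+ zero    k = sym (*-identityˡ _)
  ½^-+ (suc j) k = trans (cong (½ *_) (½^-+ j k)) (sym (*-assoc ½ (½ ^ j) (½ ^ k)))

  [n+1]½^n≤1 : ∀ n → (1ℚ + ♮ n) * ½ ^ n ≤ 1ℚ
  [n+1]½^n≤1 zero    = ≤-reflexive (cong (λ t → (1ℚ + t) * 1ℚ) ♮-0)
  [n+1]½^n≤1 (suc n) = ≤-trans (≤-by (½ * (♮ n * h)) (*-nonNeg (nonNegative⁻¹ ½) (*-nonNeg (0≤♮ n) (0≤½^ n)))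
      (trans (cong (λ t → (1ℚ + t) * (½ * h) + ½ * (♮ n * h)) (♮-suc n))
        (solve 2 (λ t h → (con 1ℚ :+ (con 1ℚ :+ t)) :* (con ½ :* h) :+ con ½ :* (t :* h) := (con 1ℚ :+ t) :* h) refl (♮ n) h)))
    ([n+1]½^n≤1 n)
    where
    open +-*-Solver
    h = ½ ^ n

  ½^≤rec : ∀ n → ½ ^ n ≤ rec n
  ½^≤rec n = *-cancel-≤ (1ℚ + ♮ n) (0<1+ (0≤♮ n)) (≤-trans ([n+1]½^n≤1 n)
    (≤-reflexive (sym (trans (*-comm (1ℚ + ♮ n) (rec n)) (rec-inverse n)))))

  four : ℚ
  four = two * two

  n[n+1]½^n≤4 : ∀ n → ♮ n * (1ℚ + ♮ n) * ½ ^ n ≤ four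
  n[n+1]½^n≤4 n = ≤-trans
    (≤-by ((two * t + four) * h) (*-nonNeg (0≤-+ (*-nonNeg (nonNegative⁻¹ two) (0≤♮ n)) (nonNegative⁻¹ four)) (0≤½^ n))
      (solve 2 (λ t h → t :* (con 1ℚ :+ t) :* h :+ (con two :* t :+ con four) :* h := polynomial t :* h) refl t h))
    (stronger n)
    where
    open +-*-Solver
    h t : ℚ
    h = ½ ^ n
    t = ♮ n
    polynomial : ∀ {k} → Polynomial k → Polynomial k
    polynomial t = t :* t :+ con (two + 1ℚ) :* t :+ con four
    -- The polynomial P(t) = t² + 3t + 4 dominates t² + t, has the value 4 at 0, and at most doubles
    -- at each step: 2 P(t) - P(t+1) = t² + t.
    stronger : ∀ n → (♮ n * ♮ n + (two + 1ℚ) * ♮ n + four) * ½ ^ n ≤ four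
    stronger zero    = ≤-reflexive (cong (λ t → (t * t + (two + 1ℚ) * t + four) * 1ℚ) ♮-0)
    stronger (suc n) = ≤-trans (≤-by (½ * (♮ n * ♮ n + ♮ n) * ½ ^ n)
        (*-nonNeg (*-nonNeg (nonNegative⁻¹ ½) (0≤-+ (*-nonNeg (0≤♮ n) (0≤♮ n)) (0≤♮ n))) (0≤½^ n))
        (trans (cong (λ t → (t * t + (two + 1ℚ) * t + four) * (½ * ½ ^ n) + ½ * (♮ n * ♮ n + ♮ n) * ½ ^ n) (♮-suc n))
          (solve 2 (λ t h → polynomial (con 1ℚ :+ t) :* (con ½ :* h) :+ con ½ :* (t :* t :+ t) :* h := polynomial t :* h) refl (♮ n) (½ ^ n))))
      (stronger n)

open RationalSums

open ℚ-Series using () renaming (_⊛_ to _⊛ℚ_; _^_ to _^ℚ_; dilate to dilateℚ; dilate-* to dilateℚ-*)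

-- x ⊑ q means ∣ x ∣ ≤ q.
record NormedAlgebra : Set₁ where
  field
    algebra : ℚ-Algebra
  open ℚ-Algebra algebra public
  infix 4 _⊑_
  field
    _⊑_       : Carrier → ℚ → Set
    ⊑-resp    : ∀ {x y q} → x ≈ y → x ⊑ q → y ⊑ q
    ⊑-mono    : ∀ {x p q} → p ℚ.≤ q → x ⊑ p → x ⊑ q
    ⊑-+       : ∀ {x y p q} → x ⊑ p → y ⊑ q → x + y ⊑ p ℚ.+ q
    ⊑-*       : ∀ {x y p q} → x ⊑ p → y ⊑ q → x * y ⊑ p ℚ.* q
    ι-⊑       : ∀ q → ι q ⊑ ℚ.∣ q ∣
    ⊑-bounded : ∀ x → ∃[ q ] (0ℚ ℚ.≤ q × x ⊑ q)

-- Rapidly convergent series, their partial sums, and transfer to coefficients.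

module Estimates (N : NormedAlgebra) where
  open NormedAlgebra N
  open PowerSeries algebra using (Series; tail; _⊛_; _≋_; _·_; _⊕_; constant)
  open SeriesCalculus algebra using (_^_; dilate; Z; B)
  open import Algebra.Properties.Ring ring using (-1*x≈-x)
  open import Relation.Binary.Reasoning.Setoid setoid
  open Solver using (solve; _:+_; _:*_; _:-_; :-_; _:=_; con)

  ι-⊑⁺ : ∀ {q} → 0ℚ ℚ.≤ q → ι q ⊑ q
  ι-⊑⁺ {q} 0≤q = ≡.subst (ι q ⊑_) (ℚ.0≤p⇒∣p∣≡p 0≤q) (ι-⊑ q)

  0-⊑ : ∀ {q} → 0ℚ ℚ.≤ q → 0# ⊑ q
  0-⊑ 0≤q = ⊑-mono 0≤q (⊑-resp ι-0 (ι-⊑ 0ℚ))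

  1-⊑ : 1# ⊑ 1ℚ
  1-⊑ = ⊑-resp ι-1 (ι-⊑ 1ℚ)

  ⊑-neg : ∀ {x q} → x ⊑ q → - x ⊑ q
  ⊑-neg {x} {q} p = ≡.subst (- x ⊑_) (ℚ.*-identityˡ q)
    (⊑-resp (trans (*-congʳ (trans (ι-‿ 1ℚ) (-‿cong ι-1))) (-1*x≈-x x)) (⊑-* (ι-⊑ (ℚ.- 1ℚ)) p))

  -- Partial sums, that is, the coefficients of x/(1 - z); this is why `S` can be moved onto one
  -- factor of a product in `S-⊛`.
  S : Series → Series
  S x zero    = x 0
  S x (suc n) = x 0 + S (tail x) n

  S-suc : ∀ x n → S x (suc n) ≈ S x n + x (suc n)
  S-suc x zero    = refl
  S-suc x (suc n) = trans (+-congˡ (S-suc (tail x) n)) (sym (+-assoc _ _ _))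

  S-cong : ∀ {x y} → x ≋ y → S x ≋ S y
  S-cong p zero    = p 0
  S-cong p (suc n) = +-cong (p 0) (S-cong (p ∘ suc) n)

  S-⊕ : ∀ x y → S (x ⊕ y) ≋ S x ⊕ S y
  S-⊕ x y zero    = refl
  S-⊕ x y (suc n) = trans (+-congˡ (S-⊕ (tail x) (tail y) n))
    (solve 4 (λ a b c d → a :+ b :+ (c :+ d) := (a :+ c) :+ (b :+ d)) refl _ _ _ _)

  S-· : ∀ k x → S (k · x) ≋ k · S x
  S-· k x zero    = refl
  S-· k x (suc n) = trans (+-congˡ (S-· k (tail x) n)) (sym (distribˡ k _ _))

  S-⊛ : ∀ x y → S (x ⊛ y) ≋ x ⊛ S y
  S-⊛ x y zero    = refl
  S-⊛ x y (suc n) = begin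
    x 0 * y 0 + S (x 0 · tail y ⊕ tail x ⊛ y) n
      ≈⟨ +-congˡ (trans (S-⊕ (x 0 · tail y) (tail x ⊛ y) n) (+-cong (S-· (x 0) (tail y) n) (S-⊛ (tail x) y n))) ⟩
    x 0 * y 0 + (x 0 * S (tail y) n + (tail x ⊛ S y) n)
      ≈⟨ solve 4 (λ a b c d → a :* b :+ (a :* c :+ d) := a :* (b :+ c) :+ d) refl _ _ _ _ ⟩
    x 0 * (y 0 + S (tail y) n) + (tail x ⊛ S y) n ∎

  -- The difference is the sum of the terms x i (t (n - i) - s), estimated one by one. It serves
  -- twice: with `t` the partial sums of a second series, and with `t` the series `B`.
  ⊛-compare : ∀ n x t s (m d : ℕ → ℚ) → (∀ i → x i ⊑ m i) → (∀ i → i ℕ.≤ n → t (n ℕ.∸ i) - s ⊑ d i) →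
              (x ⊛ t) n - S x n * s ⊑ Σ (λ i → m i ℚ.* d i) n
  ⊛-compare zero    x t s m d p q =
    ⊑-resp (solve 3 (λ a b c → a :* (b :- c) := a :* b :- a :* c) refl (x 0) (t 0) s) (⊑-* (p 0) (q 0 ℕ.z≤n))
  ⊛-compare (suc n) x t s m d p q =
    ⊑-resp (solve 5 (λ a b c d e → a :* (b :- c) :+ (d :- e :* c) := a :* b :+ d :- (a :+ e) :* c) refl
        (x 0) (t (suc n)) s ((tail x ⊛ t) n) (S (tail x) n))
      (⊑-+ (⊑-* (p 0) (q 0 ℕ.z≤n)) (⊛-compare n (tail x) t s (m ∘ suc) (d ∘ suc) (p ∘ suc) (λ i i≤n → q (suc i) (ℕ.s≤s i≤n))))

  ⊛-⊑ : ∀ x y {m l} → (∀ i → x i ⊑ m i) → (∀ i → y i ⊑ l i) → ∀ n → (x ⊛ y) n ⊑ (m ⊛ℚ l) n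
  ⊛-⊑ x y p q zero    = ⊑-* (p 0) (q 0)
  ⊛-⊑ x y p q (suc n) = ⊑-+ (⊑-* (p 0) (q (suc n))) (⊛-⊑ (tail x) y (p ∘ suc) q n)

  -- Σ 2ⁱ ∣xᵢ∣ ≤ total.
  record Fast (x : Series) : Set where
    field
      weight  : ℕ → ℚ
      total   : ℚ
      0≤weight : ∀ i → 0ℚ ℚ.≤ weight i
      bound   : ∀ i → x i ⊑ dilateℚ ½ weight i
      Σ≤total : ∀ n → Σ weight n ℚ.≤ total

    0≤total : 0ℚ ℚ.≤ total
    0≤total = ℚ.≤-trans (0≤weight 0) (Σ≤total 0)

  open Fast

  fast-resp : ∀ {x y} → x ≋ y → Fast x → Fast y
  fast-resp p X = record
    { weight = weight X ; total = total X ; 0≤weight = 0≤weight X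
    ; bound = λ i → ⊑-resp (p i) (bound X i) ; Σ≤total = Σ≤total X }

  fast-* : ∀ {x y} → Fast x → Fast y → Fast (x ⊛ y)
  fast-* {x} {y} X Y = record
    { weight = weight X ⊛ℚ weight Y
    ; total = total X ℚ.* total Y
    ; 0≤weight = ⊛-nonNeg (0≤weight X) (0≤weight Y)
    ; bound = λ i → ≡.subst ((x ⊛ y) i ⊑_) (≡.sym (dilateℚ-* ½ (weight X) (weight Y) i)) (⊛-⊑ x y (bound X) (bound Y) i)
    ; Σ≤total = λ n → ℚ.≤-trans (Σ-⊛-≤ (weight X) (weight Y) (0≤weight X) (0≤weight Y) n)
        (*-mono-≤ (0≤Σ (0≤weight X) n) (0≤Σ (0≤weight Y) n) (Σ≤total X n) (Σ≤total Y n))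
    }

  fast-+ : ∀ {x y} → Fast x → Fast y → Fast (x ⊕ y)
  fast-+ {x} {y} X Y = record
    { weight = λ i → weight X i ℚ.+ weight Y i
    ; total = total X ℚ.+ total Y
    ; 0≤weight = λ i → 0≤-+ (0≤weight X i) (0≤weight Y i)
    ; bound = λ i → ≡.subst ((x ⊕ y) i ⊑_) (≡.sym (ℚ.*-distribˡ-+ (½ ^ℚ i) (weight X i) (weight Y i))) (⊑-+ (bound X i) (bound Y i))
    ; Σ≤total = λ n → ℚ.≤-trans (ℚ.≤-reflexive (Σ-+ (weight X) (weight Y) n)) (ℚ.+-mono-≤ (Σ≤total X n) (Σ≤total Y n))
    }

  4/5 2/5 : ℚ
  4/5 = ℤ.+ 4 ℚ./ 5
  2/5 = ℤ.+ 2 ℚ./ 5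

  -- Since 2/5 = ½ · 4/5, the powers of 4/5 serve as weights, with sums at most 1/(1 - 4/5) = 5. The
  -- application is c = θ = β², where β ≤ 5/8 gives 25/64, just below 2/5.
  fast-dilate : ∀ {c x} → c ⊑ 2/5 → (∀ i → x i ⊑ 1ℚ) → Fast (dilate c x)
  fast-dilate {c} {x} c⊑ x⊑ = record
    { weight = 4/5 ^ℚ_
    ; total = ℤ.+ 5 ℚ./ 1
    ; 0≤weight = 0≤^
    ; bound = λ i → ≡.subst (dilate c x i ⊑_) (ℚ.*-identityʳ _) (⊑-* (c^ i) (x⊑ i))
    ; Σ≤total = geometric
    }
    where
    open +-*-Solver using () renaming (solve to solveℚ; _:*_ to _∙_; _:=_ to _≔_; con to conℚ)
    0≤^ : ∀ i → 0ℚ ℚ.≤ 4/5 ^ℚ i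
    0≤^ = ^-nonNeg (ℚ.nonNegative⁻¹ 4/5)
    c^ : ∀ i → c ^ i ⊑ ½ ^ℚ i ℚ.* 4/5 ^ℚ i
    c^ zero    = 1-⊑
    c^ (suc i) = ≡.subst (c ^ suc i ⊑_)
      (solveℚ 2 (λ h f → conℚ 2/5 ∙ (h ∙ f) ≔ (conℚ ½ ∙ h) ∙ (conℚ 4/5 ∙ f)) ≡.refl (½ ^ℚ i) (4/5 ^ℚ i)) (⊑-* c⊑ (c^ i))
    geometric : ∀ n → Σ (4/5 ^ℚ_) n ℚ.≤ ℤ.+ 5 ℚ./ 1
    geometric zero    = ≤-by {1ℚ} four (ℚ.nonNegative⁻¹ four) ≡.refl
    geometric (suc n) = ℚ.≤-trans (ℚ.+-monoʳ-≤ 1ℚ (ℚ.≤-trans (ℚ.≤-reflexive tail≡) (*-monoˡ-≤ (ℚ.nonNegative⁻¹ 4/5) (geometric n)))) ℚ.≤-refl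
      where
      tail≡ : Σ (λ i → 4/5 ^ℚ suc i) n ≡ 4/5 ℚ.* Σ (4/5 ^ℚ_) n
      tail≡ = go (4/5 ^ℚ_) n
        where
        go : ∀ m n → Σ (λ i → 4/5 ℚ.* m i) n ≡ 4/5 ℚ.* Σ m n
        go m zero    = ≡.refl
        go m (suc n) = ≡.trans (≡.cong (4/5 ℚ.* m 0 ℚ.+_) (go (m ∘ suc) n)) (≡.sym (ℚ.*-distribˡ-+ 4/5 (m 0) _))

  fast-constant : ∀ k → Fast (constant k)
  fast-constant k = record
    { weight = w ; total = q ; 0≤weight = λ { zero → 0≤q ; (suc i) → ℚ.≤-refl }
    ; bound = λ { zero → ≡.subst (k ⊑_) (≡.sym (ℚ.*-identityˡ q)) k⊑q
                ; (suc i) → 0-⊑ (ℚ.≤-reflexive (≡.sym (ℚ.*-zeroʳ (½ ^ℚ suc i)))) }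
    ; Σ≤total = λ { zero → ℚ.≤-refl ; (suc n) → ℚ.≤-reflexive (≡.trans (≡.cong (q ℚ.+_) (Σ-0 n)) (ℚ.+-identityʳ q)) }
    }
    where
    q : ℚ
    q = proj₁ (⊑-bounded k)
    0≤q : 0ℚ ℚ.≤ q
    0≤q = proj₁ (proj₂ (⊑-bounded k))
    k⊑q : k ⊑ q
    k⊑q = proj₂ (proj₂ (⊑-bounded k))
    w : ℕ → ℚ
    w zero    = q
    w (suc i) = 0ℚ

  fast-Z : Fast Z
  fast-Z = record
    { weight = w ; total = two
    ; 0≤weight = λ { 0 → ℚ.≤-refl ; 1 → ℚ.nonNegative⁻¹ two ; (suc (suc i)) → ℚ.≤-refl }
    ; bound = λ { 0 → 0-⊑ ℚ.≤-refl ; 1 → 1-⊑ ; (suc (suc i)) → 0-⊑ (ℚ.≤-reflexive (≡.sym (ℚ.*-zeroʳ (½ ^ℚ suc (suc i))))) }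
    ; Σ≤total = λ { 0 → ℚ.nonNegative⁻¹ two ; 1 → ℚ.≤-refl
                  ; (suc (suc n)) → ℚ.≤-reflexive (≡.cong (λ z → 0ℚ ℚ.+ (two ℚ.+ z)) (Σ-0 n)) }
    }
    where
    w : ℕ → ℚ
    w 0             = 0ℚ
    w 1             = two
    w (suc (suc i)) = 0ℚ

  fast-S : ∀ {x} (X : Fast x) n → S x n ⊑ total X
  fast-S {x} X n = ⊑-mono (Σ≤total X n) (go x (λ i → ⊑-mono (½^w≤w i) (bound X i)) n)
    where
    ½^w≤w : ∀ i → ½ ^ℚ i ℚ.* weight X i ℚ.≤ weight X i
    ½^w≤w i = ℚ.≤-trans (*-monoʳ-≤ (0≤weight X i) (ℚ.≤-trans (½^≤rec i) (rec≤1 i))) (ℚ.≤-reflexive (ℚ.*-identityˡ _))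
    go : ∀ x {m} → (∀ i → x i ⊑ m i) → ∀ n → S x n ⊑ Σ m n
    go x p zero    = p 0
    go x p (suc n) = ⊑-+ (p 0) (go (tail x) (p ∘ suc) n)

  -- The weight sums are kept as a difference so that the induction on `j` telescopes; `fast-tail-⊑`
  -- then bounds the difference by the total.
  fast-tail : ∀ {x} (X : Fast x) j k → S x (j ℕ.+ k) - S x k ⊑ ½ ^ℚ k ℚ.* (Σ (weight X) (j ℕ.+ k) ℚ.- Σ (weight X) k)
  fast-tail {x} X zero    k = ⊑-resp (sym (-‿inverseʳ (S x k))) (0-⊑ (ℚ.≤-reflexive
    (≡.sym (≡.trans (≡.cong (½ ^ℚ k ℚ.*_) (ℚ.+-inverseʳ (Σ (weight X) k))) (ℚ.*-zeroʳ (½ ^ℚ k))))))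
  fast-tail {x} X (suc j) k = ⊑-resp
    (trans (solve 3 (λ a b c → a :- b :+ c := a :+ c :- b) refl (S x (j ℕ.+ k)) (S x k) (x (suc (j ℕ.+ k)))) (+-congʳ (sym (S-suc x (j ℕ.+ k)))))
    (⊑-mono (ℚ.≤-trans (ℚ.+-monoʳ-≤ (h ℚ.* (s ℚ.- s₀)) (*-monoʳ-≤ (0≤weight X (suc (j ℕ.+ k))) (½^-anti (suc j) k)))
        (ℚ.≤-reflexive (≡.trans (solveℚ 4 (λ h s s₀ w → h ∙ (s ∸ s₀) ∔ h ∙ w ≔ h ∙ ((s ∔ w) ∸ s₀)) ≡.refl h s s₀ (weight X (suc (j ℕ.+ k))))
          (≡.cong (λ z → h ℚ.* (z ℚ.- s₀)) (≡.sym (Σ-suc (weight X) (j ℕ.+ k)))))))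
      (⊑-+ (fast-tail X j k) (bound X (suc (j ℕ.+ k)))))
    where
    open +-*-Solver using () renaming (solve to solveℚ; _:*_ to _∙_; _:+_ to _∔_; _:-_ to _∸_; _:=_ to _≔_)
    h s s₀ : ℚ
    h = ½ ^ℚ k
    s = Σ (weight X) (j ℕ.+ k)
    s₀ = Σ (weight X) k

  fast-tail-⊑ : ∀ {x} (X : Fast x) j k → S x (j ℕ.+ k) - S x k ⊑ ½ ^ℚ k ℚ.* total X
  fast-tail-⊑ X j k = ⊑-mono (*-monoˡ-≤ (0≤½^ k) (ℚ.≤-trans
      (≤-by {Σ (weight X) (j ℕ.+ k) ℚ.- Σ (weight X) k} (Σ (weight X) k) (0≤Σ (0≤weight X) k)
        (solveℚ 2 (λ a b → a ∸ b ∔ b ≔ a) ≡.refl (Σ (weight X) (j ℕ.+ k)) (Σ (weight X) k)))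
      (Σ≤total X (j ℕ.+ k)))) (fast-tail X j k)
    where open +-*-Solver using () renaming (solve to solveℚ; _:+_ to _∔_; _:-_ to _∸_; _:=_ to _≔_)

  ⊑-sub-sym : ∀ {x y q} → x - y ⊑ q → y - x ⊑ q
  ⊑-sub-sym {x} {y} p = ⊑-resp (solve 2 (λ x y → :- (x :- y) := y :- x) refl x y) (⊑-neg p)

  -- The error consists of the terms x i (S y (n - i) - S y n). The decay ½ⁱ of the first factor and
  -- ½ⁿ⁻ⁱ of the second multiply to ½ⁿ for every i; this is then weakened to the common error scale
  -- `rec n`.
  S-product : ∀ {x y} (X : Fast x) (Y : Fast y) n → S (x ⊛ y) n - S x n * S y n ⊑ total X ℚ.* total Y ℚ.* rec n
  S-product {x} {y} X Y n = ⊑-resp (+-congʳ (sym (S-⊛ x y n)))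
    (⊑-mono (ℚ.≤-trans (Σ-mono n termwise) (ℚ.≤-trans (ℚ.≤-reflexive (Σ-*ʳ (weight X) (½ ^ℚ n ℚ.* total Y) n))
        (ℚ.≤-trans (*-mono-≤ (0≤Σ (0≤weight X) n) (*-nonNeg (0≤½^ n) (0≤total Y)) (Σ≤total X n) (*-monoʳ-≤ (0≤total Y) (½^≤rec n)))
          (ℚ.≤-reflexive (solveℚ 3 (λ a b c → a ∙ (b ∙ c) ≔ a ∙ c ∙ b) ≡.refl (total X) (rec n) (total Y))))))
      (⊛-compare n x (S y) (S y n) (dilateℚ ½ (weight X)) (λ i → ½ ^ℚ (n ℕ.∸ i) ℚ.* total Y) (bound X)
        (λ i i≤n → ⊑-sub-sym (≡.subst (λ k → S y k - S y (n ℕ.∸ i) ⊑ ½ ^ℚ (n ℕ.∸ i) ℚ.* total Y)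
          (ℕ.m+[n∸m]≡n i≤n) (fast-tail-⊑ Y i (n ℕ.∸ i))))))
    where
    open +-*-Solver using () renaming (solve to solveℚ; _:*_ to _∙_; _:=_ to _≔_)
    termwise : ∀ i → i ℕ.≤ n → ½ ^ℚ i ℚ.* weight X i ℚ.* (½ ^ℚ (n ℕ.∸ i) ℚ.* total Y) ℚ.≤ weight X i ℚ.* (½ ^ℚ n ℚ.* total Y)
    termwise i i≤n = ℚ.≤-reflexive (≡.trans
      (solveℚ 4 (λ a w c t → a ∙ w ∙ (c ∙ t) ≔ w ∙ (a ∙ c ∙ t)) ≡.refl (½ ^ℚ i) (weight X i) (½ ^ℚ (n ℕ.∸ i)) (total Y))
      (≡.cong (λ z → weight X i ℚ.* (z ℚ.* total Y)) (≡.trans (≡.sym (½^-+ i (n ℕ.∸ i))) (≡.cong (½ ^ℚ_) (ℕ.m+[n∸m]≡n i≤n)))))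

  B-close : ∀ n i → i ℕ.≤ n → B (n ℕ.∸ i) - B n ⊑ ♮ i ℚ.* (1ℚ ℚ.+ ♮ i) ℚ.* (b n ℚ.* rec n)
  B-close n i i≤n = ⊑-resp (trans (ι-+ (b k) (ℚ.- b n)) (+-congˡ (ι-‿ (b n)))) (⊑-mono
    (≡.subst (λ n → b k ℚ.- b n ℚ.≤ ♮ i ℚ.* (1ℚ ℚ.+ ♮ i) ℚ.* (b n ℚ.* rec n)) (ℕ.m+[n∸m]≡n i≤n) difference)
    (ι-⊑⁺ (≡.subst (λ n → 0ℚ ℚ.≤ b k ℚ.- b n) (ℕ.m+[n∸m]≡n i≤n)
      (≡.subst (ℚ._≤ b k ℚ.- b (i ℕ.+ k)) (ℚ.+-inverseʳ (b (i ℕ.+ k))) (ℚ.+-monoˡ-≤ (ℚ.- b (i ℕ.+ k)) (b-anti-+ i k))))))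
    where
    open +-*-Solver using () renaming (solve to solveℚ; _:*_ to _∙_; _:=_ to _≔_)
    k : ℕ
    k = n ℕ.∸ i
    difference : b k ℚ.- b (i ℕ.+ k) ℚ.≤ ♮ i ℚ.* (1ℚ ℚ.+ ♮ i) ℚ.* (b (i ℕ.+ k) ℚ.* rec (i ℕ.+ k))
    difference = *-cancel-≤ (1ℚ ℚ.+ ♮ (i ℕ.+ k)) (0<1+ (0≤♮ (i ℕ.+ k))) (ℚ.≤-trans (b-close i k) (ℚ.≤-reflexive
      (≡.sym (≡.trans (solveℚ 4 (λ p c x r → p ∙ (c ∙ (x ∙ r)) ≔ c ∙ x ∙ (r ∙ p)) ≡.refl
          (1ℚ ℚ.+ ♮ (i ℕ.+ k)) (♮ i ℚ.* (1ℚ ℚ.+ ♮ i)) (b (i ℕ.+ k)) (rec (i ℕ.+ k)))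
        (≡.trans (≡.cong (♮ i ℚ.* (1ℚ ℚ.+ ♮ i) ℚ.* b (i ℕ.+ k) ℚ.*_) (rec-inverse (i ℕ.+ k))) (ℚ.*-identityʳ _))))))

  -- The elementary form of singularity analysis: replacing b (n - i) by b n costs i (i+1) b n /
  -- (n+1), and the decay ½ⁱ of the coefficients of `x` absorbs the factor i (i+1).
  ⊛B-close : ∀ {x} (X : Fast x) n → (x ⊛ B) n - S x n * B n ⊑ four ℚ.* total X ℚ.* (b n ℚ.* rec n)
  ⊛B-close {x} X n = ⊑-mono
    (ℚ.≤-trans (Σ-mono n (λ i _ → termwise i)) (ℚ.≤-trans (ℚ.≤-reflexive (Σ-*ʳ (weight X) (four ℚ.* (b n ℚ.* rec n)) n))
      (ℚ.≤-trans (*-monoʳ-≤ (*-nonNeg (ℚ.nonNegative⁻¹ four) (*-nonNeg (0≤b n) (0≤rec n))) (Σ≤total X n))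
        (ℚ.≤-reflexive (solveℚ 3 (λ a f w → a ∙ (f ∙ w) ≔ f ∙ a ∙ w) ≡.refl (total X) four (b n ℚ.* rec n))))))
    (⊛-compare n x B (B n) (dilateℚ ½ (weight X)) (λ i → ♮ i ℚ.* (1ℚ ℚ.+ ♮ i) ℚ.* (b n ℚ.* rec n)) (bound X) (B-close n))
    where
    open +-*-Solver using () renaming (solve to solveℚ; _:*_ to _∙_; _:=_ to _≔_)
    termwise : ∀ i → ½ ^ℚ i ℚ.* weight X i ℚ.* (♮ i ℚ.* (1ℚ ℚ.+ ♮ i) ℚ.* (b n ℚ.* rec n)) ℚ.≤ weight X i ℚ.* (four ℚ.* (b n ℚ.* rec n))
    termwise i = ℚ.≤-trans (ℚ.≤-reflexive (solveℚ 4 (λ h m c w → h ∙ m ∙ (c ∙ w) ≔ m ∙ (c ∙ h ∙ w)) ≡.refl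
        (½ ^ℚ i) (weight X i) (♮ i ℚ.* (1ℚ ℚ.+ ♮ i)) (b n ℚ.* rec n)))
      (*-monoˡ-≤ (0≤weight X i) (*-monoʳ-≤ (*-nonNeg (0≤b n) (0≤rec n)) (n[n+1]½^n≤4 i)))

-- Parity of indices and the scales of the error terms.

⌊double/2⌋ : ∀ k → ⌊ double k /2⌋ ≡ k
⌊double/2⌋ zero    = ≡.refl
⌊double/2⌋ (suc k) = ≡.cong suc (⌊double/2⌋ k)

⌊suc-double/2⌋ : ∀ k → ⌊ suc (double k) /2⌋ ≡ k
⌊suc-double/2⌋ zero    = ≡.refl
⌊suc-double/2⌋ (suc k) = ≡.cong suc (⌊suc-double/2⌋ k)

parity : ∀ n → n ≡ double ⌊ n /2⌋ ⊎ n ≡ suc (double ⌊ n /2⌋)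
parity 0             = inj₁ ≡.refl
parity 1             = inj₂ ≡.refl
parity (suc (suc n)) with parity n
... | inj₁ eq = inj₁ (≡.cong (suc ∘ suc) eq)
... | inj₂ eq = inj₂ (≡.cong (suc ∘ suc) eq)

-- `b k` is the size of the main term and `rec k` = 1/(k+1) the relative error. `ω` is the same
-- scale in terms of the path size n, with k = ⌊n/2⌋.
ν ω : ℕ → ℚ
ν k = b k ℚ.* rec k
ω n = ν ⌊ n /2⌋

0≤ν : ∀ k → 0ℚ ℚ.≤ ν k
0≤ν k = *-nonNeg (0≤b k) (0≤rec k)

ν-anti : ∀ k → ν (suc k) ℚ.≤ ν k
ν-anti k = *-mono-≤ (0≤b (suc k)) (0≤rec (suc k)) (b-anti k) (rec-anti (ℕ.n≤1+n k))

rec≤2rec : ∀ k → rec k ℚ.≤ two ℚ.* rec (suc k)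
rec≤2rec k = *-cancel-≤ (1ℚ ℚ.+ ♮ k) (0<1+ (0≤♮ k)) (≤-by (♮ k ℚ.* s) (*-nonNeg (0≤♮ k) (0≤rec (suc k))) (begin
  (1ℚ ℚ.+ t) ℚ.* rec k ℚ.+ t ℚ.* s         ≡⟨ ≡.cong (ℚ._+ t ℚ.* s) (≡.trans (ℚ.*-comm (1ℚ ℚ.+ t) (rec k)) (≡.trans (rec-inverse k) (≡.sym (rec-inverse (suc k))))) ⟩
  s ℚ.* (1ℚ ℚ.+ ♮ (suc k)) ℚ.+ t ℚ.* s     ≡⟨ ≡.cong (λ u → s ℚ.* (1ℚ ℚ.+ u) ℚ.+ t ℚ.* s) (♮-suc k) ⟩
  s ℚ.* (1ℚ ℚ.+ (1ℚ ℚ.+ t)) ℚ.+ t ℚ.* s    ≡⟨ solve 2 (λ s t → s :* (con 1ℚ :+ (con 1ℚ :+ t)) :+ t :* s := (con 1ℚ :+ t) :* (con two :* s)) ≡.refl s t ⟩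
  (1ℚ ℚ.+ t) ℚ.* (two ℚ.* s)               ∎))
  where
  open ≡.≡-Reasoning
  open +-*-Solver
  t s : ℚ
  t = ♮ k
  s = rec (suc k)

ν≤4ν : ∀ k → ν k ℚ.≤ four ℚ.* ν (suc k)
ν≤4ν k = ℚ.≤-trans (*-mono-≤ (0≤b k) (0≤rec k) (b≤2b k) (rec≤2rec k))
  (ℚ.≤-reflexive (solve 2 (λ x y → con two :* x :* (con two :* y) := con four :* (x :* y)) ≡.refl (b (suc k)) (rec (suc k))))
  where open +-*-Solver

0≤ω : ∀ n → 0ℚ ℚ.≤ ω n
0≤ω n = 0≤ν ⌊ n /2⌋

⌊suc/2⌋ : ∀ n → ⌊ suc n /2⌋ ≡ ⌊ n /2⌋ ⊎ ⌊ suc n /2⌋ ≡ suc ⌊ n /2⌋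
⌊suc/2⌋ 0             = inj₁ ≡.refl
⌊suc/2⌋ 1             = inj₂ ≡.refl
⌊suc/2⌋ (suc (suc n)) with ⌊suc/2⌋ n
... | inj₁ eq = inj₁ (≡.cong suc eq)
... | inj₂ eq = inj₂ (≡.cong suc eq)

ω-anti : ∀ n → ω (suc n) ℚ.≤ ω n
ω-anti n with ⌊suc/2⌋ n
... | inj₁ eq = ℚ.≤-reflexive (≡.cong ν eq)
... | inj₂ eq = ≡.subst (λ k → ν k ℚ.≤ ω n) (≡.sym eq) (ν-anti ⌊ n /2⌋)

-- Neighbouring scales are comparable, so an estimate for a shifted sequence yields one for the
-- sequence itself, as in `Asy-unshift`.
ω≤4ω : ∀ n → ω n ℚ.≤ four ℚ.* ω (suc n)
ω≤4ω n with ⌊suc/2⌋ n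
... | inj₁ eq = ≡.subst (λ k → ω n ℚ.≤ four ℚ.* ν k) (≡.sym eq) (≤-by {ω n} {four ℚ.* ω n} ((two ℚ.+ 1ℚ) ℚ.* ω n)
      (*-nonNeg (ℚ.nonNegative⁻¹ (two ℚ.+ 1ℚ)) (0≤ω n)) (solve 1 (λ x → x :+ con (two ℚ.+ 1ℚ) :* x := con four :* x) ≡.refl (ω n)))
  where open +-*-Solver
... | inj₂ eq = ≡.subst (λ k → ω n ℚ.≤ four ℚ.* ν k) (≡.sym eq) (ν≤4ν ⌊ n /2⌋)

-- Calculus of error terms.

module BigO (N : NormedAlgebra) where
  open NormedAlgebra N
  open Estimates N using (⊑-neg; 0-⊑)

  -- The bound is demanded at every index and not only eventually. Exceptional initial indices are
  -- absorbed into the constant by `O-unshift`.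
  O : (ℕ → ℚ) → (ℕ → Carrier) → Set
  O w f = ∃[ C ] (0ℚ ℚ.≤ C × (∀ n → f n ⊑ C ℚ.* w n))

  module _ {w : ℕ → ℚ} where
    O-resp : ∀ {f g : ℕ → Carrier} → (∀ n → f n ≈ g n) → O w f → O w g
    O-resp p (C , 0≤C , h) = C , 0≤C , λ n → ⊑-resp (p n) (h n)

    O-+ : ∀ {f g : ℕ → Carrier} → O w f → O w g → O w (λ n → f n + g n)
    O-+ {f} {g} (C , 0≤C , h) (D , 0≤D , k) = C ℚ.+ D , 0≤-+ 0≤C 0≤D ,
      λ n → ≡.subst (f n + g n ⊑_) (≡.sym (ℚ.*-distribʳ-+ (w n) C D)) (⊑-+ (h n) (k n))

    O-neg : ∀ {f : ℕ → Carrier} → O w f → O w (λ n → - f n)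
    O-neg (C , 0≤C , h) = C , 0≤C , λ n → ⊑-neg (h n)

    O-minus : ∀ {f g : ℕ → Carrier} → O w f → O w g → O w (λ n → f n - g n)
    O-minus p q = O-+ p (O-neg q)

    O-*ˡ : ∀ {u f : ℕ → Carrier} M → 0ℚ ℚ.≤ M → (∀ n → u n ⊑ M) → O w f → O w (λ n → u n * f n)
    O-*ˡ {u} {f} M 0≤M p (C , 0≤C , h) = M ℚ.* C , *-nonNeg 0≤M 0≤C ,
      λ n → ≡.subst (u n * f n ⊑_) (≡.sym (ℚ.*-assoc M C (w n))) (⊑-* (p n) (h n))

    O-scale : ∀ c {f : ℕ → Carrier} → O w f → O w (λ n → c * f n)
    O-scale c = O-*ˡ {u = λ _ → c} (proj₁ (⊑-bounded c)) (proj₁ (proj₂ (⊑-bounded c))) (λ _ → proj₂ (proj₂ (⊑-bounded c)))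

    O-0 : (∀ n → 0ℚ ℚ.≤ w n) → ∀ {f : ℕ → Carrier} → (∀ n → f n ≈ 0#) → O w f
    O-0 0≤w p = 0ℚ , ℚ.≤-refl , λ n → ⊑-resp (sym (p n)) (0-⊑ (*-nonNeg ℚ.≤-refl (0≤w n)))

    O-weaken : ∀ {v : ℕ → ℚ} c {f : ℕ → Carrier} → 0ℚ ℚ.≤ c → (∀ n → w n ℚ.≤ c ℚ.* v n) → O w f → O v f
    O-weaken {v} c {f} 0≤c w≤cv (C , 0≤C , h) = C ℚ.* c , *-nonNeg 0≤C 0≤c , λ n →
      ⊑-mono (ℚ.≤-trans (*-monoˡ-≤ 0≤C (w≤cv n)) (ℚ.≤-reflexive (≡.sym (ℚ.*-assoc C c (v n))))) (h n)

    O-unshift : ∀ {f : ℕ → Carrier} → 1ℚ ℚ.≤ w 0 → (∀ n → 0ℚ ℚ.≤ w n) → O (w ∘ suc) (f ∘ suc) → O w f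
    O-unshift {f} 1≤w₀ 0≤w (C , 0≤C , h) = D ℚ.+ C , 0≤-+ 0≤D 0≤C , λ
      { zero → ⊑-mono (ℚ.≤-trans (≤-by {D} {D ℚ.+ C} C 0≤C ≡.refl)
          (ℚ.≤-trans (ℚ.≤-reflexive (≡.sym (ℚ.*-identityʳ _))) (*-monoˡ-≤ (0≤-+ 0≤D 0≤C) 1≤w₀))) (proj₂ (proj₂ (⊑-bounded (f 0))))
      ; (suc n) → ⊑-mono (*-monoʳ-≤ (0≤w (suc n)) (≤-by {C} {D ℚ.+ C} D 0≤D (ℚ.+-comm C D))) (h n) }
      where
      D : ℚ
      D = proj₁ (⊑-bounded (f 0))
      0≤D : 0ℚ ℚ.≤ D
      0≤D = proj₁ (proj₂ (⊑-bounded (f 0)))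

  O-unshift′ : ∀ {w : ℕ → ℚ} c → 0ℚ ℚ.≤ c → 1ℚ ℚ.≤ w 0 → (∀ n → 0ℚ ℚ.≤ w n) → (∀ n → w n ℚ.≤ c ℚ.* w (suc n)) →
               ∀ {f : ℕ → Carrier} → O w (f ∘ suc) → O w f
  O-unshift′ {w} c 0≤c 1≤w₀ 0≤w w≤ h = O-unshift 1≤w₀ 0≤w (O-weaken {v = w ∘ suc} c 0≤c w≤ h)

  O-shift : ∀ {w : ℕ → ℚ} → (∀ n → w (suc n) ℚ.≤ w n) → ∀ {f : ℕ → Carrier} → O w f → O w (f ∘ suc)
  O-shift w↘ (C , 0≤C , h) = C , 0≤C , λ n → ⊑-mono (*-monoˡ-≤ 0≤C (w↘ n)) (h (suc n))

  O-parity : ∀ {f : ℕ → Carrier} → O ν (f ∘ double) → O ν (f ∘ suc ∘ double) → O ω f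
  O-parity {f} (C , 0≤C , h) (D , 0≤D , k) = C ℚ.+ D , 0≤-+ 0≤C 0≤D , bound
    where
    bound : ∀ n → f n ⊑ (C ℚ.+ D) ℚ.* ω n
    bound n with parity n
    ... | inj₁ eq = ≡.subst (λ m → f m ⊑ (C ℚ.+ D) ℚ.* ω n) (≡.sym eq)
          (⊑-mono (*-monoʳ-≤ (0≤ω n) (≤-by {C} {C ℚ.+ D} D 0≤D ≡.refl)) (h ⌊ n /2⌋))
    ... | inj₂ eq = ≡.subst (λ m → f m ⊑ (C ℚ.+ D) ℚ.* ω n) (≡.sym eq)
          (⊑-mono (*-monoʳ-≤ (0≤ω n) (≤-by {D} {C ℚ.+ D} C 0≤C (ℚ.+-comm D C))) (k ⌊ n /2⌋))

-- Asymptotics of the numbers of restricted paths.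

module Asymptotics (N : NormedAlgebra) (β : NormedAlgebra.Carrier N)
  (β²+β≈1 : NormedAlgebra._≈_ N (NormedAlgebra._+_ N (NormedAlgebra._*_ N β β) β) (NormedAlgebra.1# N))
  (β⊑ : NormedAlgebra._⊑_ N β (ℤ.+ 5 ℚ./ 8)) where
  open NormedAlgebra N
  open PowerSeries algebra using (Series; _⊛_; ⊖_; _⊕_; constant; ⊛-comm; constant-⊛; seriesAlgebra)
  open SeriesCalculus algebra
  open GeneratingFunctions algebra
  open Golden β β²+β≈1
  open Estimates N
  open BigO N
  private module S = ℚ-Algebra seriesAlgebra
  open import Relation.Binary.Reasoning.Setoid setoid
  open Solver using (solve; _:+_; _:*_; _:-_; :-_; _:=_; con)
  open Fast using (total; 0≤total)

  -- Computes modulo β² + β = 1. The ring solver knows no relations between variables, so the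
  -- quotient `q` of a polynomial division by β² + β - 1 is supplied by hand and the remaining
  -- identity is polynomial.
  by-relation : ∀ {x y} q → x ≈ y + q * (β * β + β - ι 1ℚ) → x ≈ y
  by-relation {x} {y} q eq = trans eq (trans (+-congˡ (trans (*-congˡ (trans (+-congʳ (trans β²+β≈1 (sym ι-1))) (-‿inverseʳ _))) (zeroʳ q))) (+-identityʳ y))

  θ≈β² : θ ≈ β * β
  θ≈β² = trans (+-congʳ (sym ι-1)) (by-relation (ι (ℚ.- 1ℚ))
    (solve 1 (λ β → con 1ℚ :- β := β :* β :+ con (ℚ.- 1ℚ) :* (β :* β :+ β :- con 1ℚ)) refl β))

  θ⊑ : θ ⊑ 2/5
  θ⊑ = ⊑-resp (sym θ≈β²) (⊑-mono (≤-by {q ℚ.* q} {2/5} (2/5 ℚ.- q ℚ.* q) (ℚ.nonNegative⁻¹ _) ≡.refl) (⊑-* β⊑ β⊑))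
    where
    q : ℚ
    q = ℤ.+ 5 ℚ./ 8

  θ²⊑ : θ * θ ⊑ 2/5
  θ²⊑ = ⊑-mono (≤-by {2/5 ℚ.* 2/5} {2/5} (2/5 ℚ.- 2/5 ℚ.* 2/5) (ℚ.nonNegative⁻¹ _) ≡.refl) (⊑-* θ⊑ θ⊑)

  B⊑1 : ∀ i → B i ⊑ 1ℚ
  B⊑1 i = ⊑-mono (b≤1 i) (ι-⊑⁺ (0≤b i))

  stretch₃-⊑1 : ∀ x → (∀ i → x i ⊑ 1ℚ) → ∀ i → stretch₃ x i ⊑ 1ℚ
  stretch₃-⊑1 x p 0                   = p 0
  stretch₃-⊑1 x p 1                   = 0-⊑ (ℚ.nonNegative⁻¹ 1ℚ)
  stretch₃-⊑1 x p 2                   = 0-⊑ (ℚ.nonNegative⁻¹ 1ℚ)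
  stretch₃-⊑1 x p (suc (suc (suc n))) = stretch₃-⊑1 (x ∘ suc) (p ∘ suc) n

  1-Z⊑1 : ∀ i → (S.ι 1ℚ S.- Z) i ⊑ 1ℚ
  1-Z⊑1 0             = ⊑-+ (ι-⊑⁺ (ℚ.nonNegative⁻¹ 1ℚ)) (⊑-neg (0-⊑ ℚ.≤-refl))
  1-Z⊑1 1             = ⊑-+ (0-⊑ ℚ.≤-refl) (⊑-neg 1-⊑)
  1-Z⊑1 (suc (suc i)) = ⊑-+ (0-⊑ ℚ.≤-refl) (⊑-neg (0-⊑ (ℚ.nonNegative⁻¹ 1ℚ)))

  -- Every factor is the dilation by θ or θ², both at most 2/5, of a series whose coefficients are
  -- bounded by 1.
  fast-g : Fast g
  fast-g = fast-resp
    (S.sym (S.trans (dilate-* θ (dilate θ B) H) (S.*-cong (dilate-dilate θ θ B)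
      (S.trans (dilate-* θ ((S.ι 1ℚ S.- Z) ⊛ B) (stretch₃ B)) (S.*-congʳ {dilate θ (stretch₃ B)} (dilate-* θ (S.ι 1ℚ S.- Z) B))))))
    (fast-* (fast-dilate θ²⊑ B⊑1) (fast-* (fast-* (fast-dilate θ⊑ 1-Z⊑1) (fast-dilate θ⊑ B⊑1)) (fast-dilate θ⊑ (stretch₃-⊑1 B B⊑1))))

  fast-neg : ∀ {x} → Fast x → Fast (⊖ x)
  fast-neg X = record
    { weight = Fast.weight X ; total = total X ; 0≤weight = Fast.0≤weight X
    ; bound = λ i → ⊑-neg (Fast.bound X i) ; Σ≤total = Fast.Σ≤total X }

  fast-κ : Fast κ
  fast-κ = fast-* (fast-+ (fast-constant _) (fast-neg (fast-* (fast-constant _) fast-Z)))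
    (fast-+ (fast-+ (fast-constant _) θZ) (fast-* θZ θZ))
    where
    θZ : Fast (constant θ ⊛ Z)
    θZ = fast-* (fast-constant θ) fast-Z

  G : ℕ → Carrier
  G = S g

  G⊑ : ∀ n → G n ⊑ total fast-g
  G⊑ = fast-S fast-g

  -- κ(1) = 1 / g(1)².
  K : Carrier
  K = (1# - θ * θ) * (1# + θ + θ * θ)

  S-1 : ∀ n → S (S.ι 1ℚ) n ≈ 1#
  S-1 zero    = ι-1
  S-1 (suc n) = trans (+-cong ι-1 (zeros n)) (+-identityʳ 1#)
    where
    zeros : ∀ n → S (λ _ → 0#) n ≈ 0#
    zeros zero    = refl
    zeros (suc n) = trans (+-identityˡ _) (zeros n)

  -- The polynomial `κ` has degree 3, so its partial sums are constant from index 3 on. They are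
  -- computed as coefficients of κ/(1 - z), with `ones` in the role of 1/(1 - z).
  S-κ : ∀ n → S κ (3 ℕ.+ n) ≈ K
  S-κ n = begin
    S κ (3 ℕ.+ n)
      ≈⟨ S-cong (λ i → trans (sym (S.*-identityʳ κ i)) (S.*-congˡ {κ} (S.sym S.ι-1) i)) (3 ℕ.+ n) ⟩
    S (κ ⊛ S.ι 1ℚ) (3 ℕ.+ n)
      ≈⟨ S-⊛ κ (S.ι 1ℚ) (3 ℕ.+ n) ⟩
    (κ ⊛ ones) (3 ℕ.+ n)
      ≈⟨ S.Solver.solve 3 (λ u w y → (con′ 1ℚ ∸ u) ∙ (con′ 1ℚ ∔ w ∔ w ∙ w) ∙ y ≔ (y ∔ w ∙ y ∔ w ∙ (w ∙ y)) ∸ u ∙ (y ∔ w ∙ y ∔ w ∙ (w ∙ y)))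
           S.refl (constant (θ * θ) ⊛ Z) (constant θ ⊛ Z) ones (3 ℕ.+ n) ⟩
    v (3 ℕ.+ n) - (constant (θ * θ) ⊛ Z ⊛ v) (3 ℕ.+ n)
      ≈⟨ +-cong (v≈ (suc n)) (-‿cong (trans (cZ⊛ (θ * θ) v (2 ℕ.+ n)) (*-congˡ (v≈ n)))) ⟩
    1# + θ * 1# + θ * (θ * 1#) - θ * θ * (1# + θ * 1# + θ * (θ * 1#))
      ≈⟨ +-cong one (-‿cong (*-congˡ one)) ⟩
    (1# + θ + θ * θ) - θ * θ * (1# + θ + θ * θ)
      ≈⟨ +-congʳ (*-identityˡ _) ⟨
    1# * (1# + θ + θ * θ) - θ * θ * (1# + θ + θ * θ)
      ≈⟨ solve 3 (λ o t x → o :* x :- t :* x := (o :- t) :* x) refl 1# (θ * θ) (1# + θ + θ * θ) ⟩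
    K ∎
    where
    open S.Solver using () renaming (con to con′; _:*_ to _∙_; _:+_ to _∔_; _:-_ to _∸_; _:=_ to _≔_)
    ones v : Series
    ones = S (S.ι 1ℚ)
    v = ones ⊕ constant θ ⊛ Z ⊛ ones ⊕ constant θ ⊛ Z ⊛ (constant θ ⊛ Z ⊛ ones)
    cZ⊛ : ∀ c y n → (constant c ⊛ Z ⊛ y) (suc n) ≈ c * y n
    cZ⊛ c y n = trans (S.*-assoc (constant c) Z y (suc n)) (trans (constant-⊛ c (Z ⊛ y) (suc n)) (*-congˡ (Z*-suc y n)))
    v≈ : ∀ n → v (2 ℕ.+ n) ≈ 1# + θ * 1# + θ * (θ * 1#)
    v≈ n = +-cong (+-cong (S-1 (2 ℕ.+ n)) (trans (cZ⊛ θ ones (suc n)) (*-congˡ (S-1 (suc n)))))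
      (trans (cZ⊛ θ (constant θ ⊛ Z ⊛ ones) (suc n)) (*-congˡ (trans (cZ⊛ θ ones n) (*-congˡ (S-1 n)))))
    one : 1# + θ * 1# + θ * (θ * 1#) ≈ 1# + θ + θ * θ
    one = +-cong (+-congˡ (*-identityʳ θ)) (*-congˡ (*-identityʳ θ))

  rec-↘ : ∀ n → rec (suc n) ℚ.≤ rec n
  rec-↘ n = rec-anti (ℕ.n≤1+n n)

  -- Obtained from g² κ = 1 by taking partial sums and splitting them twice with `S-product`. The
  -- indices 0, 1, 2, where `S κ` may differ from `K`, are recovered by `unshift`.
  G²K : O rec (λ n → G n * G n * K - 1#)
  G²K = unshift (unshift (unshift (O-resp (λ n → +-congʳ (*-congˡ (S-κ n))) (O-shift rec-↘ (O-shift rec-↘ (O-shift rec-↘ estimate))))))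
    where
    unshift : ∀ {f : ℕ → Carrier} → O rec (f ∘ suc) → O rec f
    unshift = O-unshift′ two (ℚ.nonNegative⁻¹ two) (ℚ.≤-reflexive (≡.sym rec-0)) 0≤rec rec≤2rec
    estimate : O rec (λ n → G n * G n * S κ n - 1#)
    estimate = O-resp (λ n → identity n)
      (O-neg (O-+ (O-*ˡ {u = S κ} (total fast-κ) (0≤total fast-κ) (fast-S fast-κ)
          (total fast-g ℚ.* total fast-g , *-nonNeg (0≤total fast-g) (0≤total fast-g) , S-product fast-g fast-g))
        (total (fast-* fast-g fast-g) ℚ.* total fast-κ , *-nonNeg (0≤total (fast-* fast-g fast-g)) (0≤total fast-κ) , S-product (fast-* fast-g fast-g) fast-κ)))
      where
      identity : ∀ n → - (S κ n * (S (g ⊛ g) n - G n * G n) + (S (g ⊛ g ⊛ κ) n - S (g ⊛ g) n * S κ n)) ≈ G n * G n * S κ n - 1#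
      identity n = trans (solve 4 (λ k s x y → :- (k :* (s :- x :* x) :+ (y :- s :* k)) := x :* x :* k :- y) refl (S κ n) (S (g ⊛ g) n) (G n) (S (g ⊛ g ⊛ κ) n))
        (+-congˡ (-‿cong (trans (S-cong g²κ n) (S-1 n))))

  -- The main term b k g(1), with a partial sum in place of g(1), so that no limit has to exist in
  -- the ring.
  r ref : ℕ → Carrier
  r k = B k * G k
  ref n = r ⌊ n /2⌋

  u : ℕ → Carrier
  u k = θ ^ k * α k

  u-close : O ν (λ k → u k - r k)
  u-close = four ℚ.* total fast-g , *-nonNeg (ℚ.nonNegative⁻¹ four) (0≤total fast-g) , λ k →
    ⊑-resp (+-cong (sym (trans (dilate-θ-α k) (⊛-comm B g k))) (-‿cong (*-comm (G k) (B k)))) (⊛B-close fast-g k)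

  r-suc : O ν (λ k → r (suc k) - r k)
  r-suc = O-resp (λ k → solve 4 (λ b₁ b g₁ g → b₁ :* (g₁ :- g) :- g :* (b :- b₁) := b₁ :* g₁ :- b :* g) refl (B (suc k)) (B k) (G (suc k)) (G k))
    (O-minus {ν} (total fast-g , 0≤total fast-g , λ k → ⊑-mono (first k) (⊑-* (B⊑ k) (fast-tail-⊑ fast-g 1 k)))
      (O-*ˡ {u = G} (total fast-g) (0≤total fast-g) G⊑ (two , ℚ.nonNegative⁻¹ two , λ k → ⊑-mono (second k) (B-close (suc k) 1 (ℕ.s≤s ℕ.z≤n)))))
    where
    open +-*-Solver using () renaming (solve to solveℚ; _:*_ to _∙_; _:=_ to _≔_)
    open ℚ-Series using () renaming (_^_ to _^ℚ_)
    B⊑ : ∀ k → B (suc k) ⊑ b k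
    B⊑ k = ⊑-mono (b-anti k) (ι-⊑⁺ (0≤b (suc k)))
    first : ∀ k → b k ℚ.* (½ ^ℚ k ℚ.* total fast-g) ℚ.≤ total fast-g ℚ.* ν k
    first k = ℚ.≤-trans (*-monoˡ-≤ (0≤b k) (*-monoʳ-≤ (0≤total fast-g) (½^≤rec k)))
      (ℚ.≤-reflexive (solveℚ 3 (λ x y z → x ∙ (y ∙ z) ≔ z ∙ (x ∙ y)) ≡.refl (b k) (rec k) (total fast-g)))
    second : ∀ k → ♮ 1 ℚ.* (1ℚ ℚ.+ ♮ 1) ℚ.* ν (suc k) ℚ.≤ two ℚ.* ν k
    second k = ℚ.≤-trans (ℚ.≤-reflexive (≡.cong (λ t → t ℚ.* (1ℚ ℚ.+ t) ℚ.* ν (suc k)) (♮-/1 1)))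
      (*-monoˡ-≤ (ℚ.nonNegative⁻¹ two) (ν-anti k))

  u-shift : ∀ j → O ν (λ k → u (j ℕ.+ k) - r k)
  u-shift zero    = u-close
  u-shift (suc j) = O-resp (λ k → trans (+-congʳ (+-congʳ (reflexive (≡.cong u (ℕ.+-suc j k)))))
      (solve 3 (λ a b c → a :- b :+ (b :- c) := a :- c) refl (u (suc (j ℕ.+ k))) (r (suc k)) (r k)))
    (O-+ (O-shift ν-anti (u-shift j)) r-suc)

  φ : Carrier
  φ = ι 1ℚ + β

  φβ≈1 : φ * β ≈ 1#
  φβ≈1 = trans (by-relation (ι 1ℚ) (solve 1 (λ β → (con 1ℚ :+ β) :* β := con 1ℚ :+ con 1ℚ :* (β :* β :+ β :- con 1ℚ)) refl β)) ι-1

  β^double : ∀ k → β ^ double k ≈ θ ^ k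
  β^double zero    = refl
  β^double (suc k) = trans (sym (*-assoc β β _)) (*-cong (sym θ≈β²) (β^double k))

  three : ℚ
  three = two ℚ.+ 1ℚ

  θ^α : ∀ j k → θ ^ k * α (j ℕ.+ k) ≈ ψ ^ j * u (j ℕ.+ k)
  θ^α zero    k = sym (*-identityˡ _)
  θ^α (suc j) k = begin
    θ ^ k * α (suc j ℕ.+ k)             ≈⟨ *-congˡ (reflexive (≡.cong α (≡.sym (ℕ.+-suc j k)))) ⟩
    θ ^ k * α (j ℕ.+ suc k)             ≈⟨ *-identityˡ _ ⟨
    1# * (θ ^ k * α (j ℕ.+ suc k))      ≈⟨ *-congʳ ψθ≈1 ⟨
    ψ * θ * (θ ^ k * α (j ℕ.+ suc k))   ≈⟨ solve 4 (λ p t x y → p :* t :* (x :* y) := p :* (t :* x :* y)) refl ψ θ (θ ^ k) (α (j ℕ.+ suc k)) ⟩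
    ψ * (θ ^ suc k * α (j ℕ.+ suc k))   ≈⟨ *-congˡ (θ^α j (suc k)) ⟩
    ψ * (ψ ^ j * u (j ℕ.+ suc k))       ≈⟨ *-assoc ψ (ψ ^ j) _ ⟨
    ψ ^ suc j * u (j ℕ.+ suc k)         ≈⟨ *-congˡ (reflexive (≡.cong u (ℕ.+-suc j k))) ⟩
    ψ ^ suc j * u (suc j ℕ.+ k)         ∎

  -- f n = φⁿ (l + O(1/n)) b ⌊n/2⌋ g(1).
  Asy : (ℕ → Carrier) → Carrier → Set
  Asy f l = O ω (λ n → f n * β ^ n - l * ref n)

  -- φ³ = (ψ³ - 1) / 4 = β (ψ³ + ψ² + ψ) / 4.
  Asy-U₀-shifted : Asy (λ n → U 0 (3 ℕ.+ n)) (ι two * (φ * φ * φ))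
  Asy-U₀-shifted = O-resp (λ n → trans (sym (*-assoc _ _ _)) (trans (*-congʳ (trans (sym (ι-* ½ two)) ι-1)) (*-identityˡ _)))
    (O-scale (ι ½) (O-parity
      (O-resp even (O-minus (O-scale ψ³ (u-shift 3)) (u-shift 0)))
      (O-resp odd (O-scale β (O-+ (O-+ (O-scale ψ³ (u-shift 3)) (O-scale ψ² (u-shift 2))) (O-scale ψ (u-shift 1)))))))
    where
    ψ² ψ³ : Carrier
    ψ² = ψ * ψ
    ψ³ = ψ * (ψ * ψ)
    θ^α₁ : ∀ k → θ ^ k * α (1 ℕ.+ k) ≈ ψ * u (1 ℕ.+ k)
    θ^α₁ k = trans (θ^α 1 k) (*-congʳ (*-identityʳ ψ))
    θ^α₂ : ∀ k → θ ^ k * α (2 ℕ.+ k) ≈ ψ² * u (2 ℕ.+ k)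
    θ^α₂ k = trans (θ^α 2 k) (*-congʳ (*-congˡ (*-identityʳ ψ)))
    θ^α₃ : ∀ k → θ ^ k * α (3 ℕ.+ k) ≈ ψ³ * u (3 ℕ.+ k)
    θ^α₃ k = trans (θ^α 3 k) (*-congʳ (*-congˡ (*-congˡ (*-identityʳ ψ))))
    even : ∀ k → ψ³ * (u (3 ℕ.+ k) - r k) - (u k - r k)
                 ≈ ι two * (U 0 (3 ℕ.+ double k) * β ^ double k - ι two * (φ * φ * φ) * ref (double k))
    even k = begin
      ψ³ * (u (3 ℕ.+ k) - r k) - (u k - r k)
        ≈⟨ by-relation ((ι three * β + ι three) * r k) (solve 4 (λ β x y r →
             let φ = con 1ℚ :+ β; ψ = con two :+ β; ψ³ = ψ :* (ψ :* ψ)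
             in ψ³ :* (x :- r) :- (y :- r)
                := (ψ³ :* x :- y) :- con two :* (con two :* (φ :* φ :* φ)) :* r :+ (con three :* β :+ con three) :* r :* (β :* β :+ β :- con 1ℚ))
             refl β (u (3 ℕ.+ k)) (u k) (r k)) ⟩
      (ψ³ * u (3 ℕ.+ k) - u k) - ι two * (ι two * (φ * φ * φ)) * r k
        ≈⟨ +-cong (+-congʳ (sym (θ^α₃ k))) (-‿cong (*-congˡ (reflexive (≡.cong r (≡.sym (⌊double/2⌋ k)))))) ⟩
      (θ ^ k * α (3 ℕ.+ k) - θ ^ k * α k) - ι two * (ι two * (φ * φ * φ)) * ref (double k)
        ≈⟨ +-congʳ (trans (solve 3 (λ t x y → t :* x :- t :* y := t :* (x :- y)) refl (θ ^ k) (α (3 ℕ.+ k)) (α k))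
             (*-cong (sym (β^double k)) (sym (U₀-odd k)))) ⟩
      β ^ double k * (ι two * U 0 (3 ℕ.+ double k)) - ι two * (ι two * (φ * φ * φ)) * ref (double k)
        ≈⟨ solve 4 (λ p x c r → p :* (con two :* x) :- con two :* c :* r := con two :* (x :* p :- c :* r)) refl
             (β ^ double k) (U 0 (3 ℕ.+ double k)) (ι two * (φ * φ * φ)) (ref (double k)) ⟩
      ι two * (U 0 (3 ℕ.+ double k) * β ^ double k - ι two * (φ * φ * φ) * ref (double k)) ∎
    odd : ∀ k → β * (ψ³ * (u (3 ℕ.+ k) - r k) + ψ² * (u (2 ℕ.+ k) - r k) + ψ * (u (1 ℕ.+ k) - r k))
                ≈ ι two * (U 0 (4 ℕ.+ double k) * β ^ suc (double k) - ι two * (φ * φ * φ) * ref (suc (double k)))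
    odd k = begin
      β * (ψ³ * (u (3 ℕ.+ k) - r k) + ψ² * (u (2 ℕ.+ k) - r k) + ψ * (u (1 ℕ.+ k) - r k))
        ≈⟨ by-relation (- (ι four + ι two * β + β * β) * r k) (solve 5 (λ β x y z r →
             let φ = con 1ℚ :+ β; ψ = con two :+ β; ψ² = ψ :* ψ; ψ³ = ψ :* (ψ :* ψ)
             in β :* (ψ³ :* (x :- r) :+ ψ² :* (y :- r) :+ ψ :* (z :- r))
                := β :* (ψ³ :* x :+ ψ² :* y :+ ψ :* z) :- con two :* (con two :* (φ :* φ :* φ)) :* r :+ (:- (con four :+ con two :* β :+ β :* β)) :* r :* (β :* β :+ β :- con 1ℚ))
             refl β (u (3 ℕ.+ k)) (u (2 ℕ.+ k)) (u (1 ℕ.+ k)) (r k)) ⟩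
      β * (ψ³ * u (3 ℕ.+ k) + ψ² * u (2 ℕ.+ k) + ψ * u (1 ℕ.+ k)) - ι two * (ι two * (φ * φ * φ)) * r k
        ≈⟨ +-cong (*-congˡ (+-cong (+-cong (sym (θ^α₃ k)) (sym (θ^α₂ k))) (sym (θ^α₁ k)))) (-‿cong (*-congˡ (reflexive (≡.cong r (≡.sym (⌊suc-double/2⌋ k)))))) ⟩
      β * (θ ^ k * α (3 ℕ.+ k) + θ ^ k * α (2 ℕ.+ k) + θ ^ k * α (1 ℕ.+ k)) - ι two * (ι two * (φ * φ * φ)) * ref (suc (double k))
        ≈⟨ +-congʳ (trans (solve 5 (λ b t x y z → b :* (t :* x :+ t :* y :+ t :* z) := b :* t :* (x :+ y :+ z)) refl β (θ ^ k) (α (3 ℕ.+ k)) (α (2 ℕ.+ k)) (α (1 ℕ.+ k)))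
             (*-cong (*-congˡ (sym (β^double k))) (sym (U₀-even k)))) ⟩
      β ^ suc (double k) * (ι two * U 0 (4 ℕ.+ double k)) - ι two * (ι two * (φ * φ * φ)) * ref (suc (double k))
        ≈⟨ solve 4 (λ p x c r → p :* (con two :* x) :- con two :* c :* r := con two :* (x :* p :- c :* r)) refl
             (β ^ suc (double k)) (U 0 (4 ℕ.+ double k)) (ι two * (φ * φ * φ)) (ref (suc (double k))) ⟩
      ι two * (U 0 (4 ℕ.+ double k) * β ^ suc (double k) - ι two * (φ * φ * φ) * ref (suc (double k))) ∎

  ref-suc : O ω (λ n → ref (suc n) - ref n)
  ref-suc = O-parity
    (O-0 0≤ν (λ k → trans (+-cong (reflexive (≡.cong r (⌊suc-double/2⌋ k))) (-‿cong (reflexive (≡.cong r (⌊double/2⌋ k))))) (-‿inverseʳ (r k))))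
    (O-resp (λ k → +-cong (reflexive (≡.cong (r ∘ suc) (≡.sym (⌊double/2⌋ k)))) (-‿cong (reflexive (≡.cong r (≡.sym (⌊suc-double/2⌋ k)))))) r-suc)

  Asy-resp : ∀ {f g l m} → (∀ n → f n ≈ g n) → l ≈ m → Asy f l → Asy g m
  Asy-resp p q = O-resp (λ n → +-cong (*-congʳ (p n)) (-‿cong (*-congʳ q)))

  Asy-+ : ∀ {f g l m} → Asy f l → Asy g m → Asy (λ n → f n + g n) (l + m)
  Asy-+ {f} {g} {l} {m} p q = O-resp (λ n → solve 6 (λ f g l m b r → f :* b :- l :* r :+ (g :* b :- m :* r) := (f :+ g) :* b :- (l :+ m) :* r)
    refl (f n) (g n) l m (β ^ n) (ref n)) (O-+ p q)

  Asy-minus : ∀ {f g l m} → Asy f l → Asy g m → Asy (λ n → f n - g n) (l - m)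
  Asy-minus {f} {g} {l} {m} p q = O-resp (λ n → solve 6 (λ f g l m b r → f :* b :- l :* r :- (g :* b :- m :* r) := (f :- g) :* b :- (l :- m) :* r)
    refl (f n) (g n) l m (β ^ n) (ref n)) (O-minus p q)

  Asy-0 : ∀ {f l} → (∀ n → f n ≈ 0#) → l ≈ 0# → Asy f l
  Asy-0 p q = O-0 0≤ω (λ n → trans (+-cong (trans (*-congʳ (p n)) (zeroˡ _)) (-‿cong (trans (*-congʳ q) (zeroˡ _)))) (-‿inverseʳ 0#))

  -- The normalisation by βⁿ turns a shift into the factor φ = 1/β; the main term moves only by an
  -- error, by `ref-suc`.
  Asy-shift : ∀ {f l} → Asy f l → Asy (f ∘ suc) (l * φ)
  Asy-shift {f} {l} p = O-resp
    (λ n → trans (solve 7 (λ x β b l φ r₁ r → φ :* (x :* (β :* b) :- l :* r₁) :+ l :* φ :* (r₁ :- r) := x :* (φ :* β :* b) :- l :* φ :* r)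
        refl (f (suc n)) β (β ^ n) l φ (ref (suc n)) (ref n))
      (+-congʳ (*-congˡ (trans (*-congʳ φβ≈1) (*-identityˡ _)))))
    (O-+ (O-scale φ (O-shift ω-anti p)) (O-scale (l * φ) ref-suc))

  1≤ω₀ : 1ℚ ℚ.≤ ω 0
  1≤ω₀ = ℚ.≤-reflexive (≡.sym (≡.cong₂ ℚ._*_ b-0 rec-0))

  Asy-unshift : ∀ {f l} → Asy (f ∘ suc) l → Asy f (l * β)
  Asy-unshift {f} {l} p = O-unshift′ four (ℚ.nonNegative⁻¹ four) 1≤ω₀ 0≤ω ω≤4ω (O-resp
    (λ n → solve 6 (λ x β b l r₁ r → β :* (x :* b :- l :* r) :- l :* β :* (r₁ :- r) := x :* (β :* b) :- l :* β :* r₁)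
        refl (f (suc n)) β (β ^ n) l (ref (suc n)) (ref n))
    (O-minus (O-scale β p) (O-scale (l * β) ref-suc)))

  φφφβββ : ∀ c → c * (φ * φ * φ) * β * β * β ≈ c
  φφφβββ c = begin
    c * (φ * φ * φ) * β * β * β             ≈⟨ solve 3 (λ c f b → c :* (f :* f :* f) :* b :* b :* b := c :* ((f :* b) :* (f :* b) :* (f :* b))) refl c φ β ⟩
    c * (φ * β * (φ * β) * (φ * β))         ≈⟨ *-congˡ (trans (*-cong (trans (*-cong φβ≈1 φβ≈1) (*-identityˡ 1#)) φβ≈1) (*-identityˡ 1#)) ⟩
    c * 1#                                  ≈⟨ *-identityʳ c ⟩
    c                                       ∎

  W-recurrence : ∀ h n → W (suc h) (4 ℕ.+ n) ≈ W (suc h) (2 ℕ.+ n) + W (suc h) n + (W (2 ℕ.+ h) (1 ℕ.+ n) + W h (1 ℕ.+ n))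
  W-recurrence h n = trans (S.trans (W-step h) (S.Solver.solve 3 (λ z x y →
      con′ 1ℚ ∔ z ∔ z ∙ z ∔ (z ∙ z ∔ z ∙ z ∙ (z ∙ z)) ∙ x ∔ z ∙ (z ∙ z) ∙ y
      ≔ con′ 1ℚ ∔ (z ∔ z ∙ z) ∔ (z ∙ (z ∙ x) ∔ z ∙ (z ∙ (z ∙ (z ∙ x)))) ∔ z ∙ (z ∙ (z ∙ y))) S.refl Z x y) (4 ℕ.+ n))
    (+-cong (trans (+-cong (trans (+-cong refl (trans (+-cong refl (Z*-suc Z (3 ℕ.+ n))) (+-identityˡ _))) (+-identityˡ _))
        (+-cong (Z²-suc x (2 ℕ.+ n)) (trans (Z²-suc (Z ⊛ (Z ⊛ x)) (2 ℕ.+ n)) (Z²-suc x n)))) (+-identityˡ _))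
      (trans (Z²-suc (Z ⊛ y) (2 ℕ.+ n)) (Z*-suc y (1 ℕ.+ n))))
    where
    open S.Solver using () renaming (con to con′; _:*_ to _∙_; _:+_ to _∔_; _:=_ to _≔_)
    x y : Series
    x = W (suc h)
    y = W (2 ℕ.+ h) ⊕ W h
    Z²-suc : ∀ x n → (Z ⊛ (Z ⊛ x)) (2 ℕ.+ n) ≈ x n
    Z²-suc x n = trans (Z*-suc (Z ⊛ x) (suc n)) (Z*-suc x n)

  ι2* : ℕ → Carrier
  ι2* h = ι two * ι (♮ h)

  ι2*-suc : ∀ h → ι2* (suc h) ≈ ι two * (ι 1ℚ + ι (♮ h))
  ι2*-suc h = *-congˡ (trans (ι♮-suc h) (+-congʳ (sym ι-1)))

  -- The recurrence is solved for `W (2 ℕ.+ h)`. Because φ⁴ - φ² - 1 = 2φ, the leading constants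
  -- satisfy l (h+2) = 2 l (h+1) - l h, and hence grow linearly in `h`.
  Asy-W-step : ∀ h → Asy (W h) (ι2* h) → Asy (W (suc h)) (ι2* (suc h)) → Asy (W (2 ℕ.+ h)) (ι2* (2 ℕ.+ h))
  Asy-W-step h q p = Asy-resp {f = W (2 ℕ.+ h)} (λ _ → refl) scale≈
    (Asy-unshift {f = W (2 ℕ.+ h)} (Asy-resp coefficients≈ refl
      (Asy-minus (Asy-minus (Asy-minus (Asy-shift (Asy-shift (Asy-shift (Asy-shift p)))) (Asy-shift (Asy-shift p))) p) (Asy-shift q))))
    where
    coefficients≈ : ∀ n → W (suc h) (4 ℕ.+ n) - W (suc h) (2 ℕ.+ n) - W (suc h) n - W h (1 ℕ.+ n) ≈ W (2 ℕ.+ h) (1 ℕ.+ n)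
    coefficients≈ n = trans (+-congʳ (+-congʳ (+-congʳ (W-recurrence h n))))
      (solve 4 (λ a b c d → a :+ b :+ (c :+ d) :- a :- b :- d := c) refl (W (suc h) (2 ℕ.+ n)) (W (suc h) n) (W (2 ℕ.+ h) (1 ℕ.+ n)) (W h (1 ℕ.+ n)))
    s : Carrier
    s = ι (♮ h)
    scale≈ : (ι2* (suc h) * φ * φ * φ * φ - ι2* (suc h) * φ * φ - ι2* (suc h) - ι2* h * φ) * β ≈ ι2* (2 ℕ.+ h)
    scale≈ = begin
      (ι2* (suc h) * φ * φ * φ * φ - ι2* (suc h) * φ * φ - ι2* (suc h) - ι2* h * φ) * β
        ≈⟨ *-congʳ (+-congʳ (trans (solve 2 (λ l φ → l :* φ :* φ :* φ :* φ :- l :* φ :* φ :- l := l :* (φ :* φ :* φ :* φ :- φ :* φ :- con 1ℚ)) refl (ι2* (suc h)) φ)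
             (*-congʳ (ι2*-suc h)))) ⟩
      (ι two * (ι 1ℚ + s) * (φ * φ * φ * φ - φ * φ - ι 1ℚ) - ι two * s * φ) * β
        ≈⟨ by-relation (ι two * (ι 1ℚ + s) * (β * β * β + ι three * (β * β) + ι three * β + ι two) - ι two * s) (solve 2 (λ β s → let φ = con 1ℚ :+ β in
             (con two :* (con 1ℚ :+ s) :* (φ :* φ :* φ :* φ :- φ :* φ :- con 1ℚ) :- con two :* s :* φ) :* β
             := con two :* (con 1ℚ :+ (con 1ℚ :+ s)) :+ (con two :* (con 1ℚ :+ s) :* (β :* β :* β :+ con three :* (β :* β) :+ con three :* β :+ con two) :- con two :* s) :* (β :* β :+ β :- con 1ℚ)) refl β s) ⟩
      ι two * (ι 1ℚ + (ι 1ℚ + s))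
        ≈⟨ trans (ι2*-suc (suc h)) (*-congˡ (+-congˡ (trans (ι♮-suc h) (+-congʳ (sym ι-1))))) ⟨
      ι2* (2 ℕ.+ h) ∎

  Asy-W : ∀ h → Asy (W h) (ι2* h)
  Asy-W 0 = Asy-0 (λ _ → refl) (trans (*-congˡ ι♮-0) (zeroʳ _))
  Asy-W 1 = Asy-resp (λ _ → refl) (trans (φφφβββ (ι two)) (trans (sym (*-identityʳ _)) (*-congˡ (sym (trans (ι-cong (♮-/1 1)) ι-1)))))
    (Asy-unshift (Asy-unshift (Asy-unshift Asy-U₀-shifted)))
  Asy-W (suc (suc h)) = Asy-W-step h (Asy-W h) (Asy-W (suc h))

  -- The numbers of paths that stay above -m are asymptotically proportional to ρ m.
  ρ : ℕ → Carrier
  ρ zero    = ι 1ℚ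
  ρ (suc h) = ι two * ι (♮ h) + ι three - β

  V : ℕ → ℕ → Carrier
  V m n = ι (♮ (up m n ℕ.+ down m n))

  Asy-D : ∀ h → Asy (D (suc h)) (ι two * (ι (♮ h) + ι 1ℚ - β))
  Asy-D h = Asy-resp {f = D (suc h)} (λ _ → refl) scale≈
    (Asy-unshift {f = D (suc h)} (Asy-unshift (Asy-resp coefficients≈ refl (Asy-+ (Asy-shift (Asy-W h)) (Asy-W (suc h))))))
    where
    coefficients≈ : ∀ n → W h (suc n) + W (suc h) n ≈ D (suc h) (2 ℕ.+ n)
    coefficients≈ n = sym (trans (D-W h (2 ℕ.+ n)) (+-cong (trans (+-identityˡ _) (Z*-suc (W h) (suc n)))
      (trans (Z*-suc (Z ⊛ W (suc h)) (suc n)) (Z*-suc (W (suc h)) n))))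
    s : Carrier
    s = ι (♮ h)
    scale≈ : (ι2* h * φ + ι2* (suc h)) * β * β ≈ ι two * (s + ι 1ℚ - β)
    scale≈ = trans (*-congʳ (*-congʳ (+-congˡ (ι2*-suc h)))) (by-relation (ι two * s * β + ι two * s + ι two)
      (solve 2 (λ β s → (con two :* s :* (con 1ℚ :+ β) :+ con two :* (con 1ℚ :+ s)) :* β :* β
        := con two :* (s :+ con 1ℚ :- β) :+ (con two :* s :* β :+ con two :* s :+ con two) :* (β :* β :+ β :- con 1ℚ)) refl β s))

  Asy-V : ∀ m → Asy (V m) (ι two * ρ m)
  Asy-V zero = Asy-resp {f = λ n → W 1 n + D 0 n} (λ n → sym (ι♮-+ (up 0 n) (down 0 n)))
    (trans (+-identityʳ _) (*-congˡ (ι-cong (♮-/1 1))))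
    (Asy-+ (Asy-W 1) (Asy-resp {f = D 0} (λ _ → refl) (zeroˡ β) (Asy-unshift {f = D 0} (Asy-0 {l = 0#} (λ _ → ι♮-0) refl))))
  Asy-V (suc h) = Asy-resp {f = λ n → W (2 ℕ.+ h) n + D (suc h) n} (λ n → sym (ι♮-+ (up (suc h) n) (down (suc h) n)))
    (trans (+-congʳ (trans (ι2*-suc (suc h)) (*-congˡ (+-congˡ (trans (ι♮-suc h) (+-congʳ (sym ι-1)))))))
      (solve 2 (λ β s → con two :* (con 1ℚ :+ (con 1ℚ :+ s)) :+ con two :* (s :+ con 1ℚ :- β) := con two :* (con two :* s :+ con three :- β)) refl β (ι (♮ h))))
    (Asy-+ (Asy-W (2 ℕ.+ h)) (Asy-D h))

-- Compositions of n into parts 1 and 2, a Fibonacci number: with the first direction fixed, a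
-- zigzag path is given by the horizontal lengths of its steps.
compositions : ℕ → ℕ
compositions 0             = 1
compositions 1             = 1
compositions (suc (suc n)) = compositions (suc n) ℕ.+ compositions n

-- A linear lower bound is strong enough because the reciprocal only has to be O(1/n), namely in
-- `δit`.
n+1≤2compositions : ∀ n → suc n ℕ.≤ compositions n ℕ.+ compositions n
n+1≤2compositions 0             = ℕ.s≤s ℕ.z≤n
n+1≤2compositions 1             = ℕ.≤-refl
n+1≤2compositions (suc (suc n)) = ℕ.≤-trans
  (ℕ.≤-trans (ℕ.≤-reflexive (ℕ.+-comm 1 (suc (suc n)))) (ℕ.+-mono-≤ (n+1≤2compositions (suc n)) (ℕ.≤-trans (ℕ.s≤s ℕ.z≤n) (n+1≤2compositions n))))
  (ℕ.≤-reflexive (interchange (compositions (suc n)) (compositions (suc n)) (compositions n) (compositions n)))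
  where
  open import Algebra.Properties.CommutativeSemigroup ℕ.+-commutativeSemigroup using (interchange)

0<♮compositions : ∀ n → 0ℚ ℚ.< ♮ (compositions n)
0<♮compositions n with compositions n | n+1≤2compositions n
... | suc c | _ = 0<♮suc c

inv-compositions≤ : ∀ n → inv (♮ (compositions n)) ℚ.≤ two ℚ.* rec n
inv-compositions≤ n = *-cancel-≤ t (0<♮compositions n) (ℚ.≤-trans (ℚ.≤-reflexive
    (≡.trans (inv-inverseʳ (0<♮compositions n)) (≡.sym (rec-inverse n))))
  (ℚ.≤-trans (*-monoˡ-≤ (0≤rec n) (ℚ.≤-trans (ℚ.≤-reflexive (≡.sym (♮-suc n))) (ℚ.≤-trans (♮-mono (n+1≤2compositions n)) (ℚ.≤-reflexive (♮-+ (compositions n) (compositions n))))))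
    (ℚ.≤-reflexive (solve 2 (λ r t → r :* (t :+ t) := t :* (con two :* r)) ≡.refl (rec n) t))))
  where
  open +-*-Solver
  t : ℚ
  t = ♮ (compositions n)

rec½ : ℕ → ℚ
rec½ n = rec ⌊ n /2⌋

b½ : ℕ → ℚ
b½ n = b ⌊ n /2⌋

-- b⁻² n = 2 / (b½ n)².
b⁻² : ℕ → ℚ
b⁻² n = (1ℚ ℚ.+ two ℚ.* ♮ ⌊ n /2⌋) ℚ.* wallis ⌊ n /2⌋

-- From numbers of paths to the squared probability.

module Limit (N : NormedAlgebra) (β : NormedAlgebra.Carrier N)
  (β²+β≈1 : NormedAlgebra._≈_ N (NormedAlgebra._+_ N (NormedAlgebra._*_ N β β) β) (NormedAlgebra.1# N))
  (β⊑ : NormedAlgebra._⊑_ N β (ℤ.+ 5 ℚ./ 8)) where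
  open NormedAlgebra N
  open Estimates N
  open BigO N
  open SeriesCalculus algebra using (_^_; B)
  open GeneratingFunctions algebra using (ι♮-+; ι♮-1)
  open Asymptotics N β β²+β≈1 β⊑
  open import Relation.Binary.Reasoning.Setoid setoid
  open Solver using (solve; _:+_; _:*_; _:-_; :-_; _:=_; con)

  O-* : ∀ {w v : ℕ → ℚ} {f g : ℕ → Carrier} → O w f → O v g → O (λ n → w n ℚ.* v n) (λ n → f n * g n)
  O-* {w} {v} {f} {g} (C , 0≤C , h) (D , 0≤D , k) = C ℚ.* D , *-nonNeg 0≤C 0≤D , λ n →
    ≡.subst (f n * g n ⊑_) (solveℚ 4 (λ C D w v → (C ∙ w) ∙ (D ∙ v) ≔ (C ∙ D) ∙ (w ∙ v)) ≡.refl C D (w n) (v n)) (⊑-* (h n) (k n))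
    where open +-*-Solver using () renaming (solve to solveℚ; _:*_ to _∙_; _:=_ to _≔_)

  t s : ℕ → Carrier
  t n = ι (♮ (compositions n))
  s zero    = 0#
  s (suc n) = t n

  t-suc : ∀ n → t (suc n) ≈ t n + s n
  t-suc zero    = sym (+-identityʳ _)
  t-suc (suc n) = ι♮-+ (compositions (suc n)) (compositions n)

  φ^ : ∀ n → φ ^ n ≈ t n + s n * β
  φ^ zero    = sym (trans (+-cong ι♮-1 (zeroˡ β)) (+-identityʳ 1#))
  φ^ (suc n) = begin
    φ * φ ^ n                          ≈⟨ *-congˡ (φ^ n) ⟩
    φ * (t n + s n * β)                ≈⟨ by-relation (s n) (solve 3 (λ β t s → (con 1ℚ :+ β) :* (t :+ s :* β)
                                            := t :+ s :+ t :* β :+ s :* (β :* β :+ β :- con 1ℚ)) refl β (t n) (s n)) ⟩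
    t n + s n + t n * β                ≈⟨ +-congʳ (t-suc n) ⟨
    t (suc n) + s (suc n) * β          ∎

  -- Up to sign a power of β, the contribution of the conjugate root to Binet's formula. It measures
  -- how far s n / t n is from β.
  δ : ℕ → Carrier
  δ n = s n - β * t n

  δ-suc : ∀ n → δ (suc n) ≈ - (β * δ n)
  δ-suc n = trans (+-congˡ (-‿cong (*-congˡ (t-suc n)))) (by-relation (- t n)
    (trans (solve 3 (λ β t s → t :- β :* (t :+ s) := :- (β :* (s :- β :* t)) :+ (:- t) :* (β :* β :+ β :- con 1ℚ)) refl β (t n) (s n)) refl))

  β⊑1 : β ⊑ 1ℚ
  β⊑1 = ⊑-mono (≤-by {ℤ.+ 5 ℚ./ 8} {1ℚ} (ℤ.+ 3 ℚ./ 8) (ℚ.nonNegative⁻¹ _) ≡.refl) β⊑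

  δ⊑1 : ∀ n → δ n ⊑ 1ℚ
  δ⊑1 zero    = ⊑-resp (sym (trans (+-identityˡ _) (-‿cong (trans (*-congˡ ι♮-1) (*-identityʳ β))))) (⊑-neg β⊑1)
  δ⊑1 (suc n) = ⊑-resp (sym (δ-suc n)) (⊑-neg (⊑-* β⊑1 (δ⊑1 n)))

  -- Found by inverting `K` in ℚ(√5); this is the number g(1)².
  K⁻¹ : Carrier
  K⁻¹ = (ι (# 11) + ι (# 7) * β) * ι (ℤ.+ 1 ℚ./ 20)

  KK⁻¹≈1 : K * K⁻¹ ≈ 1#
  KK⁻¹≈1 = trans (*-congʳ K≈) (trans (by-relation (q * ι (ℤ.+ 1 ℚ./ 20)) (solve 1 (λ β →
      let θ = con 1ℚ :- β in
      (con 1ℚ :- θ :* θ) :* (con 1ℚ :+ θ :+ θ :* θ) :* ((con (# 11) :+ con (# 7) :* β) :* con (ℤ.+ 1 ℚ./ 20))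
      := con 1ℚ :+ (con (# 20) :- con (# 46) :* β :+ con (# 31) :* (β :* β) :- con (# 7) :* (β :* β :* β)) :* con (ℤ.+ 1 ℚ./ 20)
                     :* (β :* β :+ β :- con 1ℚ)) refl β)) ι-1)
    where
    q : Carrier
    q = ι (# 20) - ι (# 46) * β + ι (# 31) * (β * β) - ι (# 7) * (β * β * β)
    θ′ : Carrier
    θ′ = ι 1ℚ - β
    θ≈ : 1# - β ≈ θ′
    θ≈ = +-congʳ (sym ι-1)
    K≈ : K ≈ (ι 1ℚ - θ′ * θ′) * (ι 1ℚ + θ′ + θ′ * θ′)
    K≈ = *-cong (+-cong (sym ι-1) (-‿cong (*-cong θ≈ θ≈))) (+-cong (+-cong (sym ι-1) θ≈) (*-cong θ≈ θ≈))

  0≤b½ : ∀ n → 0ℚ ℚ.≤ b½ n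
  0≤b½ n = 0≤b ⌊ n /2⌋

  ω≤b½ : ∀ n → ω n ℚ.≤ 1ℚ ℚ.* b½ n
  ω≤b½ n = ℚ.≤-trans (*-monoˡ-≤ (0≤b½ n) (rec≤1 ⌊ n /2⌋)) (ℚ.≤-reflexive (ℚ.*-comm (b½ n) 1ℚ))

  ref-O : O b½ ref
  ref-O = M , 0≤M , λ n → ≡.subst (ref n ⊑_) (ℚ.*-comm (b½ n) M) (⊑-* (ι-⊑⁺ (0≤b½ n)) (G⊑ ⌊ n /2⌋))
    where
    M : ℚ
    M = Fast.total fast-g
    0≤M : 0ℚ ℚ.≤ M
    0≤M = Fast.0≤total fast-g

  -- The limit of p² n π. The probability behaves like ρ m (2 - β) g(1) b ⌊n/2⌋, the factor `K⁻¹` is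
  -- g(1)², and the factor 2 comes from (b½ n)² b⁻² n = 2.
  limit : ℕ → Carrier
  limit m = ι two * (ρ m * (ι two - β) * (ρ m * (ι two - β))) * K⁻¹

  module _ (m : ℕ) (p : ℕ → ℚ)
    (p-ratio : ∀ n → p n ℚ.* (♮ (compositions n) ℚ.+ ♮ (compositions n)) ≡ ♮ (up m n ℕ.+ down m n)) where

    λₘ : Carrier
    λₘ = ρ m * (ι two - β)

    P it v : ℕ → Carrier
    P n = ι (p n)
    it n = ι (inv (♮ (compositions n)))
    v n = V m n * β ^ n

    t*it≈1 : ∀ n → t n * it n ≈ 1#
    t*it≈1 n = trans (sym (ι-* _ _)) (trans (ι-cong (inv-inverseʳ (0<♮compositions n))) ι-1)

    β^φ^ : ∀ n → β ^ n * φ ^ n ≈ 1#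
    β^φ^ zero    = *-identityˡ 1#
    β^φ^ (suc n) = trans (solve 4 (λ β b φ f → (β :* b) :* (φ :* f) := (φ :* β) :* (b :* f)) refl β (β ^ n) φ (φ ^ n))
      (trans (*-cong φβ≈1 (β^φ^ n)) (*-identityˡ 1#))

    -- Dividing `V m n` by the number of paths: the unit βⁿφⁿ is inserted, βⁿ normalises `V m n`,
    -- and φⁿ = t n + s n β cancels against the Fibonacci number t n.
    2P≈ : ∀ n → ι two * P n ≈ v n * (ι 1ℚ + β * (s n * it n))
    2P≈ n = begin
      ι two * P n                                   ≈⟨ *-identityʳ _ ⟨
      ι two * P n * 1#                              ≈⟨ *-congˡ (t*it≈1 n) ⟨
      ι two * P n * (t n * it n)                    ≈⟨ solve 3 (λ p t i → con two :* p :* (t :* i) := p :* (t :+ t) :* i) refl (P n) (t n) (it n) ⟩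
      P n * (t n + t n) * it n                      ≈⟨ *-congʳ (trans (*-congˡ (sym (ι-+ _ _))) (trans (sym (ι-* _ _)) (ι-cong (p-ratio n)))) ⟩
      V m n * it n                                  ≈⟨ *-congʳ (trans (sym (*-identityʳ _)) (*-congˡ (sym (β^φ^ n)))) ⟩
      V m n * (β ^ n * φ ^ n) * it n                ≈⟨ *-congʳ (*-congˡ (*-congˡ (φ^ n))) ⟩
      V m n * (β ^ n * (t n + s n * β)) * it n      ≈⟨ solve 6 (λ V b t s β i → V :* (b :* (t :+ s :* β)) :* i := V :* b :* (t :* i :+ β :* (s :* i))) refl (V m n) (β ^ n) (t n) (s n) β (it n) ⟩
      v n * (t n * it n + β * (s n * it n))         ≈⟨ *-congˡ (+-congʳ (trans (t*it≈1 n) (sym ι-1))) ⟩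
      v n * (ι 1ℚ + β * (s n * it n))               ∎

    v-O : O b½ v
    v-O = O-resp (λ n → solve 2 (λ x y → x :- y :+ y := x) refl (v n) (ι two * ρ m * ref n))
      (O-+ (O-weaken {v = b½} 1ℚ (ℚ.nonNegative⁻¹ 1ℚ) ω≤b½ (Asy-V m)) (O-scale (ι two * ρ m) ref-O))

    -- As s n / t n approaches β, the factor 1 + β s n / t n approaches 1 + β² = 2 - β. The
    -- deviation is β δ n / t n, where δ n is bounded.
    P-asymptotics : O ω (λ n → P n - λₘ * ref n)
    P-asymptotics = O-resp identity (O-scale (ι ½) (O-+ (O-scale (ι two - β) (Asy-V m)) (O-scale β (O-* {b½} {rec½} {v} v-O δit))))
      where
      δit : O rec½ (λ n → δ n * it n)
      δit = two , ℚ.nonNegative⁻¹ two , λ n → ⊑-mono (ℚ.≤-trans (ℚ.≤-reflexive (ℚ.*-identityˡ _))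
          (ℚ.≤-trans (inv-compositions≤ n) (*-monoˡ-≤ (ℚ.nonNegative⁻¹ two) (rec-anti (ℕ.⌊n/2⌋≤n n)))))
        (⊑-* (δ⊑1 n) (ι-⊑⁺ (ℚ.<⇒≤ (inv-pos (0<♮compositions n)))))
      identity : ∀ n → ι ½ * ((ι two - β) * (v n - ι two * ρ m * ref n) + β * (v n * (δ n * it n))) ≈ P n - λₘ * ref n
      identity n = begin
        ι ½ * ((ι two - β) * (v n - ι two * ρ m * ref n) + β * (v n * (δ n * it n)))
          ≈⟨ by-relation (ι (ℚ.- ½) * v n) (solve 7 (λ β v l r s t i →
               con ½ :* ((con two :- β) :* (v :- con two :* l :* r) :+ β :* (v :* ((s :- β :* t) :* i)))
               := con ½ :* (v :* (con 1ℚ :+ β :* (s :* i)) :+ v :* (β :* β) :* (con 1ℚ :- t :* i)) :- l :* (con two :- β) :* r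
                  :+ con (ℚ.- ½) :* v :* (β :* β :+ β :- con 1ℚ)) refl β (v n) (ρ m) (ref n) (s n) (t n) (it n)) ⟩
        ι ½ * (v n * (ι 1ℚ + β * (s n * it n)) + v n * (β * β) * (ι 1ℚ - t n * it n)) - λₘ * ref n
          ≈⟨ +-congʳ (*-congˡ (+-cong (sym (2P≈ n)) (trans (*-congˡ (trans (+-cong ι-1 (-‿cong (t*it≈1 n))) (-‿inverseʳ 1#))) (zeroʳ _)))) ⟩
        ι ½ * (ι two * P n + 0#) - λₘ * ref n
          ≈⟨ +-congʳ (trans (*-congˡ (+-identityʳ _)) (solve 1 (λ p → con ½ :* (con two :* p) := p) refl (P n))) ⟩
        P n - λₘ * ref n ∎

    -- Squaring removes the partial sums of `g`: K P² - λ² b² is the sum of K (P + λ ref)(P - λ ref)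
    -- and λ² b² (G² K - 1), both of size b² times the relative error. Multiplication by `b⁻²` turns
    -- b² into 2.
    P²-asymptotics : O rec½ (λ n → ι (p n ℚ.* p n ℚ.* b⁻² n) - limit m)
    P²-asymptotics = O-resp identity (O-scale K⁻¹ (O-resp (λ _ → refl) divided))
      where
      β½ : ℕ → Carrier
      β½ n = B ⌊ n /2⌋
      ε : ℕ → Carrier
      ε n = P n - λₘ * ref n
      P-O : O b½ (λ n → P n + λₘ * ref n)
      P-O = O-resp (λ n → solve 2 (λ p l → (p :- l) :+ l :+ l := p :+ l) refl (P n) (λₘ * ref n))
        (O-+ (O-+ (O-weaken {v = b½} 1ℚ (ℚ.nonNegative⁻¹ 1ℚ) ω≤b½ P-asymptotics) (O-scale λₘ ref-O)) (O-scale λₘ ref-O))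
      G²K½ : O rec½ (λ n → G ⌊ n /2⌋ * G ⌊ n /2⌋ * K - 1#)
      G²K½ = proj₁ G²K , proj₁ (proj₂ G²K) , λ n → proj₂ (proj₂ G²K) ⌊ n /2⌋
      β½-O : O b½ β½
      β½-O = 1ℚ , ℚ.nonNegative⁻¹ 1ℚ , λ n → ≡.subst (β½ n ⊑_) (≡.sym (ℚ.*-identityˡ (b½ n))) (ι-⊑⁺ (0≤b½ n))
      w : ℕ → ℚ
      w n = b½ n ℚ.* ω n
      undivided : O w (λ n → K * (P n * P n) - λₘ * λₘ * (β½ n * β½ n))
      undivided = O-resp (λ n → trans
          (solve 6 (λ k p l b g o → k :* ((p :+ l :* (b :* g)) :* (p :- l :* (b :* g))) :+ l :* l :* (b :* (b :* (g :* g :* k :- o)))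
            := k :* (p :* p) :- l :* l :* (b :* b) :* o) refl K (P n) λₘ (β½ n) (G ⌊ n /2⌋) 1#)
          (+-congˡ (-‿cong (*-identityʳ _))))
        (O-+ (O-scale K (O-* {b½} {ω} {λ n → P n + λₘ * ref n} P-O P-asymptotics))
          (O-scale (λₘ * λₘ) (O-* {b½} {ω} {β½} β½-O (O-* {b½} {rec½} {β½} β½-O G²K½))))
      0≤b⁻² : ∀ n → 0ℚ ℚ.≤ b⁻² n
      0≤b⁻² n = *-nonNeg (ℚ.<⇒≤ (0<1+ (*-nonNeg (ℚ.nonNegative⁻¹ two) (0≤♮ ⌊ n /2⌋)))) (wallis-nonNeg ⌊ n /2⌋)
      b²b⁻² : ∀ n → b½ n ℚ.* b½ n ℚ.* b⁻² n ≡ two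
      b²b⁻² n = ≡.trans (≡.sym (ℚ.*-assoc (b½ n ℚ.* b½ n) _ _)) (b²-wallis ⌊ n /2⌋)
      divided : O rec½ (λ n → ι (b⁻² n) * (K * (P n * P n) - λₘ * λₘ * (β½ n * β½ n)))
      divided = proj₁ undivided ℚ.* two , *-nonNeg (proj₁ (proj₂ undivided)) (ℚ.nonNegative⁻¹ two) , λ n →
        ⊑-mono (ℚ.≤-reflexive (≡.trans (solveℚ 4 (λ w c x r → w ∙ (c ∙ (x ∙ (x ∙ r))) ≔ c ∙ (x ∙ x ∙ w) ∙ r) ≡.refl (b⁻² n) (proj₁ undivided) (b½ n) (rec½ n))
            (≡.cong (λ z → proj₁ undivided ℚ.* z ℚ.* rec½ n) (b²b⁻² n))))
          (⊑-* (ι-⊑⁺ (0≤b⁻² n)) (proj₂ (proj₂ undivided) n))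
        where open +-*-Solver using () renaming (solve to solveℚ; _:*_ to _∙_; _:=_ to _≔_)
      identity : ∀ n → K⁻¹ * (ι (b⁻² n) * (K * (P n * P n) - λₘ * λₘ * (β½ n * β½ n))) ≈ ι (p n ℚ.* p n ℚ.* b⁻² n) - limit m
      identity n = trans (solve 6 (λ k j i p l b → j :* (i :* (k :* (p :* p) :- l :* l :* (b :* b))) := (k :* j) :* (p :* p :* i) :- (b :* b :* i) :* (l :* l) :* j)
          refl K K⁻¹ (ι (b⁻² n)) (P n) λₘ (β½ n))
        (+-cong (trans (*-congʳ KK⁻¹≈1) (trans (*-identityˡ _) (sym (trans (ι-* _ _) (*-congʳ (ι-* _ _))))))
          (-‿cong (*-congʳ (*-congʳ (trans (sym (trans (ι-* _ _) (*-congʳ (ι-* _ _)))) (ι-cong (b²b⁻² n)))))))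

-- Evaluation of the constants in ℚ(√5), and the passage to p² n π.

module Constants (N : NormedAlgebra) (√5 : NormedAlgebra.Carrier N)
  (√5² : NormedAlgebra._≈_ N (NormedAlgebra._*_ N √5 √5) (NormedAlgebra.ι N (# 5)))
  (β⊑ : NormedAlgebra._⊑_ N (NormedAlgebra._*_ N (NormedAlgebra._-_ N √5 (NormedAlgebra.ι N 1ℚ)) (NormedAlgebra.ι N ½)) (ℤ.+ 5 ℚ./ 8)) where
  open NormedAlgebra N
  open BigO N
  open Estimates N
  open import Relation.Binary.Reasoning.Setoid setoid
  open Solver using (solve; _:+_; _:*_; _:-_; :-_; _:=_; con)

  β : Carrier
  β = (√5 - ι 1ℚ) * ι ½

  by-√5² : ∀ {x y} q → x ≈ y + q * (√5 * √5 - ι (# 5)) → x ≈ y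
  by-√5² {x} {y} q eq = trans eq (trans (+-congˡ (trans (*-congˡ (trans (+-congʳ √5²) (-‿inverseʳ _))) (zeroʳ q))) (+-identityʳ y))

  β²+β≈1 : β * β + β ≈ 1#
  β²+β≈1 = trans (by-√5² (ι (ℤ.+ 1 ℚ./ 4)) (solve 1 (λ r → let β = (r :- con 1ℚ) :* con ½ in
    β :* β :+ β := con 1ℚ :+ con (ℤ.+ 1 ℚ./ 4) :* (r :* r :- con (# 5))) refl √5)) ι-1

  open Limit N β β²+β≈1 β⊑ using (limit; P²-asymptotics; K⁻¹) public
  open Asymptotics N β β²+β≈1 β⊑ using (ρ; three) public

  radicand : Carrier
  radicand = ι (# 7) * √5 - ι (# 15)

  -- A computation in ℚ(√5) with the same device as `by-relation`: the factor handed to `by-√5²` is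
  -- the quotient of the difference of both sides by r² - 5. The same holds for the longer factor
  -- `q` in `limit-suc`.
  limit-zero : ∀ h → ι two * h ≈ 1# → (ι two + √5) * h * ((ι two + √5) * h) * radicand ≈ limit 0
  limit-zero h 2h≈1 = trans (*-congʳ (*-cong (*-congˡ h≈½) (*-congˡ h≈½)))
    (by-√5² (ι (ℤ.+ 63 ℚ./ 16) + ι (ℤ.+ 133 ℚ./ 80) * √5) (solve 1 (λ r →
      let β = (r :- con 1ℚ) :* con ½
          a = (con two :+ r) :* con ½
          l = con 1ℚ :* (con two :- β)
      in a :* a :* (con (# 7) :* r :- con (# 15))
         := con two :* (l :* l) :* ((con (# 11) :+ con (# 7) :* β) :* con (ℤ.+ 1 ℚ./ 20))
            :+ (con (ℤ.+ 63 ℚ./ 16) :+ con (ℤ.+ 133 ℚ./ 80) :* r) :* (r :* r :- con (# 5))) refl √5))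
    where
    h≈½ : h ≈ ι ½
    h≈½ = trans (solve 1 (λ h → h := con two :* h :* con ½) refl h) (trans (*-congʳ 2h≈1) (*-identityˡ _))

  limit-suc : ∀ h R → ι (# 4) * (√5 - ι two) * R ≈ 1# →
    (ι (# 4) * ι (♮ (suc h)) + ι (# 3) - √5) * R * ((ι (# 4) * ι (♮ (suc h)) + ι (# 3) - √5) * R) * radicand ≈ limit (suc h)
  limit-suc h R R-inverse = trans (*-congʳ (*-cong (*-cong a≈ R≈) (*-cong a≈ R≈)))
    (by-√5² q (solve 2 (λ r s →
      let β = (r :- con 1ℚ) :* con ½
          a = (con (# 4) :* (con 1ℚ :+ s) :+ con (# 3) :- r) :* ((r :+ con two) :* con (ℤ.+ 1 ℚ./ 4))
          l = (con two :* s :+ con three :- β) :* (con two :- β)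
          q = con (ℤ.+ 1 ℚ./ 320) :* (con (# 5) :* (con (# 1008) :* (s :* s) :+ con (# 3528) :* s :+ con (# 3087))
            :+ (con (# 2128) :* (s :* s) :+ con (# 4928) :* s :+ con (# 2107)) :* r
            :- (con (# 1064) :* s :+ con (# 1547)) :* (r :* r) :+ con (# 133) :* (r :* r :* r))
      in a :* a :* (con (# 7) :* r :- con (# 15))
         := con two :* (l :* l) :* ((con (# 11) :+ con (# 7) :* β) :* con (ℤ.+ 1 ℚ./ 20))
            :+ q :* (r :* r :- con (# 5))) refl √5 (ι (♮ h))))
    where
    s q : Carrier
    s = ι (♮ h)
    q = ι (ℤ.+ 1 ℚ./ 320) * (ι (# 5) * (ι (# 1008) * (s * s) + ι (# 3528) * s + ι (# 3087))
      + (ι (# 2128) * (s * s) + ι (# 4928) * s + ι (# 2107)) * √5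
      - (ι (# 1064) * s + ι (# 1547)) * (√5 * √5) + ι (# 133) * (√5 * √5 * √5))
    -- Since (√5 - 2)(√5 + 2) = 1, the reciprocal of 4 (√5 - 2) is a polynomial in √5.
    R≈ : R ≈ (√5 + ι two) * ι (ℤ.+ 1 ℚ./ 4)
    R≈ = trans (by-√5² (- R) (solve 2 (λ r R → R
        := con (# 4) :* (r :- con two) :* R :* ((r :+ con two) :* con (ℤ.+ 1 ℚ./ 4)) :+ (:- R) :* (r :* r :- con (# 5))) refl √5 R))
      (trans (*-congʳ R-inverse) (*-identityˡ _))
    a≈ : ι (# 4) * ι (♮ (suc h)) + ι (# 3) - √5 ≈ ι (# 4) * (ι 1ℚ + s) + ι (# 3) - √5
    a≈ = +-congʳ (+-congʳ (*-congˡ (trans (ι-cong (♮-suc h)) (ι-+ 1ℚ (♮ h)))))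

  module _ (ι-⊑⁻ : ∀ q C → ι q ⊑ C → ℚ.∣ q ∣ ℚ.≤ C) (π : Carrier) (π-close : ∀ k → π - ι (wallis k) ⊑ four ℚ.* rec k)
    (m : ℕ) (p : ℕ → ℚ) (p-ratio : ∀ n → p n ℚ.* (♮ (compositions n) ℚ.+ ♮ (compositions n)) ≡ ♮ (up m n ℕ.+ down m n)) where

    private
      asymptotics : O rec½ (λ n → ι (p n ℚ.* p n ℚ.* b⁻² n) - limit m)
      asymptotics = P²-asymptotics m p p-ratio

      0≤rec½ : ∀ n → 0ℚ ℚ.≤ rec½ n
      0≤rec½ n = 0≤rec ⌊ n /2⌋

    -- The product of p² and `b⁻²` is bounded, and b⁻² n is at least 1 + ⌊n/2⌋. This a priori bound
    -- makes the replacement of b⁻² n by n π harmless.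
    p²-O : O rec½ (λ n → ι (p n ℚ.* p n))
    p²-O = M , 0≤M , λ n → ⊑-mono (p²≤ n) (ι-⊑⁺ (0≤p² n))
      where
      C L M : ℚ
      C = proj₁ asymptotics
      L = proj₁ (⊑-bounded (limit m))
      M = C ℚ.+ L
      0≤M : 0ℚ ℚ.≤ M
      0≤M = 0≤-+ (proj₁ (proj₂ asymptotics)) (proj₁ (proj₂ (⊑-bounded (limit m))))
      0≤p² : ∀ n → 0ℚ ℚ.≤ p n ℚ.* p n
      0≤p² n = square-nonNeg (p n)
        where
        square-nonNeg : ∀ q → 0ℚ ℚ.≤ q ℚ.* q
        square-nonNeg q = ≡.subst (0ℚ ℚ.≤_) (abs² q) (*-nonNeg (ℚ.0≤∣p∣ q) (ℚ.0≤∣p∣ q))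
          where
          open import Data.Sum.Base using (inj₁; inj₂)
          abs² : ∀ q → ℚ.∣ q ∣ ℚ.* ℚ.∣ q ∣ ≡ q ℚ.* q
          abs² q with ℚ.∣p∣≡p∨∣p∣≡-p q
          ... | inj₁ eq = ≡.cong (λ z → z ℚ.* z) eq
          ... | inj₂ eq = ≡.trans (≡.cong (λ z → z ℚ.* z) eq) (+-*-Solver.solve 1 (λ q → (+-*-Solver.:- q) +-*-Solver.:* (+-*-Solver.:- q) +-*-Solver.:= q +-*-Solver.:* q) ≡.refl q)
      p²b⁻²≤M : ∀ n → p n ℚ.* p n ℚ.* b⁻² n ℚ.≤ M
      p²b⁻²≤M n = ℚ.≤-trans (ℚ-Lemmas.p≤∣p∣ (p n ℚ.* p n ℚ.* b⁻² n)) (ι-⊑⁻ (p n ℚ.* p n ℚ.* b⁻² n) M (⊑-resp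
        (solve 2 (λ x l → x :- l :+ l := x) refl (ι (p n ℚ.* p n ℚ.* b⁻² n)) (limit m))
        (⊑-+ (⊑-mono (ℚ.≤-trans (*-monoˡ-≤ (proj₁ (proj₂ asymptotics)) (rec≤1 ⌊ n /2⌋)) (ℚ.≤-reflexive (ℚ.*-identityʳ C))) (proj₂ (proj₂ asymptotics) n))
          (proj₂ (proj₂ (⊑-bounded (limit m)))))))
      1+k≤b⁻² : ∀ n → 1ℚ ℚ.+ ♮ ⌊ n /2⌋ ℚ.≤ b⁻² n
      1+k≤b⁻² n = ℚ.≤-trans (≤-by {1ℚ ℚ.+ t} {(1ℚ ℚ.+ two ℚ.* t) ℚ.* two} (1ℚ ℚ.+ three ℚ.* t) (0≤-+ (ℚ.nonNegative⁻¹ 1ℚ) (*-nonNeg (ℚ.nonNegative⁻¹ three) (0≤♮ ⌊ n /2⌋)))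
          (solveℚ 1 (λ t → (con′ 1ℚ ∔ t) ∔ (con′ 1ℚ ∔ con′ three ∙ t) ≔ (con′ 1ℚ ∔ con′ two ∙ t) ∙ con′ two) ≡.refl t))
        (*-monoˡ-≤ (0≤-+ (ℚ.nonNegative⁻¹ 1ℚ) (*-nonNeg (ℚ.nonNegative⁻¹ two) (0≤♮ ⌊ n /2⌋))) (2≤wallis ⌊ n /2⌋))
        where
        open +-*-Solver using () renaming (solve to solveℚ; _:*_ to _∙_; _:+_ to _∔_; _:=_ to _≔_; con to con′)
        t : ℚ
        t = ♮ ⌊ n /2⌋
      p²≤ : ∀ n → p n ℚ.* p n ℚ.≤ M ℚ.* rec½ n
      p²≤ n = ℚ.≤-trans (ℚ.≤-reflexive (≡.sym (≡.trans (≡.cong (p n ℚ.* p n ℚ.*_) (≡.trans (ℚ.*-comm (1ℚ ℚ.+ ♮ ⌊ n /2⌋) (rec½ n)) (rec-inverse ⌊ n /2⌋))) (ℚ.*-identityʳ _))))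
        (ℚ.≤-trans (ℚ.≤-reflexive (≡.sym (ℚ.*-assoc (p n ℚ.* p n) _ _)))
          (*-monoʳ-≤ (0≤rec½ n) (ℚ.≤-trans (*-monoˡ-≤ (0≤p² n) (1+k≤b⁻² n)) (p²b⁻²≤M n))))

    -- With k = ⌊n/2⌋, π differs from `wallis k` by at most 4/(k+1) while n ≤ 2(k+1), which costs at
    -- most 8. Replacing n by 2k + 1 changes it by at most 1, times `wallis k` ≤ 4.
    scale-close : ∀ n → ι (♮ n) * π - ι (b⁻² n) ⊑ two ℚ.* four ℚ.+ four
    scale-close n = ⊑-resp (begin
        ι (♮ n) * (π - ι w) + (ι (♮ n) - ι d) * ι w  ≈⟨ solve 4 (λ n π w d → n :* (π :- w) :+ (n :- d) :* w := n :* π :- d :* w) refl (ι (♮ n)) π (ι w) (ι d) ⟩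
        ι (♮ n) * π - ι d * ι w                      ≈⟨ +-congˡ (-‿cong (ι-* d w)) ⟨
        ι (♮ n) * π - ι (b⁻² n)                      ∎)
      (⊑-+ (⊑-mono (ℚ.≤-trans (*-monoʳ-≤ (*-nonNeg (ℚ.nonNegative⁻¹ four) (0≤rec½ n)) n≤)
            (ℚ.≤-reflexive (≡.trans (solveℚ 2 (λ k r → con′ two ∙ k ∙ (con′ four ∙ r) ≔ con′ two ∙ con′ four ∙ (r ∙ k)) ≡.refl (1ℚ ℚ.+ ♮ k) (rec k))
              (≡.trans (≡.cong (two ℚ.* four ℚ.*_) (rec-inverse k)) (ℚ.*-identityʳ (two ℚ.* four))))))
          (⊑-* (ι-⊑⁺ (0≤♮ n)) (π-close k)))
        (⊑-mono (ℚ.≤-reflexive (ℚ.*-identityˡ four)) (⊑-* n-d (⊑-mono w≤4 (ι-⊑⁺ (Cauchy-Proofs.wallis-nonNeg k))))))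
      where
      open import Data.Sum.Base using (inj₁; inj₂)
      open +-*-Solver using () renaming (solve to solveℚ; _:*_ to _∙_; _:+_ to _∔_; _:=_ to _≔_; con to con′)
      k : ℕ
      k = ⌊ n /2⌋
      w d : ℚ
      w = wallis k
      d = 1ℚ ℚ.+ two ℚ.* ♮ k
      w≤4 : w ℚ.≤ four
      w≤4 = ℚ.≤-trans (Cauchy-Proofs.wallis≤upper k) (Cauchy-Proofs.wallis-upper≤4 k)
      double♮ : ∀ k → ♮ (double k) ≡ two ℚ.* ♮ k
      double♮ zero    = ≡.trans ♮-0 (≡.sym (≡.trans (≡.cong (two ℚ.*_) ♮-0) ≡.refl))
      double♮ (suc k) = ≡.trans (♮-suc _) (≡.trans (≡.cong (1ℚ ℚ.+_) (≡.trans (♮-suc _) (≡.cong (1ℚ ℚ.+_) (double♮ k))))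
        (≡.trans (solveℚ 1 (λ t → con′ 1ℚ ∔ (con′ 1ℚ ∔ con′ two ∙ t) ≔ con′ two ∙ (con′ 1ℚ ∔ t)) ≡.refl (♮ k)) (≡.cong (two ℚ.*_) (≡.sym (♮-suc k)))))
      n-d : ι (♮ n) - ι d ⊑ 1ℚ
      n-d with parity n
      ... | inj₁ eq = ⊑-resp (sym (trans (+-congʳ (ι-cong (≡.trans (≡.cong ♮ eq) (double♮ k)))) (trans (+-congˡ (-‿cong (ι-+ 1ℚ (two ℚ.* ♮ k))))
            (solve 1 (λ x → x :- (con 1ℚ :+ x) := :- con 1ℚ) refl (ι (two ℚ.* ♮ k))))))
          (⊑-neg (ι-⊑⁺ (ℚ.nonNegative⁻¹ 1ℚ)))
      ... | inj₂ eq = ⊑-resp (sym (trans (+-congʳ (ι-cong (≡.trans (≡.cong ♮ eq) (≡.trans (♮-suc _) (≡.cong (1ℚ ℚ.+_) (double♮ k)))))) (-‿inverseʳ (ι d))))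
          (0-⊑ (ℚ.nonNegative⁻¹ 1ℚ))
      n≤ : ♮ n ℚ.≤ two ℚ.* (1ℚ ℚ.+ ♮ k)
      n≤ with parity n
      ... | inj₁ eq = ≤-by {♮ n} two (ℚ.nonNegative⁻¹ two) (≡.trans (≡.cong (ℚ._+ two) (≡.trans (≡.cong ♮ eq) (double♮ k)))
            (solveℚ 1 (λ t → con′ two ∙ t ∔ con′ two ≔ con′ two ∙ (con′ 1ℚ ∔ t)) ≡.refl (♮ k)))
      ... | inj₂ eq = ≤-by {♮ n} 1ℚ (ℚ.nonNegative⁻¹ 1ℚ) (≡.trans (≡.cong (ℚ._+ 1ℚ) (≡.trans (≡.cong ♮ eq) (≡.trans (♮-suc _) (≡.cong (1ℚ ℚ.+_) (double♮ k)))))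
            (solveℚ 1 (λ t → con′ 1ℚ ∔ con′ two ∙ t ∔ con′ 1ℚ ≔ con′ two ∙ (con′ 1ℚ ∔ t)) ≡.refl (♮ k)))

    p²nπ-asymptotics : O rec½ (λ n → ι (p n) * ι (p n) * (ι (♮ n) * π) - limit m)
    p²nπ-asymptotics = O-resp
      (λ n → trans (+-cong (+-congʳ (ι-* _ _)) refl) (trans
        (solve 4 (λ x b s l → x :* b :- l :+ (s :- b) :* x := x :* s :- l) refl (ι (p n ℚ.* p n)) (ι (b⁻² n)) (ι (♮ n) * π) (limit m))
        (+-congʳ (*-congʳ (ι-* _ _)))))
      (O-+ asymptotics (O-*ˡ {u = λ n → ι (♮ n) * π - ι (b⁻² n)} (two ℚ.* four ℚ.+ four) (ℚ.nonNegative⁻¹ _) scale-close p²-O))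

module RingLemmas (A : ℚ-Algebra) where
  open ℚ-Algebra A using (1#; *-cong; *-congʳ; *-congˡ; *-identityˡ; *-identityʳ) renaming (_≈_ to _∼′_; _*_ to _·_; refl to ∼-refl; trans to ∼-trans; sym to ∼-sym)
  open ℚ-Algebra.Solver A using (solve; _:*_; _:=_)

  c²π : ∀ a σ D i w → σ · σ ∼′ D · i → w · i ∼′ 1# → (a · σ) · (a · σ) · w ∼′ a · a · D
  c²π a σ D i w σ² wi = ∼-trans (solve 3 (λ a σ w → a :* σ :* (a :* σ) :* w := a :* a :* (σ :* σ :* w)) ∼-refl a σ w)
    (*-congˡ (∼-trans (*-congʳ σ²) (∼-trans (solve 3 (λ D i w → D :* i :* w := D :* (w :* i)) ∼-refl D i w) (∼-trans (*-congˡ wi) (*-identityʳ D)))))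

  [c/s]²nπ : ∀ c i s n w → s · s ∼′ n → s · i ∼′ 1# → (c · i) · (c · i) · (n · w) ∼′ c · c · w
  [c/s]²nπ c i s n w s² si = ∼-trans (*-congˡ (*-congʳ (∼-sym s²)))
    (∼-trans (solve 4 (λ c i s w → c :* i :* (c :* i) :* (s :* s :* w) := c :* c :* w :* ((s :* i) :* (s :* i))) ∼-refl c i s w)
      (∼-trans (*-congˡ (∼-trans (*-cong si si) (*-identityˡ 1#))) (*-identityʳ _)))

-- Counting the listed paths by recursion on words.

module PathCounting where

  open import Defs using (Step; N; N̄; E; Ē; vector; move; points; endpoint; size; Zigzag; StaysAbove; ZigzagOfSize; zigzagOfSize?; staysAbove?; steps; wordsUpTo; paths)
  open import Data.Integer.Base as ℤ using (ℤ; +_)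
  open import Data.Integer.Solver using () renaming (module +-*-Solver to ℤ-Solver)
  open import Data.Sign.Base as Sign using (Sign; opposite)
  open import Data.Sign.Properties as Sign using (s≢opposite[s])
  open import Data.Empty using (⊥)
  open import Data.Unit.Base using (⊤; tt)
  open import Data.Sum.Base as Sum using (_⊎_; inj₁; inj₂)
  open import Data.List.Base using (List; []; _∷_; length; filter; map; _++_; cartesianProductWith)
  open import Data.List.Properties using (length-++; filter-++; filter-accept; filter-reject; filter-≐)
  open import Data.List.Relation.Unary.All as All using (All; []; _∷_)
  open import Data.List.Relation.Unary.Linked using (Linked; []; [-]; _∷_)
  open import Relation.Binary.PropositionalEquality
  open import Relation.Nullary using (¬_; Dec; yes; no)
  open import Relation.Nullary.Decidable using (_×-dec_; _⊎-dec_; map′)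
  open import Relation.Nullary.Negation using (contradiction)
  open import Relation.Unary using (Decidable)

  count : ∀ {A : Set} {P : A → Set} → Decidable P → List A → ℕ
  count P? xs = length (filter P? xs)

  module _ {A : Set} {P Q : A → Set} (P? : Decidable P) (Q? : Decidable Q) where

    count-filter : ∀ xs → count P? (filter Q? xs) ≡ count (λ x → Q? x ×-dec P? x) xs
    count-filter []       = refl
    count-filter (x ∷ xs) with Q? x
    ... | no  _ = count-filter xs
    ... | yes _ with P? x
    ...   | yes _ = cong suc (count-filter xs)
    ...   | no  _ = count-filter xs

    count-⊎ : (∀ x → P x → Q x → ⊥) → ∀ xs → count (λ x → P? x ⊎-dec Q? x) xs ≡ count P? xs ℕ.+ count Q? xs
    count-⊎ disjoint []       = refl
    count-⊎ disjoint (x ∷ xs) with P? x | Q? x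
    ... | yes p | yes q = contradiction q (disjoint x p)
    ... | yes _ | no  _ = cong suc (count-⊎ disjoint xs)
    ... | no  _ | yes _ = trans (cong suc (count-⊎ disjoint xs)) (sym (ℕ.+-suc _ _))
    ... | no  _ | no  _ = count-⊎ disjoint xs

  count-map : ∀ {A B : Set} {P : B → Set} (P? : Decidable P) (f : A → B) xs → count P? (map f xs) ≡ count (P? ∘ f) xs
  count-map P? f []       = refl
  count-map P? f (x ∷ xs) with P? (f x)
  ... | yes _ = cong suc (count-map P? f xs)
  ... | no  _ = count-map P? f xs

  count-++ : ∀ {A : Set} {P : A → Set} (P? : Decidable P) xs ys → count P? (xs ++ ys) ≡ count P? xs ℕ.+ count P? ys
  count-++ P? xs ys = trans (cong length (filter-++ P? xs ys)) (length-++ (filter P? xs))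

  count-none : ∀ {A : Set} {P : A → Set} (P? : Decidable P) → (∀ x → ¬ P x) → ∀ xs → count P? xs ≡ 0
  count-none P? ¬P []       = refl
  count-none P? ¬P (x ∷ xs) with P? x
  ... | yes p = contradiction p (¬P x)
  ... | no  _ = count-none P? ¬P xs

  -- Quantified over every decision procedure for `P`, so that the count depends on the property
  -- alone and the recursions may restrict a decider to words with a given first letter.
  record Counts (P : List Step → Set) (k c : ℕ) : Set where
    constructor counts
    field
      counted : (P? : Decidable P) → count P? (wordsUpTo k) ≡ c

  open Counts

  module _ {P : List Step → Set} where

    counts-cons : ∀ {k c₁ c₂ c₃ c₄} →
      Counts (P ∘ (N ∷_)) k c₁ → Counts (P ∘ (N̄ ∷_)) k c₂ → Counts (P ∘ (E ∷_)) k c₃ → Counts (P ∘ (Ē ∷_)) k c₄ →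
      (P? : Decidable P) → count P? (cartesianProductWith _∷_ steps (wordsUpTo k)) ≡ c₁ ℕ.+ (c₂ ℕ.+ (c₃ ℕ.+ c₄))
    counts-cons {k} h₁ h₂ h₃ h₄ P? =
      trans (part N _) (cong₂ ℕ._+_ (counted h₁ _) (trans (part N̄ _) (cong₂ ℕ._+_ (counted h₂ _) (trans (part E _) (cong₂ ℕ._+_ (counted h₃ _)
        (trans (part Ē []) (trans (ℕ.+-identityʳ _) (counted h₄ _))))))))
      where
      part : ∀ s rest → count P? (map (s ∷_) (wordsUpTo k) ++ rest) ≡ count (P? ∘ (s ∷_)) (wordsUpTo k) ℕ.+ count P? rest
      part s rest = trans (count-++ P? (map (s ∷_) (wordsUpTo k)) rest) (cong (ℕ._+ count P? rest) (count-map P? (s ∷_) (wordsUpTo k)))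

    counts-suc-yes : ∀ {k c₁ c₂ c₃ c₄} → P [] →
      Counts (P ∘ (N ∷_)) k c₁ → Counts (P ∘ (N̄ ∷_)) k c₂ → Counts (P ∘ (E ∷_)) k c₃ → Counts (P ∘ (Ē ∷_)) k c₄ →
      Counts P (suc k) (suc (c₁ ℕ.+ (c₂ ℕ.+ (c₃ ℕ.+ c₄))))
    counts-suc-yes p h₁ h₂ h₃ h₄ = counts λ P? → trans (cong length (filter-accept P? p)) (cong suc (counts-cons h₁ h₂ h₃ h₄ P?))

    counts-suc-no : ∀ {k c₁ c₂ c₃ c₄} → ¬ P [] →
      Counts (P ∘ (N ∷_)) k c₁ → Counts (P ∘ (N̄ ∷_)) k c₂ → Counts (P ∘ (E ∷_)) k c₃ → Counts (P ∘ (Ē ∷_)) k c₄ →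
      Counts P (suc k) (c₁ ℕ.+ (c₂ ℕ.+ (c₃ ℕ.+ c₄)))
    counts-suc-no ¬p h₁ h₂ h₃ h₄ = counts λ P? → trans (cong length (filter-reject P? ¬p)) (counts-cons h₁ h₂ h₃ h₄ P?)

    counts-zero : P [] → Counts P 0 1
    counts-zero p = counts λ P? → cong length (filter-accept P? p)

    counts-none : ∀ {k} → (∀ p → ¬ P p) → Counts P k 0
    counts-none {k} ¬P = counts λ P? → count-none P? ¬P (wordsUpTo k)

  pattern ↑ = Sign.+
  pattern ↓ = Sign.-

  -- Zigzag words of size r whose first step, if any, has the given direction.
  Zig : Sign → ℕ → List Step → Set
  Zig d r             []      = r ≡ 0
  Zig ↑ (suc r)       (N ∷ p) = Zig ↓ r p
  Zig ↑ (suc (suc r)) (E ∷ p) = Zig ↓ r p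
  Zig ↓ (suc r)       (N̄ ∷ p) = Zig ↑ r p
  Zig ↓ (suc (suc r)) (Ē ∷ p) = Zig ↑ r p
  Zig _ _             _       = ⊥

  -- `h` is the current height above the barrier, so paths from the origin over y = -m start with
  -- `h` equal to `m`. Natural numbers make a point below the barrier unrepresentable.
  Above : ℕ → List Step → Set
  Above h             []      = ⊤
  Above h             (N ∷ p) = Above (2 ℕ.+ h) p
  Above h             (E ∷ p) = Above (1 ℕ.+ h) p
  Above (suc (suc h)) (N̄ ∷ p) = Above h p
  Above (suc h)       (Ē ∷ p) = Above h p
  Above _             (_ ∷ _) = ⊥

  -- Every step has width at least 1, so a word of size `r` has at most `r` letters and any length
  -- bound `k` ≥ `r` gives the same count.
  zig-count : ∀ k d r → r ℕ.≤ k → Counts (Zig d r) k (compositions r)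
  zig-count zero    d zero          _          = counts-zero refl
  zig-count (suc k) ↑ zero          _          = counts-suc-yes refl (counts-none λ _ ()) (counts-none λ _ ()) (counts-none λ _ ()) (counts-none λ _ ())
  zig-count (suc k) ↓ zero          _          = counts-suc-yes refl (counts-none λ _ ()) (counts-none λ _ ()) (counts-none λ _ ()) (counts-none λ _ ())
  zig-count (suc k) ↑ 1             _          = counts-suc-no (λ ()) (zig-count k ↓ 0 ℕ.z≤n) (counts-none λ _ ()) (counts-none λ _ ()) (counts-none λ _ ())
  zig-count (suc k) ↓ 1             _          = counts-suc-no (λ ()) (counts-none λ _ ()) (zig-count k ↑ 0 ℕ.z≤n) (counts-none λ _ ()) (counts-none λ _ ())
  zig-count (suc k) ↑ (suc (suc r)) (ℕ.s≤s le) = subst (Counts _ _) (cong (compositions (suc r) ℕ.+_) (ℕ.+-identityʳ _))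
    (counts-suc-no (λ ()) (zig-count k ↓ (suc r) le) (counts-none λ _ ()) (zig-count k ↓ r (ℕ.≤-trans (ℕ.n≤1+n r) le)) (counts-none λ _ ()))
  zig-count (suc k) ↓ (suc (suc r)) (ℕ.s≤s le) =
    counts-suc-no (λ ()) (counts-none λ _ ()) (zig-count k ↑ (suc r) le) (counts-none λ _ ()) (zig-count k ↑ r (ℕ.≤-trans (ℕ.n≤1+n r) le))

  above-count : Sign → ℕ → ℕ → ℕ
  above-count ↑ = up
  above-count ↓ = down

  zig-above-count : ∀ k d r h → r ℕ.≤ k → Counts (λ p → Zig d r p × Above h p) k (above-count d h r)
  zig-above-count zero    ↑ zero    h _ = counts-zero (refl , tt)
  zig-above-count zero    ↓ zero    h _ = counts-zero (refl , tt)
  zig-above-count (suc k) ↑ zero    h _ = counts-suc-yes (refl , tt) (counts-none λ _ ()) (counts-none λ _ ()) (counts-none λ _ ()) (counts-none λ _ ())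
  zig-above-count (suc k) ↓ zero    h _ = counts-suc-yes (refl , tt) (counts-none λ _ ()) (counts-none λ _ ()) (counts-none λ _ ()) (counts-none λ _ ())
  zig-above-count (suc k) ↑ 1       h _ =
    counts-suc-no (λ ()) (zig-above-count k ↓ 0 (2 ℕ.+ h) ℕ.z≤n) (counts-none λ _ ()) (counts-none λ _ ()) (counts-none λ _ ())
  zig-above-count (suc k) ↑ (suc (suc r)) h (ℕ.s≤s le) = subst (Counts _ _) (cong (down (2 ℕ.+ h) (suc r) ℕ.+_) (ℕ.+-identityʳ _))
    (counts-suc-no (λ ()) (zig-above-count k ↓ (suc r) (2 ℕ.+ h) le) (counts-none λ _ ())
      (zig-above-count k ↓ r (1 ℕ.+ h) (ℕ.≤-trans (ℕ.n≤1+n r) le)) (counts-none λ _ ()))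
  zig-above-count (suc k) ↓ (suc r) 0 _ =
    counts-suc-no (λ ()) (counts-none λ _ ()) (counts-none λ _ ()) (counts-none λ _ ()) (counts-none λ _ ())
  zig-above-count (suc k) ↓ 1 1 _ =
    counts-suc-no (λ ()) (counts-none λ _ ()) (counts-none λ _ ()) (counts-none λ _ ()) (counts-none λ _ ())
  zig-above-count (suc k) ↓ (suc (suc r)) 1 (ℕ.s≤s le) =
    counts-suc-no (λ ()) (counts-none λ _ ()) (counts-none λ _ ()) (counts-none λ _ ()) (zig-above-count k ↑ r 0 (ℕ.≤-trans (ℕ.n≤1+n r) le))
  zig-above-count (suc k) ↓ 1 (suc (suc h)) _ =
    counts-suc-no (λ ()) (counts-none λ _ ()) (zig-above-count k ↑ 0 h ℕ.z≤n) (counts-none λ _ ()) (counts-none λ _ ())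
  zig-above-count (suc k) ↓ (suc (suc r)) (suc (suc h)) (ℕ.s≤s le) =
    counts-suc-no (λ ()) (counts-none λ _ ()) (zig-above-count k ↑ (suc r) h le) (counts-none λ _ ()) (zig-above-count k ↑ r (suc h) (ℕ.≤-trans (ℕ.n≤1+n r) le))

  direction : Step → Sign
  direction s = ℤ.sign (proj₂ (vector s))

  Starts : Sign → List Step → Set
  Starts d []      = ⊤
  Starts d (s ∷ _) = direction s ≡ d

  ≢⇒opposite : ∀ d e → d ≢ e → e ≡ opposite d
  ≢⇒opposite ↑ ↑ d≢e = contradiction refl d≢e
  ≢⇒opposite ↑ ↓ _   = refl
  ≢⇒opposite ↓ ↑ _   = refl
  ≢⇒opposite ↓ ↓ d≢e = contradiction refl d≢e

  zigzag-uncons : ∀ s p → Zigzag (s ∷ p) → Zigzag p × Starts (opposite (direction s)) p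
  zigzag-uncons s []      _       = [] , tt
  zigzag-uncons s (t ∷ p) (a ∷ l) = l , ≢⇒opposite (direction s) (direction t) a

  zigzag-cons : ∀ s p → Zigzag p → Starts (opposite (direction s)) p → Zigzag (s ∷ p)
  zigzag-cons s []      _ _  = [-]
  zigzag-cons s (t ∷ p) l eq = (λ same → s≢opposite[s] (direction s) (trans same eq)) ∷ l

  width : List Step → ℕ
  width []      = 0
  width (N ∷ p) = 1 ℕ.+ width p
  width (N̄ ∷ p) = 1 ℕ.+ width p
  width (E ∷ p) = 2 ℕ.+ width p
  width (Ē ∷ p) = 2 ℕ.+ width p

  endpoint-width : ∀ x y p → proj₁ (endpoint (x , y) p) ≡ x ℤ.+ + width p
  endpoint-width x y []      = sym (ℤ.+-identityʳ x)
  endpoint-width x y (N ∷ p) = trans (endpoint-width _ _ p) (ℤ.+-assoc x (+ 1) (+ width p))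
  endpoint-width x y (N̄ ∷ p) = trans (endpoint-width _ _ p) (ℤ.+-assoc x (+ 1) (+ width p))
  endpoint-width x y (E ∷ p) = trans (endpoint-width _ _ p) (ℤ.+-assoc x (+ 2) (+ width p))
  endpoint-width x y (Ē ∷ p) = trans (endpoint-width _ _ p) (ℤ.+-assoc x (+ 2) (+ width p))

  size≡width : ∀ p → size p ≡ + width p
  size≡width p = trans (endpoint-width (+ 0) (+ 0) p) (ℤ.+-identityˡ (+ width p))

  zig-intro : ∀ d p → Zigzag p → Starts d p → Zig d (width p) p
  zig-intro d []      _ _    = refl
  zig-intro ↑ (N ∷ p) l refl = let (l′ , s) = zigzag-uncons N p l in zig-intro ↓ p l′ s
  zig-intro ↑ (E ∷ p) l refl = let (l′ , s) = zigzag-uncons E p l in zig-intro ↓ p l′ s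
  zig-intro ↓ (N̄ ∷ p) l refl = let (l′ , s) = zigzag-uncons N̄ p l in zig-intro ↑ p l′ s
  zig-intro ↓ (Ē ∷ p) l refl = let (l′ , s) = zigzag-uncons Ē p l in zig-intro ↑ p l′ s

  zig-elim : ∀ d r p → Zig d r p → Zigzag p × Starts d p × width p ≡ r
  zig-elim d r             []      eq = [] , tt , sym eq
  zig-elim ↑ (suc r)       (N ∷ p) z  = let (l , s , eq) = zig-elim ↓ r p z in zigzag-cons N p l s , refl , cong suc eq
  zig-elim ↑ (suc (suc r)) (E ∷ p) z  = let (l , s , eq) = zig-elim ↓ r p z in zigzag-cons E p l s , refl , cong (2 ℕ.+_) eq
  zig-elim ↓ (suc r)       (N̄ ∷ p) z  = let (l , s , eq) = zig-elim ↑ r p z in zigzag-cons N̄ p l s , refl , cong suc eq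
  zig-elim ↓ (suc (suc r)) (Ē ∷ p) z  = let (l , s , eq) = zig-elim ↑ r p z in zigzag-cons Ē p l s , refl , cong (2 ℕ.+_) eq
  zig-elim ↑ zero          (N ∷ p) ()
  zig-elim ↑ zero          (E ∷ p) ()
  zig-elim ↑ (suc zero)    (E ∷ p) ()
  zig-elim ↓ zero          (N̄ ∷ p) ()
  zig-elim ↓ zero          (Ē ∷ p) ()
  zig-elim ↓ (suc zero)    (Ē ∷ p) ()

  zigzagOfSize⇒zig : ∀ n p → ZigzagOfSize n p → Zig ↑ n p ⊎ Zig ↓ n p
  zigzagOfSize⇒zig n p (l , eq) = Sum.map (cast ↑) (cast ↓) (either p l)
    where
    cast : ∀ d → Zig d (width p) p → Zig d n p
    cast d = subst (λ r → Zig d r p) (ℤ.+-injective (trans (sym (size≡width p)) eq))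
    either : ∀ p → Zigzag p → Zig ↑ (width p) p ⊎ Zig ↓ (width p) p
    either []      l = inj₁ refl
    either (N ∷ p) l = inj₁ (zig-intro ↑ (N ∷ p) l refl)
    either (E ∷ p) l = inj₁ (zig-intro ↑ (E ∷ p) l refl)
    either (N̄ ∷ p) l = inj₂ (zig-intro ↓ (N̄ ∷ p) l refl)
    either (Ē ∷ p) l = inj₂ (zig-intro ↓ (Ē ∷ p) l refl)

  zig⇒zigzagOfSize : ∀ n p → Zig ↑ n p ⊎ Zig ↓ n p → ZigzagOfSize n p
  zig⇒zigzagOfSize n p = Sum.[ from ↑ , from ↓ ]
    where
    from : ∀ d → Zig d n p → ZigzagOfSize n p
    from d z = let (l , _ , eq) = zig-elim d n p z in l , trans (size≡width p) (cong +_ eq)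

  -- Restricted to positive sizes: the empty path would have both directions. Hence `length-paths`
  -- and `count-staysAbove` also speak of `suc n`.
  zig-disjoint : ∀ n p → Zig ↑ (suc n) p → Zig ↓ (suc n) p → ⊥
  zig-disjoint n []      () _
  zig-disjoint n (s ∷ p) z w =
    contradiction (trans (sym (proj₁ (proj₂ (zig-elim ↑ (suc n) (s ∷ p) z)))) (proj₁ (proj₂ (zig-elim ↓ (suc n) (s ∷ p) w)))) λ ()

  module _ (m : ℕ) where

    OnOrAbove : ℤ × ℤ → Set
    OnOrAbove a = ℤ.- + m ℤ.≤ proj₂ a

    all-points-head : ∀ a p → All OnOrAbove (points a p) → OnOrAbove a
    all-points-head a []      (q ∷ _) = q
    all-points-head a (_ ∷ _) (q ∷ _) = q

    onOrAbove : ∀ {y} h → y ≡ + h ℤ.- + m → ℤ.- + m ℤ.≤ y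
    onOrAbove h refl = ℤ.≤-trans (ℤ.≤-reflexive (sym (ℤ.+-identityˡ _))) (ℤ.+-monoˡ-≤ (ℤ.- + m) (ℤ.+≤+ ℕ.z≤n))

    raise : ∀ {y} h k → y ≡ + h ℤ.- + m → y ℤ.+ + k ≡ + (k ℕ.+ h) ℤ.- + m
    raise h k refl = solve 3 (λ h m k → h :- m :+ k := k :+ h :- m) refl (+ h) (+ m) (+ k)
      where open ℤ-Solver

    lower : ∀ {y} h k → y ≡ + (k ℕ.+ h) ℤ.- + m → y ℤ.+ (ℤ.- + k) ≡ + h ℤ.- + m
    lower h k refl = solve 3 (λ h m k → k :+ h :- m :- k := h :- m) refl (+ h) (+ m) (+ k)
      where open ℤ-Solver

    room : ∀ {y} h k → y ≡ + h ℤ.- + m → ℤ.- + m ℤ.≤ y ℤ.+ (ℤ.- + k) → k ℕ.≤ h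
    room h k refl q = ℤ.drop‿+≤+ (subst₂ ℤ._≤_
      (solve 2 (λ m k → :- m :+ (m :+ k) := k) refl (+ m) (+ k))
      (solve 3 (λ h m k → h :- m :- k :+ (m :+ k) := h) refl (+ h) (+ m) (+ k))
      (ℤ.+-monoˡ-≤ (+ m ℤ.+ + k) q))
      where open ℤ-Solver

    above-intro : ∀ {x y} h p → y ≡ + h ℤ.- + m → All OnOrAbove (points (x , y) p) → Above h p
    above-intro h []      _  _       = tt
    above-intro h (N ∷ p) eq (_ ∷ q) = above-intro (2 ℕ.+ h) p (raise h 2 eq) q
    above-intro h (E ∷ p) eq (_ ∷ q) = above-intro (1 ℕ.+ h) p (raise h 1 eq) q
    above-intro (suc (suc h)) (N̄ ∷ p) eq (_ ∷ q) = above-intro h p (lower h 2 eq) q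
    above-intro (suc h)       (Ē ∷ p) eq (_ ∷ q) = above-intro h p (lower h 1 eq) q
    above-intro {x} {y} 0     (N̄ ∷ p) eq (_ ∷ q) = contradiction (room 0 2 eq (all-points-head (move (x , y) N̄) p q)) λ ()
    above-intro {x} {y} 1     (N̄ ∷ p) eq (_ ∷ q) = contradiction (room 1 2 eq (all-points-head (move (x , y) N̄) p q)) λ { (ℕ.s≤s ()) }
    above-intro {x} {y} 0     (Ē ∷ p) eq (_ ∷ q) = contradiction (room 0 1 eq (all-points-head (move (x , y) Ē) p q)) λ ()

    above-elim : ∀ {x y} h p → y ≡ + h ℤ.- + m → Above h p → All OnOrAbove (points (x , y) p)
    above-elim h             []      eq _ = onOrAbove h eq ∷ []
    above-elim h             (N ∷ p) eq q = onOrAbove h eq ∷ above-elim (2 ℕ.+ h) p (raise h 2 eq) q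
    above-elim h             (E ∷ p) eq q = onOrAbove h eq ∷ above-elim (1 ℕ.+ h) p (raise h 1 eq) q
    above-elim (suc (suc h)) (N̄ ∷ p) eq q = onOrAbove (suc (suc h)) eq ∷ above-elim h p (lower h 2 eq) q
    above-elim (suc h)       (Ē ∷ p) eq q = onOrAbove (suc h) eq ∷ above-elim h p (lower h 1 eq) q
    above-elim zero          (N̄ ∷ p) eq ()
    above-elim (suc zero)    (N̄ ∷ p) eq ()
    above-elim zero          (Ē ∷ p) eq ()

    origin≡ : + 0 ≡ + m ℤ.- + m
    origin≡ = sym (ℤ.+-inverseʳ (+ m))

  zig? : ∀ d r → Decidable (Zig d r)
  zig? d r p with zigzagOfSize? r p
  ... | no ¬z = no λ z → ¬z (zig⇒zigzagOfSize r p (inject d z))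
    where
    inject : ∀ d → Zig d r p → Zig ↑ r p ⊎ Zig ↓ r p
    inject ↑ = inj₁
    inject ↓ = inj₂
  ... | yes (l , eq) with starts? d p
    where
    starts? : ∀ d p → Dec (Starts d p)
    starts? d []      = yes tt
    starts? d (s ∷ _) = direction s Sign.≟ d
  ...   | yes s = yes (subst (λ n → Zig d n p) (ℤ.+-injective (trans (sym (size≡width p)) eq)) (zig-intro d p l s))
  ...   | no ¬s = no λ z → ¬s (proj₁ (proj₂ (zig-elim d r p z)))

  above? : ∀ m → Decidable (Above m)
  above? m p = map′ (above-intro m m p (origin≡ m)) (above-elim m m p (origin≡ m)) (staysAbove? m p)

  length-paths : ∀ n → length (paths (suc n)) ≡ compositions (suc n) ℕ.+ compositions (suc n)
  length-paths n = begin
    count (zigzagOfSize? (suc n)) words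
      ≡⟨ cong length (filter-≐ (zigzagOfSize? (suc n)) (λ p → zig? ↑ (suc n) p ⊎-dec zig? ↓ (suc n) p)
           ((λ {p} → zigzagOfSize⇒zig (suc n) p) , (λ {p} → zig⇒zigzagOfSize (suc n) p)) words) ⟩
    count (λ p → zig? ↑ (suc n) p ⊎-dec zig? ↓ (suc n) p) words
      ≡⟨ count-⊎ (zig? ↑ (suc n)) (zig? ↓ (suc n)) (zig-disjoint n) words ⟩
    count (zig? ↑ (suc n)) words ℕ.+ count (zig? ↓ (suc n)) words
      ≡⟨ cong₂ ℕ._+_ (counted (zig-count (suc n) ↑ (suc n) ℕ.≤-refl) (zig? ↑ (suc n))) (counted (zig-count (suc n) ↓ (suc n) ℕ.≤-refl) (zig? ↓ (suc n))) ⟩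
    compositions (suc n) ℕ.+ compositions (suc n) ∎
    where
    open ≡-Reasoning
    words : List (List Step)
    words = wordsUpTo (suc n)

  count-staysAbove : ∀ m n → count (staysAbove? m) (paths (suc n)) ≡ up m (suc n) ℕ.+ down m (suc n)
  count-staysAbove m n = begin
    count (staysAbove? m) (filter (zigzagOfSize? (suc n)) words)
      ≡⟨ count-filter (staysAbove? m) (zigzagOfSize? (suc n)) words ⟩
    count (λ p → zigzagOfSize? (suc n) p ×-dec staysAbove? m p) words
      ≡⟨ cong length (filter-≐ (λ p → zigzagOfSize? (suc n) p ×-dec staysAbove? m p) (λ p → both? ↑ p ⊎-dec both? ↓ p)
           ((λ {p} → to p) , (λ {p} → from p)) words) ⟩
    count (λ p → both? ↑ p ⊎-dec both? ↓ p) words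
      ≡⟨ count-⊎ (both? ↑) (both? ↓) (λ p (z , _) (z′ , _) → zig-disjoint n p z z′) words ⟩
    count (both? ↑) words ℕ.+ count (both? ↓) words
      ≡⟨ cong₂ ℕ._+_ (counted (zig-above-count (suc n) ↑ (suc n) m ℕ.≤-refl) (both? ↑)) (counted (zig-above-count (suc n) ↓ (suc n) m ℕ.≤-refl) (both? ↓)) ⟩
    up m (suc n) ℕ.+ down m (suc n) ∎
    where
    open ≡-Reasoning
    words : List (List Step)
    words = wordsUpTo (suc n)
    Both : Sign → List Step → Set
    Both d p = Zig d (suc n) p × Above m p
    both? : ∀ d → Decidable (Both d)
    both? d p = zig? d (suc n) p ×-dec above? m p
    to : ∀ p → ZigzagOfSize (suc n) p × StaysAbove m p → Both ↑ p ⊎ Both ↓ p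
    to p (z , q) = Sum.map (_, a) (_, a) (zigzagOfSize⇒zig (suc n) p z)
      where
      a : Above m p
      a = above-intro m m p (origin≡ m) q
    from : ∀ p → Both ↑ p ⊎ Both ↓ p → ZigzagOfSize (suc n) p × StaysAbove m p
    from p (inj₁ (z , a)) = zig⇒zigzagOfSize (suc n) p (inj₁ z) , above-elim m m p (origin≡ m) a
    from p (inj₂ (z , a)) = zig⇒zigzagOfSize (suc n) p (inj₂ z) , above-elim m m p (origin≡ m) a

open PathCounting using (length-paths; count-staysAbove)

open import Defs

open +-*-Solver using (solve; _:+_; _:*_; _:-_; :-_; _:=_; con)

-- Cauchy reals as a normed algebra.

Eventually : (ℕ → Set) → Set
Eventually P = ∃[ M ] (∀ n → M ℕ.≤ n → P n)

always : ∀ {P : ℕ → Set} → (∀ n → P n) → Eventually P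
always h = 0 , λ n _ → h n

eventually-map : ∀ {P Q : ℕ → Set} → (∀ n → P n → Q n) → Eventually P → Eventually Q
eventually-map f (M , h) = M , λ n M≤n → f n (h n M≤n)

eventually-× : ∀ {P Q : ℕ → Set} → Eventually P → Eventually Q → Eventually (λ n → P n × Q n)
eventually-× (M , h) (L , k) = M ℕ.⊔ L , λ n ≤n →
  h n (ℕ.≤-trans (ℕ.m≤m⊔n M L) ≤n) , k n (ℕ.≤-trans (ℕ.m≤n⊔m M L) ≤n)

-- lim sup ∣ f n ∣ ≤ q
record LimBound (f : ℕ → ℚ) (q : ℚ) : Set where
  constructor limBound
  field
    within : ∀ ε → 0ℚ ℚ.< ε → Eventually (λ n → ℚ.∣ f n ∣ ℚ.≤ q ℚ.+ ε)

open LimBound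

module _ {f : ℕ → ℚ} {p : ℚ} where
  limBound-resp : ∀ {g} → Eventually (λ n → f n ≡ g n) → LimBound f p → LimBound g p
  limBound-resp eq h = limBound λ ε 0<ε → eventually-map (λ n (eq , le) → ≡.subst (λ x → ℚ.∣ x ∣ ℚ.≤ p ℚ.+ ε) eq le) (eventually-× eq (within h ε 0<ε))

  limBound-mono : ∀ {q} → p ℚ.≤ q → LimBound f p → LimBound f q
  limBound-mono p≤q h = limBound λ ε 0<ε → eventually-map (λ n le → ℚ.≤-trans le (ℚ.+-monoˡ-≤ ε p≤q)) (within h ε 0<ε)

  limBound-const : Eventually (λ n → ℚ.∣ f n ∣ ℚ.≤ p) → LimBound f p
  limBound-const h = limBound λ ε 0<ε → eventually-map (λ n le → ℚ.≤-trans le (≤-by {p} {p ℚ.+ ε} ε (ℚ.<⇒≤ 0<ε) ≡.refl)) h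

  limBound-nonNeg : LimBound f p → 0ℚ ℚ.≤ p
  limBound-nonNeg h with 0ℚ ℚ.≤? p
  ... | yes 0≤p = 0≤p
  ... | no  0≰p = contradiction (ℚ.≤-<-trans (ℚ.0≤∣p∣ (f M)) (ℚ.≤-<-trans (proj₂ (within h ε 0<ε) M ℕ.≤-refl) p+ε<0)) (ℚ.<-irrefl ≡.refl)
    where
    p<0 : p ℚ.< 0ℚ
    p<0 = ℚ.≰⇒> 0≰p
    ε : ℚ
    ε = ½ ℚ.* (ℚ.- p)
    0<-p : 0ℚ ℚ.< ℚ.- p
    0<-p = ℚ.neg-antimono-< p<0
    0<ε : 0ℚ ℚ.< ε
    0<ε = halve-pos 0<-p
    M : ℕ
    M = proj₁ (within h ε 0<ε)
    p+ε<0 : p ℚ.+ ε ℚ.< 0ℚ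
    p+ε<0 = ≡.subst (ℚ._< 0ℚ) (solve 1 (λ p → :- (con ½ :* (:- p)) := p :+ con ½ :* (:- p)) ≡.refl p) (ℚ.neg-antimono-< 0<ε)

limBound-+ : ∀ {f g p q} → LimBound f p → LimBound g q → LimBound (λ n → f n ℚ.+ g n) (p ℚ.+ q)
limBound-+ {f} {g} {p} {q} h k = limBound λ ε 0<ε → eventually-map
  (λ n (le , le′) → ℚ.≤-trans (ℚ.∣p+q∣≤∣p∣+∣q∣ (f n) (g n)) (ℚ.≤-trans (ℚ.+-mono-≤ le le′) (ℚ.≤-reflexive
    (≡.trans (solve 3 (λ p q e → p :+ e :+ (q :+ e) := p :+ q :+ (e :+ e)) ≡.refl p q (½ ℚ.* ε)) (≡.cong (p ℚ.+ q ℚ.+_) (halves ε))))))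
  (eventually-× (within h (½ ℚ.* ε) (halve-pos 0<ε)) (within k (½ ℚ.* ε) (halve-pos 0<ε)))

limBound-* : ∀ {f g p q} → LimBound f p → LimBound g q → LimBound (λ n → f n ℚ.* g n) (p ℚ.* q)
limBound-* {f} {g} {p} {q} h k = limBound λ ε 0<ε → let open Radius ε 0<ε in eventually-map
  (λ n (le , le′) → ℚ.≤-trans (ℚ.≤-reflexive (ℚ.∣p*q∣≡∣p∣*∣q∣ (f n) (g n)))
    (ℚ.≤-trans (*-mono-≤ (ℚ.0≤∣p∣ (f n)) (ℚ.0≤∣p∣ (g n)) le le′) product≤))
  (eventually-× (within h δ 0<δ) (within k δ 0<δ))
  where
  0≤p : 0ℚ ℚ.≤ p
  0≤p = limBound-nonNeg h
  0≤q : 0ℚ ℚ.≤ q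
  0≤q = limBound-nonNeg k
  module Radius (ε : ℚ) (0<ε : 0ℚ ℚ.< ε) where
    -- δ = ε / (ε + p + q + 1) is at most 1, so the excess (p + q + δ) δ of the product over p q is
    -- at most (p + q + 1) δ ≤ ε.
    d δ : ℚ
    d = ε ℚ.+ (p ℚ.+ q ℚ.+ 1ℚ)
    δ = ε ℚ.* inv d
    0≤pq1 : 0ℚ ℚ.≤ p ℚ.+ q ℚ.+ 1ℚ
    0≤pq1 = 0≤-+ (0≤-+ 0≤p 0≤q) (ℚ.nonNegative⁻¹ 1ℚ)
    0<d : 0ℚ ℚ.< d
    0<d = ℚ.+-mono-<-≤ 0<ε 0≤pq1
    0<δ : 0ℚ ℚ.< δ
    0<δ = *-pos 0<ε (inv-pos 0<d)
    0≤δ : 0ℚ ℚ.≤ δ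
    0≤δ = ℚ.<⇒≤ 0<δ
    dδ≡ε : d ℚ.* δ ≡ ε
    dδ≡ε = ≡.trans (solve 3 (λ d e i → d :* (e :* i) := e :* (d :* i)) ≡.refl d ε (inv d))
      (≡.trans (≡.cong (ε ℚ.*_) (inv-inverseʳ 0<d)) (ℚ.*-identityʳ ε))
    δ≤1 : δ ℚ.≤ 1ℚ
    δ≤1 = *-cancel-≤ d 0<d (ℚ.≤-trans (ℚ.≤-reflexive dδ≡ε) (≤-by {ε} {d ℚ.* 1ℚ} (p ℚ.+ q ℚ.+ 1ℚ) 0≤pq1 (≡.sym (ℚ.*-identityʳ d))))
    product≤ : (p ℚ.+ δ) ℚ.* (q ℚ.+ δ) ℚ.≤ p ℚ.* q ℚ.+ ε
    product≤ = ℚ.≤-trans (ℚ.≤-reflexive (solve 3 (λ p q e → (p :+ e) :* (q :+ e) := p :* q :+ (p :+ q :+ e) :* e) ≡.refl p q δ))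
      (ℚ.+-monoʳ-≤ (p ℚ.* q) (ℚ.≤-trans (*-monoʳ-≤ 0≤δ (ℚ.≤-trans (ℚ.+-monoʳ-≤ (p ℚ.+ q) δ≤1)
        (≤-by {p ℚ.+ q ℚ.+ 1ℚ} {d} ε (ℚ.<⇒≤ 0<ε) (ℚ.+-comm (p ℚ.+ q ℚ.+ 1ℚ) ε)))) (ℚ.≤-reflexive dδ≡ε)))

limBound-neg : ∀ {f p} → LimBound f p → LimBound (λ n → ℚ.- f n) p
limBound-neg {f} {p} h = limBound λ ε 0<ε → eventually-map (λ n le → ≡.subst (ℚ._≤ p ℚ.+ ε) (≡.sym (ℚ.∣-p∣≡∣p∣ (f n))) le) (within h ε 0<ε)

infix 4 _≈_ _⊑_
record _≈_ (x y : ℝ) : Set where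
  constructor limZero
  field
    difference : LimBound (λ n → seq x n ℚ.- seq y n) 0ℚ

-- A bound on the lim sup rather than on the terms is invariant under `≈`, and for a constant
-- sequence it still bounds the rational itself, see `ι-⊑⁻`.
record _⊑_ (x : ℝ) (q : ℚ) : Set where
  constructor bounds
  field
    limBounds : LimBound (seq x) q

open _≈_ public
open _⊑_ public

≈-eventually : ∀ {x y} → Eventually (λ n → seq x n ≡ seq y n) → x ≈ y
≈-eventually {x} {y} h = limZero (limBound-const (eventually-map
  (λ n eq → ℚ.≤-reflexive (≡.cong ℚ.∣_∣ (≡.trans (≡.cong (ℚ._- seq y n) eq) (ℚ.+-inverseʳ (seq y n))))) h))

≈-pointwise : ∀ {x y} → (∀ n → seq x n ≡ seq y n) → x ≈ y
≈-pointwise {x} {y} h = ≈-eventually {x} {y} (always h)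

ℝ-bounded : ∀ x → ∃[ q ] (0ℚ ℚ.≤ q × x ⊑ q)
ℝ-bounded x = proj₁ h , ℚ.≤-trans (ℚ.nonNegative⁻¹ 1ℚ) (proj₁ (proj₂ h)) , bounds (limBound-const {seq x} {proj₁ h} (proj₂ (proj₂ h)))
  where
  h : ∃[ q ] (1ℚ ℚ.≤ q × Eventually (λ n → ℚ.∣ seq x n ∣ ℚ.≤ q))
  h = bounded {seq x} (cauchy x)

infixl 6 _⊞_
infixl 7 _⊠_
infix  8 ⊟_

-- The ring operations are opaque so that conversion never compares Cauchy moduli.
opaque
  _⊞_ _⊠_ : ℝ → ℝ → ℝ
  _⊞_ = _+_
  _⊠_ = _*_

  ⊟_ : ℝ → ℝ
  ⊟_ = -_

  ι : ℚ → ℝ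
  ι = fromℚ

  seq-⊞ : ∀ x y n → seq (x ⊞ y) n ≡ seq x n ℚ.+ seq y n
  seq-⊞ x y n = ≡.refl

  seq-⊠ : ∀ x y n → seq (x ⊠ y) n ≡ seq x n ℚ.* seq y n
  seq-⊠ x y n = ≡.refl

  seq-⊟ : ∀ x n → seq (⊟ x) n ≡ ℚ.- seq x n
  seq-⊟ x n = ≡.refl

  seq-ι : ∀ q n → seq (ι q) n ≡ q
  seq-ι q n = ≡.refl

  ℝ-*-cong : ∀ {x x′ y y′} → x ≈ x′ → y ≈ y′ → x ⊠ y ≈ x′ ⊠ y′
  ℝ-*-cong {x} {x′} {y} {y′} (limZero p) (limZero q) = limZero (limBound-mono (ℚ.≤-reflexive zero≡)
    (limBound-resp (always (λ n → ≡.sym (*-diff (seq x n) (seq x′ n) (seq y n) (seq y′ n))))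
      (limBound-+ (limBound-* (limBounds (proj₂ (proj₂ (ℝ-bounded x)))) q) (limBound-* p (limBounds (proj₂ (proj₂ (ℝ-bounded y′))))))))
    where
    A B : ℚ
    A = proj₁ (ℝ-bounded x)
    B = proj₁ (ℝ-bounded y′)
    zero≡ : A ℚ.* 0ℚ ℚ.+ 0ℚ ℚ.* B ≡ 0ℚ
    zero≡ = solve 2 (λ a b → a :* con 0ℚ :+ con 0ℚ :* b := con 0ℚ) ≡.refl A B

  ℝ-isCommutativeRing : IsCommutativeRing _≈_ _⊞_ _⊠_ ⊟_ (ι 0ℚ) (ι 1ℚ)
  ℝ-isCommutativeRing = record
    { isRing = record
      { +-isAbelianGroup = record
        { isGroup = record
          { isMonoid = record
            { isSemigroup = record
              { isMagma = record
                { isEquivalence = record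
                  { refl  = λ {x} → ≈-pointwise {x} {x} (λ _ → ≡.refl)
                  ; sym   = λ {x} {y} (limZero p) → limZero (limBound-resp (always (λ n → ℚ-Lemmas.neg-sub (seq x n) (seq y n))) (limBound-neg p))
                  ; trans = λ {x} {y} {z} (limZero p) (limZero q) → limZero (limBound-resp
                      (always (λ n → solve 3 (λ a b c → a :- b :+ (b :- c) := a :- c) ≡.refl (seq x n) (seq y n) (seq z n))) (limBound-+ p q))
                  }
                ; ∙-cong = λ {x} {x′} {y} {y′} (limZero p) (limZero q) → limZero (limBound-resp
                      (always (λ n → solve 4 (λ a b c d → a :- b :+ (c :- d) := (a :+ c) :- (b :+ d)) ≡.refl (seq x n) (seq x′ n) (seq y n) (seq y′ n))) (limBound-+ p q))
                }
              ; assoc = λ x y z → ≈-pointwise {x ⊞ y ⊞ z} {x ⊞ (y ⊞ z)} (λ n → ℚ.+-assoc (seq x n) (seq y n) (seq z n))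
              }
            ; identity = (λ x → ≈-pointwise {ι 0ℚ ⊞ x} {x} (λ n → ℚ.+-identityˡ (seq x n)))
                       , (λ x → ≈-pointwise {x ⊞ ι 0ℚ} {x} (λ n → ℚ.+-identityʳ (seq x n)))
            }
          ; inverse = (λ x → ≈-pointwise {(⊟ x) ⊞ x} {ι 0ℚ} (λ n → ℚ.+-inverseˡ (seq x n)))
                    , (λ x → ≈-pointwise {x ⊞ (⊟ x)} {ι 0ℚ} (λ n → ℚ.+-inverseʳ (seq x n)))
          ; ⁻¹-cong = λ {x} {y} (limZero p) → limZero (limBound-resp
              (always (λ n → solve 2 (λ a b → :- (a :- b) := :- a :- :- b) ≡.refl (seq x n) (seq y n))) (limBound-neg p))
          }
        ; comm = λ x y → ≈-pointwise {x ⊞ y} {y ⊞ x} (λ n → ℚ.+-comm (seq x n) (seq y n))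
        }
      ; *-cong = λ {x} {x′} {y} {y′} → ℝ-*-cong {x} {x′} {y} {y′}
      ; *-assoc = λ x y z → ≈-pointwise {x ⊠ y ⊠ z} {x ⊠ (y ⊠ z)} (λ n → ℚ.*-assoc (seq x n) (seq y n) (seq z n))
      ; *-identity = (λ x → ≈-pointwise {ι 1ℚ ⊠ x} {x} (λ n → ℚ.*-identityˡ (seq x n)))
                   , (λ x → ≈-pointwise {x ⊠ ι 1ℚ} {x} (λ n → ℚ.*-identityʳ (seq x n)))
      ; distrib = (λ x y z → ≈-pointwise {x ⊠ (y ⊞ z)} {x ⊠ y ⊞ x ⊠ z} (λ n → ℚ.*-distribˡ-+ (seq x n) (seq y n) (seq z n)))
                , (λ x y z → ≈-pointwise {(y ⊞ z) ⊠ x} {y ⊠ x ⊞ z ⊠ x} (λ n → ℚ.*-distribʳ-+ (seq x n) (seq y n) (seq z n)))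
      }
    ; *-comm = λ x y → ≈-pointwise {x ⊠ y} {y ⊠ x} (λ n → ℚ.*-comm (seq x n) (seq y n))
    }

  ι-⊞ : ∀ p q → ι (p ℚ.+ q) ≈ ι p ⊞ ι q
  ι-⊞ p q = ≈-pointwise (λ _ → ≡.refl)

  ι-⊠ : ∀ p q → ι (p ℚ.* q) ≈ ι p ⊠ ι q
  ι-⊠ p q = ≈-pointwise (λ _ → ≡.refl)

  ι-⊟ : ∀ p → ι (ℚ.- p) ≈ ⊟ ι p
  ι-⊟ p = ≈-pointwise (λ _ → ≡.refl)

  ⊑-⊞ : ∀ {x y p q} → x ⊑ p → y ⊑ q → x ⊞ y ⊑ p ℚ.+ q
  ⊑-⊞ (bounds h) (bounds k) = bounds (limBound-+ h k)

  ⊑-⊠ : ∀ {x y p q} → x ⊑ p → y ⊑ q → x ⊠ y ⊑ p ℚ.* q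
  ⊑-⊠ (bounds h) (bounds k) = bounds (limBound-* h k)

  ι-⊑ : ∀ q → ι q ⊑ ℚ.∣ q ∣
  ι-⊑ q = bounds (limBound-const (always (λ _ → ℚ.≤-refl)))

ℝ-ring : CommutativeRing 0ℓ 0ℓ
ℝ-ring = record { isCommutativeRing = ℝ-isCommutativeRing }

ℝ-algebra : ℚ-Algebra
ℝ-algebra = record
  { commutativeRing = ℝ-ring ; ι = ι ; ι-+ = ι-⊞ ; ι-* = ι-⊠ ; ι-‿ = ι-⊟
  ; ι-0 = CommutativeRing.refl ℝ-ring ; ι-1 = CommutativeRing.refl ℝ-ring }

ℝ-normed : NormedAlgebra
ℝ-normed = record
  { algebra   = ℝ-algebra
  ; _⊑_       = _⊑_
  ; ⊑-resp    = λ {x} {y} {q} (limZero p) (bounds h) → bounds (limBound-mono {q = q} (ℚ.≤-reflexive (ℚ.+-identityʳ q))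
      (limBound-resp (always (λ n → solve 2 (λ a b → a :+ (:- (a :- b)) := b) ≡.refl (seq x n) (seq y n))) (limBound-+ h (limBound-neg p))))
  ; ⊑-mono    = λ p≤q (bounds h) → bounds (limBound-mono p≤q h)
  ; ⊑-+       = ⊑-⊞
  ; ⊑-*       = ⊑-⊠
  ; ι-⊑       = ι-⊑
  ; ⊑-bounded = ℝ-bounded
  }


/-♮-nonZero : ∀ a l .{{_ : ℕ.NonZero l}} → (ℤ.+ a ℚ./ l) ℚ.* ♮ l ≡ ♮ a
/-♮-nonZero a (suc d) = /-♮ a d

ℙ-ratio : ∀ {a l v t} .{{_ : ℕ.NonZero l}} → a ≡ v → l ≡ t ℕ.+ t → (ℤ.+ a ℚ./ l) ℚ.* (♮ t ℚ.+ ♮ t) ≡ ♮ v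
ℙ-ratio {a} {l} {v} {t} a≡v l≡t+t = ≡.trans (≡.cong ((ℤ.+ a ℚ./ l) ℚ.*_) (≡.trans (≡.sym (♮-+ t t)) (≡.cong ♮ (≡.sym l≡t+t))))
  (≡.trans (/-♮-nonZero a l) (≡.cong ♮ a≡v))

prob-ratio : ∀ m n → probStaysAbove m n ℚ.* (♮ (compositions n) ℚ.+ ♮ (compositions n)) ≡ ♮ (up m n ℕ.+ down m n)
prob-ratio m (suc n) = ℙ-ratio {t = compositions (suc n)} {{paths-nonEmpty (suc n)}} (count-staysAbove m n) (length-paths n)
-- At size 0 the empty path is counted by `up` and by `down`, and the total is doubled as well, so
-- the ratio is still 1.
prob-ratio m zero    = ≡.trans (≡.cong (λ a → (ℤ.+ a ℚ./ 1) ℚ.* (♮ 1 ℚ.+ ♮ 1)) one)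
  (≡.trans (ℚ.*-identityˡ (♮ 1 ℚ.+ ♮ 1)) (≡.sym (♮-+ 1 1)))
  where
  -m≤0 : ℤ.- ℤ.+ m ℤ.≤ ℤ.+ 0
  -m≤0 = ℤ.neg-≤-pos {m} {0}
  one : length (filter (staysAbove? m) ([] ∷ [])) ≡ 1
  one = ≡.cong length (filter-accept (staysAbove? m) {x = []} {xs = []} (-m≤0 ∷ []))

prob-nonNeg : ∀ m n → 0ℚ ℚ.≤ probStaysAbove m n
prob-nonNeg m n = nonNeg (length (filter (staysAbove? m) (paths n))) (length (paths n)) {{paths-nonEmpty n}}
  where
  nonNeg : ∀ a l .{{_ : ℕ.NonZero l}} → 0ℚ ℚ.≤ ℤ.+ a ℚ./ l
  nonNeg a (suc d) = ℕ/-mono-≤ 0 0 a d ℕ.z≤n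

≤-limit : ∀ {p q} → (∀ ε → 0ℚ ℚ.< ε → p ℚ.≤ q ℚ.+ ε) → p ℚ.≤ q
≤-limit {p} {q} h with p ℚ.≤? q
... | yes p≤q = p≤q
... | no  p≰q = contradiction (ℚ.<-≤-trans q+ε<p (h (½ ℚ.* (p ℚ.- q)) (halve-pos 0<p-q))) (ℚ.<-irrefl ≡.refl)
  where
  open +-*-Solver
  0<p-q : 0ℚ ℚ.< p ℚ.- q
  0<p-q = ≡.subst (ℚ._< p ℚ.- q) (ℚ.+-inverseʳ q) (ℚ.+-monoˡ-< (ℚ.- q) (ℚ.≰⇒> p≰q))
  q+ε<p : q ℚ.+ ½ ℚ.* (p ℚ.- q) ℚ.< p
  q+ε<p = ≡.subst₂ ℚ._<_ (ℚ.+-identityʳ _) (solve 2 (λ p q → q :+ con ½ :* (p :- q) :+ con ½ :* (p :- q) := p) ≡.refl p q)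
    (ℚ.+-monoʳ-< (q ℚ.+ ½ ℚ.* (p ℚ.- q)) (halve-pos 0<p-q))

ι-⊑⁻ : ∀ q C → ι q ⊑ C → ℚ.∣ q ∣ ℚ.≤ C
ι-⊑⁻ q C (bounds h) = ≤-limit λ ε 0<ε → ≡.subst (λ x → ℚ.∣ x ∣ ℚ.≤ C ℚ.+ ε) (seq-ι q _) (proj₂ (within h ε 0<ε) _ ℕ.≤-refl)

-- `wallis` increases and `wallis-upper` decreases, so all later terms lie between `wallis k` and
-- `wallis-upper k`.
π-close : ∀ k → π ⊞ ⊟ ι (wallis k) ⊑ four ℚ.* rec k
π-close k = bounds (limBound-resp (always seq≡) (limBound-const (k , bound)))
  where
  seq≡ : ∀ n → wallis n ℚ.- wallis k ≡ seq (π ⊞ ⊟ ι (wallis k)) n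
  seq≡ n = ≡.sym (≡.trans (seq-⊞ π (⊟ ι (wallis k)) n) (≡.cong (wallis n ℚ.+_) (≡.trans (seq-⊟ (ι (wallis k)) n) (≡.cong ℚ.-_ (seq-ι (wallis k) n)))))
  lower : ∀ d → wallis k ℚ.≤ wallis (d ℕ.+ k)
  lower zero    = ℚ.≤-refl
  lower (suc d) = ℚ.≤-trans (lower d) (wallis-↗ (d ℕ.+ k))
  upper : ∀ d → wallis-upper (d ℕ.+ k) ℚ.≤ wallis-upper k
  upper zero    = ℚ.≤-refl
  upper (suc d) = ℚ.≤-trans (wallis-upper-↘ (d ℕ.+ k)) (upper d)
  close : ∀ d → ℚ.∣ wallis (d ℕ.+ k) ℚ.- wallis k ∣ ℚ.≤ four ℚ.* rec k
  close d = ℚ-Lemmas.∣p-q∣≤⁺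
    (ℚ.≤-trans (wallis≤upper (d ℕ.+ k)) (ℚ.≤-trans (upper d) (≡.subst (λ s → wallis-upper k ℚ.≤ wallis k ℚ.+ four ℚ.* s) (≡.sym (rec-/ k)) (wallis-width k))))
    (ℚ.≤-trans (lower d) (≤-by {wallis (d ℕ.+ k)} (four ℚ.* rec k) (*-nonNeg (ℚ.nonNegative⁻¹ four) (0≤rec k)) ≡.refl))
  bound : ∀ j → k ℕ.≤ j → ℚ.∣ wallis j ℚ.- wallis k ∣ ℚ.≤ four ℚ.* rec k
  bound j k≤j = ≡.subst (λ i → ℚ.∣ wallis i ℚ.- wallis k ∣ ℚ.≤ four ℚ.* rec k) (ℕ.m∸n+n≡m k≤j) (close (j ℕ.∸ k))

recip-inverse : ∀ x (0<x : 0ℝ < x) → x ⊠ recip x 0<x ≈ ι 1ℚ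
recip-inverse x 0<x@(q , 0<q , M , h) = ≈-eventually (M , λ n M≤n → ≡.trans (seq-⊠ x (recip x 0<x) n)
  (≡.trans (inv-inverseʳ (ℚ.<-≤-trans 0<q (≡.subst (ℚ._≤ seq x n) (ℚ.+-identityˡ q) (h n M≤n)))) (≡.sym (seq-ι 1ℚ n))))

-- With u = 1/(n+1), the inequalities r² ≤ y < (r + u)² leave a gap of at most (2r + u) u, and hence
-- of at most (2Q + 1) u.
square-close : ∀ {y r : ℕ → ℚ} Q → 0ℚ ℚ.≤ Q → (∀ n → 0ℚ ℚ.≤ r n) → (∀ n → r n ℚ.* r n ℚ.≤ 0ℚ ℚ.⊔ y n) →
  (∀ n → 0ℚ ℚ.⊔ y n ℚ.< (r n ℚ.+ ℤ.+ 1 ℚ./ suc n) ℚ.* (r n ℚ.+ ℤ.+ 1 ℚ./ suc n)) →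
  Eventually (λ n → 0ℚ ℚ.≤ y n) → Eventually (λ n → ℚ.∣ r n ∣ ℚ.≤ Q) → LimBound (λ n → r n ℚ.* r n ℚ.- y n) 0ℚ
square-close {y} {r} Q 0≤Q 0≤r lower upper 0≤y r≤Q = limBound λ ε 0<ε → let open Radius ε 0<ε in
  eventually-map (λ n (0≤y , r≤ , u≤) → close n 0≤y r≤ u≤) (eventually-× 0≤y (eventually-× r≤Q small))
  where
  open +-*-Solver
  d : ℚ
  d = two ℚ.* Q ℚ.+ 1ℚ
  0<d : 0ℚ ℚ.< d
  0<d = ≡.subst (0ℚ ℚ.<_) (ℚ.+-comm 1ℚ (two ℚ.* Q)) (0<1+ (*-nonNeg (ℚ.nonNegative⁻¹ two) 0≤Q))
  module Radius (ε : ℚ) (0<ε : 0ℚ ℚ.< ε) where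
    δ : ℚ
    δ = ε ℚ.* inv d
    small : Eventually (λ n → ℤ.+ 1 ℚ./ suc n ℚ.≤ δ)
    small = archimedean {δ} (*-pos 0<ε (inv-pos 0<d))
    dδ≡ε : d ℚ.* δ ≡ ε
    dδ≡ε = ≡.trans (solve 3 (λ d e i → d :* (e :* i) := e :* (d :* i)) ≡.refl d ε (inv d))
      (≡.trans (≡.cong (ε ℚ.*_) (inv-inverseʳ 0<d)) (ℚ.*-identityʳ ε))
    close : ∀ n → 0ℚ ℚ.≤ y n → ℚ.∣ r n ∣ ℚ.≤ Q → ℤ.+ 1 ℚ./ suc n ℚ.≤ δ → ℚ.∣ r n ℚ.* r n ℚ.- y n ∣ ℚ.≤ 0ℚ ℚ.+ ε
    close n 0≤yₙ r≤ u≤δ = ℚ-Lemmas.∣p-q∣≤⁺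
      (ℚ.≤-trans (≡.subst (r n ℚ.* r n ℚ.≤_) max≡y (lower n))
        (≤-by {y n} (0ℚ ℚ.+ ε) (ℚ.≤-trans (ℚ.<⇒≤ 0<ε) (ℚ.≤-reflexive (≡.sym (ℚ.+-identityˡ ε)))) ≡.refl))
      (ℚ.≤-trans (ℚ.<⇒≤ (≡.subst (ℚ._< (r n ℚ.+ u) ℚ.* (r n ℚ.+ u)) max≡y (upper n)))
        (ℚ.≤-trans (ℚ.≤-reflexive (solve 2 (λ r u → (r :+ u) :* (r :+ u) := r :* r :+ (con two :* r :+ u) :* u) ≡.refl (r n) u))
          (ℚ.+-monoʳ-≤ (r n ℚ.* r n) (ℚ.≤-trans (*-mono-≤ (0≤-+ (*-nonNeg (ℚ.nonNegative⁻¹ two) (0≤r n)) (0≤1/suc n)) (0≤1/suc n)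
            (ℚ.+-mono-≤ (*-monoˡ-≤ (ℚ.nonNegative⁻¹ two) (ℚ.≤-trans (ℚ-Lemmas.p≤∣p∣ (r n)) r≤)) u≤1) u≤δ)
            (ℚ.≤-reflexive (≡.trans dδ≡ε (≡.sym (ℚ.+-identityˡ ε))))))))
      where
      u : ℚ
      u = ℤ.+ 1 ℚ./ suc n
      max≡y : 0ℚ ℚ.⊔ y n ≡ y n
      max≡y = ℚ.p≤q⇒p⊔q≡q 0≤yₙ
      u≤1 : u ℚ.≤ 1ℚ
      u≤1 = ℕ/-mono-≤ 1 n 1 0 (ℕ.*-monoʳ-≤ 1 (ℕ.s≤s ℕ.z≤n))

√-square : ∀ x → Eventually (λ n → 0ℚ ℚ.≤ seq x n) → √ x ⊠ √ x ≈ x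
√-square x 0≤x = go (ℝ-bounded (√ x))
  where
  go : ∃[ q ] (0ℚ ℚ.≤ q × √ x ⊑ q) → √ x ⊠ √ x ≈ x
  go (q , 0≤q , bounds h) = limZero (limBound-resp (always (λ n → ≡.cong (ℚ._- seq x n) (≡.sym (seq-⊠ (√ x) (√ x) n))))
    (square-close {seq x} {seq (√ x)} (q ℚ.+ 1ℚ) (0≤-+ 0≤q (ℚ.nonNegative⁻¹ 1ℚ))
      (λ n → sqrt-approx-nonNeg n (seq x n)) (λ n → sqrt-approx-lower n (seq x n)) (λ n → sqrt-approx-upper n (seq x n))
      0≤x (within h 1ℚ (ℚ.positive⁻¹ 1ℚ))))


5/8 9/4 : ℚ
5/8 = ℤ.+ 5 ℚ./ 8
9/4 = ℤ.+ 9 ℚ./ 4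

1≤-* : ∀ {p q} → 1ℚ ℚ.≤ p → 1ℚ ℚ.≤ q → 1ℚ ℚ.≤ p ℚ.* q
1≤-* {p} {q} 1≤p 1≤q = *-mono-≤ (ℚ.nonNegative⁻¹ 1ℚ) (ℚ.nonNegative⁻¹ 1ℚ) 1≤p 1≤q

-- ∣ p² - y² ∣ ≤ ε y² gives ∣ p - y ∣ ≤ ε y because p + y ≥ y.
square-root-close : ∀ p y s ε → 0ℚ ℚ.≤ p → 0ℚ ℚ.≤ y → 0ℚ ℚ.< s → 0ℚ ℚ.≤ ε → ½ ℚ.≤ y ℚ.* y ℚ.* s →
  ℚ.∣ (p ℚ.* p ℚ.- y ℚ.* y) ℚ.* s ∣ ℚ.≤ ½ ℚ.* ε → ℚ.∣ p ℚ.- y ∣ ℚ.≤ ε ℚ.* ℚ.∣ y ∣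
square-root-close p y s ε 0≤p 0≤y 0<s 0≤ε ½≤y²s h = ≡.subst (λ z → d ℚ.≤ ε ℚ.* z) (≡.sym (ℚ.0≤p⇒∣p∣≡p 0≤y))
  (*-cancel-≤ (y ℚ.* s) 0<ys (begin
    y ℚ.* s ℚ.* d
      ≤⟨ *-monoʳ-≤ (ℚ.0≤∣p∣ _) (*-monoʳ-≤ (ℚ.<⇒≤ 0<s) (≤-by {y} {p ℚ.+ y} p 0≤p (ℚ.+-comm y p))) ⟩
    (p ℚ.+ y) ℚ.* s ℚ.* d
      ≡⟨ ≡.cong (ℚ._* d) (≡.sym (ℚ.0≤p⇒∣p∣≡p 0≤[p+y]s)) ⟩
    ℚ.∣ (p ℚ.+ y) ℚ.* s ∣ ℚ.* d
      ≡⟨ ℚ.∣p*q∣≡∣p∣*∣q∣ ((p ℚ.+ y) ℚ.* s) (p ℚ.- y) ⟨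
    ℚ.∣ (p ℚ.+ y) ℚ.* s ℚ.* (p ℚ.- y) ∣
      ≡⟨ ≡.cong ℚ.∣_∣ (solve 3 (λ p y s → (p :+ y) :* s :* (p :- y) := (p :* p :- y :* y) :* s) ≡.refl p y s) ⟩
    ℚ.∣ (p ℚ.* p ℚ.- y ℚ.* y) ℚ.* s ∣
      ≤⟨ h ⟩
    ½ ℚ.* ε
      ≤⟨ *-monoʳ-≤ 0≤ε ½≤y²s ⟩
    y ℚ.* y ℚ.* s ℚ.* ε
      ≡⟨ solve 3 (λ y s e → y :* y :* s :* e := y :* s :* (e :* y)) ≡.refl y s ε ⟩
    y ℚ.* s ℚ.* (ε ℚ.* y) ∎))
  where
  open ℚ.≤-Reasoning
  open +-*-Solver
  d : ℚ
  d = ℚ.∣ p ℚ.- y ∣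
  0≤[p+y]s : 0ℚ ℚ.≤ (p ℚ.+ y) ℚ.* s
  0≤[p+y]s = *-nonNeg (0≤-+ 0≤p 0≤y) (ℚ.<⇒≤ 0<s)
  0<y : 0ℚ ℚ.< y
  0<y with y ℚ.≟ 0ℚ
  ... | no y≢0    = ℚ.≰⇒> (λ y≤0 → y≢0 (ℚ.≤-antisym y≤0 0≤y))
  ... | yes ≡.refl = contradiction (ℚ.<-≤-trans (ℚ.positive⁻¹ ½) (ℚ.≤-trans ½≤y²s (ℚ.≤-reflexive (ℚ.*-zeroˡ s)))) (ℚ.<-irrefl ≡.refl)
  0<ys : 0ℚ ℚ.< y ℚ.* s
  0<ys = *-pos 0<y 0<s

rec½-small : ∀ C δ → 0ℚ ℚ.≤ C → 0ℚ ℚ.< δ → Eventually (λ n → C ℚ.* rec½ n ℚ.≤ δ)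
rec½-small C δ 0≤C 0<δ = go (archimedean {δ ℚ.* inv (1ℚ ℚ.+ C)} (*-pos 0<δ (inv-pos 0<1+C)))
  where
  open +-*-Solver
  0<1+C : 0ℚ ℚ.< 1ℚ ℚ.+ C
  0<1+C = 0<1+ 0≤C
  go : Eventually (λ n → ℤ.+ 1 ℚ./ suc n ℚ.≤ δ ℚ.* inv (1ℚ ℚ.+ C)) → Eventually (λ n → C ℚ.* rec½ n ℚ.≤ δ)
  go (M , h) = M ℕ.+ M , λ n M+M≤n →
    ℚ.≤-trans (*-mono-≤ 0≤C (0≤rec ⌊ n /2⌋) (≤-by {C} {1ℚ ℚ.+ C} 1ℚ (ℚ.nonNegative⁻¹ 1ℚ) (ℚ.+-comm C 1ℚ))
        (ℚ.≤-trans (ℚ.≤-reflexive (rec-/ ⌊ n /2⌋)) (h ⌊ n /2⌋ (≡.subst (ℕ._≤ ⌊ n /2⌋) (≡.sym (ℕ.n≡⌊n+n/2⌋ M)) (ℕ.⌊n/2⌋-mono M+M≤n)))))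
      (ℚ.≤-reflexive (≡.trans (solve 3 (λ c d i → c :* (d :* i) := d :* (c :* i)) ≡.refl (1ℚ ℚ.+ C) δ (inv (1ℚ ℚ.+ C)))
        (≡.trans (≡.cong (δ ℚ.*_) (inv-inverseʳ 0<1+C)) (ℚ.*-identityʳ δ))))

-- Comparing the probability with a real number whose square is known.

module Comparison (√5 π : ℝ) (√5² : √5 ⊠ √5 ≈ ι (# 5))
  (√5≤9/4 : ∀ n → seq √5 n ℚ.≤ 9/4) (2≤√5 : Eventually (λ n → two ℚ.≤ seq √5 n))
  (2≤π : ∀ n → two ℚ.≤ seq π n) (π-close : ∀ k → π ⊞ ⊟ ι (wallis k) ⊑ four ℚ.* rec k) where

  [√5-1]/2 : ℝ
  [√5-1]/2 = (√5 ⊞ ⊟ ι 1ℚ) ⊠ ι ½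

  seq≡ : ∀ n → seq [√5-1]/2 n ≡ (seq √5 n ℚ.- 1ℚ) ℚ.* ½
  seq≡ n = ≡.trans (seq-⊠ (√5 ⊞ ⊟ ι 1ℚ) (ι ½) n) (≡.cong₂ ℚ._*_
    (≡.trans (seq-⊞ √5 (⊟ ι 1ℚ) n) (≡.cong (seq √5 n ℚ.+_) (≡.trans (seq-⊟ (ι 1ℚ) n) (≡.cong ℚ.-_ (seq-ι 1ℚ n))))) (seq-ι ½ n))

  [√5-1]/2≤5/8 : ∀ n → seq [√5-1]/2 n ℚ.≤ 5/8
  [√5-1]/2≤5/8 n = ≡.subst (ℚ._≤ 5/8) (≡.sym (seq≡ n)) (*-monoʳ-≤ (ℚ.nonNegative⁻¹ ½) (ℚ.+-monoˡ-≤ (ℚ.- 1ℚ) (√5≤9/4 n)))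

  0≤[√5-1]/2 : Eventually (λ n → 0ℚ ℚ.≤ seq [√5-1]/2 n)
  0≤[√5-1]/2 = eventually-map (λ n 2≤r → ≡.subst (0ℚ ℚ.≤_) (≡.sym (seq≡ n))
    (*-nonNeg (ℚ.≤-trans (ℚ.nonNegative⁻¹ 1ℚ) (ℚ.+-monoˡ-≤ (ℚ.- 1ℚ) 2≤r)) (ℚ.nonNegative⁻¹ ½))) 2≤√5

  [√5-1]/2⊑5/8 : [√5-1]/2 ⊑ 5/8
  [√5-1]/2⊑5/8 = bounds (limBound-const (eventually-map (λ n 0≤x → ≡.subst (ℚ._≤ 5/8) (≡.sym (ℚ.0≤p⇒∣p∣≡p 0≤x)) ([√5-1]/2≤5/8 n)) 0≤[√5-1]/2))

  open Constants ℝ-normed √5 √5² [√5-1]/2⊑5/8 public using (β; ρ; three; K⁻¹; limit; p²nπ-asymptotics; limit-zero; limit-suc)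

  β≤5/8 : ∀ n → seq β n ℚ.≤ 5/8
  β≤5/8 = [√5-1]/2≤5/8

  0≤β : Eventually (λ n → 0ℚ ℚ.≤ seq β n)
  0≤β = 0≤[√5-1]/2

  1≤2-β : ∀ n → 1ℚ ℚ.≤ two ℚ.- seq β n
  1≤2-β n = ℚ.≤-trans (toWitness {a? = 1ℚ ℚ.≤? two ℚ.- 5/8} tt) (ℚ.+-monoʳ-≤ two (ℚ.neg-antimono-≤ (β≤5/8 n)))

  seq-ρ-suc : ∀ h n → seq (ρ (suc h)) n ≡ two ℚ.* ♮ h ℚ.+ three ℚ.- seq β n
  seq-ρ-suc h n = ≡.trans (seq-⊞ (ι two ⊠ ι (♮ h) ⊞ ι three) (⊟ β) n) (≡.cong₂ ℚ._+_
    (≡.trans (seq-⊞ (ι two ⊠ ι (♮ h)) (ι three) n) (≡.cong₂ ℚ._+_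
      (≡.trans (seq-⊠ (ι two) (ι (♮ h)) n) (≡.cong₂ ℚ._*_ (seq-ι two n) (seq-ι (♮ h) n))) (seq-ι three n)))
    (seq-⊟ β n))

  1≤ρ : ∀ m n → 1ℚ ℚ.≤ seq (ρ m) n
  1≤ρ zero    n = ℚ.≤-reflexive (≡.sym (seq-ι 1ℚ n))
  1≤ρ (suc h) n = ≡.subst (1ℚ ℚ.≤_) (≡.sym (seq-ρ-suc h n)) (lemma (seq β n) (1≤2-β n))
    where
    open +-*-Solver
    lemma : ∀ x → 1ℚ ℚ.≤ two ℚ.- x → 1ℚ ℚ.≤ two ℚ.* ♮ h ℚ.+ three ℚ.- x
    lemma x 1≤ = ℚ.≤-trans 1≤ (≤-by {two ℚ.- x} (two ℚ.* ♮ h ℚ.+ 1ℚ) (0≤-+ (*-nonNeg (ℚ.nonNegative⁻¹ two) (0≤♮ h)) (ℚ.nonNegative⁻¹ 1ℚ))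
      (solve 2 (λ t x → con two :- x :+ (con two :* t :+ con 1ℚ) := con two :* t :+ con three :- x) ≡.refl (♮ h) x))

  11ℚ 7ℚ 1/20 : ℚ
  11ℚ = ℤ.+ 11 ℚ./ 1
  7ℚ = ℤ.+ 7 ℚ./ 1
  1/20 = ℤ.+ 1 ℚ./ 20

  Λ : ℕ → ℝ
  Λ m = ρ m ⊠ (ι two ⊞ ⊟ β)

  seq-limit : ∀ m n → seq (limit m) n ≡ two ℚ.* (seq (Λ m) n ℚ.* seq (Λ m) n) ℚ.* ((11ℚ ℚ.+ 7ℚ ℚ.* seq β n) ℚ.* 1/20)
  seq-limit m n = ≡.trans (seq-⊠ (ι two ⊠ (Λ m ⊠ Λ m)) K⁻¹ n) (≡.cong₂ ℚ._*_
    (≡.trans (seq-⊠ (ι two) (Λ m ⊠ Λ m) n) (≡.cong₂ ℚ._*_ (seq-ι two n) (seq-⊠ (Λ m) (Λ m) n)))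
    (≡.trans (seq-⊠ (ι 11ℚ ⊞ ι 7ℚ ⊠ β) (ι 1/20) n) (≡.cong₂ ℚ._*_
      (≡.trans (seq-⊞ (ι 11ℚ) (ι 7ℚ ⊠ β) n) (≡.cong₂ ℚ._+_ (seq-ι 11ℚ n) (≡.trans (seq-⊠ (ι 7ℚ) β n) (≡.cong (ℚ._* seq β n) (seq-ι 7ℚ n)))))
      (seq-ι 1/20 n))))

  1≤Λ : ∀ m n → 1ℚ ℚ.≤ seq (Λ m) n
  1≤Λ m n = ≡.subst (1ℚ ℚ.≤_) (≡.sym (≡.trans (seq-⊠ (ρ m) (ι two ⊞ ⊟ β) n) (≡.cong (seq (ρ m) n ℚ.*_)
    (≡.trans (seq-⊞ (ι two) (⊟ β) n) (≡.cong₂ ℚ._+_ (seq-ι two n) (seq-⊟ β n)))))) (1≤-* (1≤ρ m n) (1≤2-β n))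

  -- A relative error requires a limit bounded away from 0. Here `Λ m` ≥ 1 and β ≥ 0, and 2 · 11/20
  -- already exceeds 1.
  1≤limit : ∀ m → Eventually (λ n → 1ℚ ℚ.≤ seq (limit m) n)
  1≤limit m = eventually-map (λ n 0≤β → ≡.subst (1ℚ ℚ.≤_) (≡.sym (seq-limit m n)) (lemma (seq (Λ m) n) (seq β n) (1≤Λ m n) 0≤β)) 0≤β
    where
    lemma : ∀ l x → 1ℚ ℚ.≤ l → 0ℚ ℚ.≤ x → 1ℚ ℚ.≤ two ℚ.* (l ℚ.* l) ℚ.* ((11ℚ ℚ.+ 7ℚ ℚ.* x) ℚ.* 1/20)
    lemma l x 1≤l 0≤x = ℚ.≤-trans (1≤-* (1≤-* 1≤l 1≤l) (≤-by {1ℚ} {1ℚ ℚ.+ 1/10 ℚ.* (1ℚ ℚ.+ 7ℚ ℚ.* x)} (1/10 ℚ.* (1ℚ ℚ.+ 7ℚ ℚ.* x))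
        (*-nonNeg (ℚ.nonNegative⁻¹ 1/10) (0≤-+ (ℚ.nonNegative⁻¹ 1ℚ) (*-nonNeg (ℚ.nonNegative⁻¹ 7ℚ) 0≤x))) ≡.refl))
      (ℚ.≤-reflexive (solve 2 (λ l x → l :* l :* (con 1ℚ :+ con 1/10 :* (con 1ℚ :+ con 7ℚ :* x))
        := con two :* (l :* l) :* ((con 11ℚ :+ con 7ℚ :* x) :* con 1/20)) ≡.refl l x))
      where
      open +-*-Solver
      1/10 : ℚ
      1/10 = ℤ.+ 1 ℚ./ 10

  module _ (m : ℕ) (p : ℕ → ℚ) (0≤p : ∀ n → 0ℚ ℚ.≤ p n)
    (p-ratio : ∀ n → p n ℚ.* (♮ (compositions n) ℚ.+ ♮ (compositions n)) ≡ ♮ (up m n ℕ.+ down m n)) where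

    open BigO ℝ-normed using (O)

    asymptotics : O rec½ (λ n → ι (p n) ⊠ ι (p n) ⊠ (ι (♮ n) ⊠ π) ⊞ ⊟ limit m)
    asymptotics = p²nπ-asymptotics ι-⊑⁻ π π-close m p p-ratio

    -- In the application `y` is c/√n. The threshold for `n` depends on ε only, whereas the
    -- threshold for the index `j` of the Cauchy sequences may depend on `n` and `y`; for fixed `n`
    -- the comparison is one of rationals.
    compare : ∀ ε → 0ℚ ℚ.< ε → Eventually (λ n → ∀ (y : ℝ) → 0ℚ ℚ.< ♮ n → y ⊠ y ⊠ (ι (♮ n) ⊠ π) ≈ limit m →
      Eventually (λ j → 0ℚ ℚ.≤ seq y j) → Eventually (λ j → ℚ.∣ p n ℚ.- seq y j ∣ ℚ.≤ ε ℚ.* ℚ.∣ seq y j ∣))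
    compare ε 0<ε = eventually-map (λ n small y 0<n y²≈ 0≤y → at n small y 0<n y²≈ 0≤y)
        (rec½-small (proj₁ asymptotics) η (proj₁ (proj₂ asymptotics)) 0<η)
      where
      -- A quarter of ε: one share for the asymptotic error at `n`, one for the approximation at
      -- index `j`, together the ½ ε that `square-root-close` asks for.
      η : ℚ
      η = ½ ℚ.* (½ ℚ.* ε)
      0<η : 0ℚ ℚ.< η
      0<η = halve-pos (halve-pos 0<ε)
      at : ∀ n → proj₁ asymptotics ℚ.* rec½ n ℚ.≤ η → ∀ (y : ℝ) → 0ℚ ℚ.< ♮ n → y ⊠ y ⊠ (ι (♮ n) ⊠ π) ≈ limit m →
        Eventually (λ j → 0ℚ ℚ.≤ seq y j) → Eventually (λ j → ℚ.∣ p n ℚ.- seq y j ∣ ℚ.≤ ε ℚ.* ℚ.∣ seq y j ∣)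
      at n small y 0<n y²≈ 0≤y = eventually-map
          (λ j (0≤yⱼ , 1≤l , near , gap) → pointwise (seq y j) (♮ n ℚ.* seq π j) (seq (limit m) j) 0≤yⱼ
            (*-pos 0<n (ℚ.<-≤-trans (ℚ.positive⁻¹ two) (2≤π j))) 1≤l near gap)
          (eventually-× 0≤y (eventually-× (1≤limit m) (eventually-× (within near-limit ½ (ℚ.positive⁻¹ ½))
            (within (limBound-+ (limBound-resp (always p²≡) (limBounds (proj₂ (proj₂ asymptotics) n))) (limBound-neg near-limit)) η 0<η))))
        where
        open +-*-Solver
        C : ℚ
        C = proj₁ asymptotics ℚ.* rec½ n
        scaled≡ : ∀ x j → seq (x ⊠ x ⊠ (ι (♮ n) ⊠ π)) j ≡ seq x j ℚ.* seq x j ℚ.* (♮ n ℚ.* seq π j)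
        scaled≡ x j = ≡.trans (seq-⊠ (x ⊠ x) (ι (♮ n) ⊠ π) j) (≡.cong₂ ℚ._*_ (seq-⊠ x x j)
          (≡.trans (seq-⊠ (ι (♮ n)) π j) (≡.cong (ℚ._* seq π j) (seq-ι (♮ n) j))))
        p²≡ : ∀ j → seq (ι (p n) ⊠ ι (p n) ⊠ (ι (♮ n) ⊠ π) ⊞ ⊟ limit m) j ≡ p n ℚ.* p n ℚ.* (♮ n ℚ.* seq π j) ℚ.- seq (limit m) j
        p²≡ j = ≡.trans (seq-⊞ (ι (p n) ⊠ ι (p n) ⊠ (ι (♮ n) ⊠ π)) (⊟ limit m) j) (≡.cong₂ ℚ._+_
          (≡.trans (scaled≡ (ι (p n)) j) (≡.cong (λ x → x ℚ.* x ℚ.* (♮ n ℚ.* seq π j)) (seq-ι (p n) j))) (seq-⊟ (limit m) j))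
        near-limit : LimBound (λ j → seq y j ℚ.* seq y j ℚ.* (♮ n ℚ.* seq π j) ℚ.- seq (limit m) j) 0ℚ
        near-limit = limBound-resp (always (λ j → ≡.cong (ℚ._- seq (limit m) j) (scaled≡ y j))) (difference y²≈)
        pointwise : ∀ y s l → 0ℚ ℚ.≤ y → 0ℚ ℚ.< s → 1ℚ ℚ.≤ l → ℚ.∣ y ℚ.* y ℚ.* s ℚ.- l ∣ ℚ.≤ 0ℚ ℚ.+ ½ →
          ℚ.∣ p n ℚ.* p n ℚ.* s ℚ.- l ℚ.+ ℚ.- (y ℚ.* y ℚ.* s ℚ.- l) ∣ ℚ.≤ C ℚ.+ 0ℚ ℚ.+ η → ℚ.∣ p n ℚ.- y ∣ ℚ.≤ ε ℚ.* ℚ.∣ y ∣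
        pointwise y s l 0≤y 0<s 1≤l near gap = square-root-close (p n) y s ε (0≤p n) 0≤y 0<s (ℚ.<⇒≤ 0<ε) ½≤
          (ℚ.≤-trans (ℚ.≤-reflexive (≡.cong ℚ.∣_∣ (solve 4 (λ p y s l → (p :* p :- y :* y) :* s := p :* p :* s :- l :+ (:- (y :* y :* s :- l))) ≡.refl (p n) y s l)))
            (ℚ.≤-trans gap (ℚ.≤-trans (ℚ.+-monoˡ-≤ η (ℚ.≤-trans (ℚ.≤-reflexive (ℚ.+-identityʳ C)) small))
              (ℚ.≤-reflexive (solve 1 (λ e → con ½ :* (con ½ :* e) :+ con ½ :* (con ½ :* e) := con ½ :* e) ≡.refl ε)))))
          where
          ½≤ : ½ ℚ.≤ y ℚ.* y ℚ.* s
          ½≤ = ≡.subst₂ ℚ._≤_ ≡.refl (solve 1 (λ a → a :+ (con 0ℚ :+ con ½) :- con ½ := a) ≡.refl (y ℚ.* y ℚ.* s))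
            (ℚ.+-monoˡ-≤ (ℚ.- ½) (ℚ.≤-trans 1≤l (ℚ-Lemmas.∣p-q∣≤⁻′ {y ℚ.* y ℚ.* s} {l} near)))

open NormedAlgebra ℝ-normed using (trans; sym; refl; +-cong; *-cong; *-congʳ; -‿cong)
open RingLemmas ℝ-algebra

-- A property of the representing sequence, stronger than nonnegativity of the real number: `√` and
-- `∣_∣` act on the sequence term by term.
record NonNeg (x : ℝ) : Set where
  constructor nonNeg
  field
    eventually : Eventually (λ n → 0ℚ ℚ.≤ seq x n)

nonNeg-* : ∀ x y → NonNeg x → NonNeg y → NonNeg (x * y)
nonNeg-* x y (nonNeg p) (nonNeg q) = nonNeg (eventually-map (λ n (0≤x , 0≤y) → *-nonNeg 0≤x 0≤y) (eventually-× p q))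

nonNeg-recip : ∀ x (0<x : 0ℝ < x) → NonNeg (recip x 0<x)
nonNeg-recip x (q , 0<q , M , h) = nonNeg (M , λ n M≤n → ℚ.<⇒≤ (inv-pos (ℚ.<-≤-trans 0<q (≡.subst (ℚ._≤ seq x n) (ℚ.+-identityˡ q) (h n M≤n)))))

nonNeg-/ : ∀ x y (0<y : 0ℝ < y) → NonNeg x → NonNeg (x / y [ 0<y ])
nonNeg-/ x y 0<y p = nonNeg-* x (recip y 0<y) p (nonNeg-recip y 0<y)

nonNeg-√ : ∀ x → NonNeg (√ x)
nonNeg-√ x = nonNeg (always λ n → sqrt-approx-nonNeg n (seq x n))

-- Translation of the operations of the statement into their opaque copies, on which the ring lemmas
-- operate.
+-≈ : ∀ x y {x′ y′} → x ≈ x′ → y ≈ y′ → x + y ≈ x′ ⊞ y′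
+-≈ x y p q = trans (≈-pointwise (λ n → ≡.sym (seq-⊞ x y n))) (+-cong p q)

*-≈ : ∀ x y {x′ y′} → x ≈ x′ → y ≈ y′ → x * y ≈ x′ ⊠ y′
*-≈ x y p q = trans (≈-pointwise (λ n → ≡.sym (seq-⊠ x y n))) (*-cong p q)

neg-≈ : ∀ x {x′} → x ≈ x′ → - x ≈ ⊟ x′
neg-≈ x p = trans (≈-pointwise (λ n → ≡.sym (seq-⊟ x n))) (-‿cong p)

minus-≈ : ∀ x y {x′ y′} → x ≈ x′ → y ≈ y′ → x - y ≈ x′ ⊞ ⊟ y′
minus-≈ x y p q = +-≈ x (- y) p (neg-≈ y q)

/-≈ : ∀ x y (0<y : 0ℝ < y) {x′} → x ≈ x′ → x / y [ 0<y ] ≈ x′ ⊠ recip y 0<y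
/-≈ x y 0<y p = *-≈ x (recip y 0<y) p refl

fromℚ≈ : ∀ q → fromℚ q ≈ ι q
fromℚ≈ q = ≈-pointwise (λ n → ≡.sym (seq-ι q n))

fromℕ≈ : ∀ n → fromℕ n ≈ ι (♮ n)
fromℕ≈ n = ≈-pointwise (λ j → ≡.trans (≡.sym (♮-/1 n)) (≡.sym (seq-ι (♮ n) j)))

7ℚ 15ℚ 4ℚ 3ℚ 15/7 : ℚ
7ℚ = ℤ.+ 7 ℚ./ 1
15ℚ = ℤ.+ 15 ℚ./ 1
4ℚ = ℤ.+ 4 ℚ./ 1
3ℚ = ℤ.+ 3 ℚ./ 1
15/7 = ℤ.+ 15 ℚ./ 7

-- Identification of the constant in the statement.

module ClosedForm (√5 π : ℝ) (√5² : √5 ⊠ √5 ≈ ι (# 5))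
  (√5≤9/4 : ∀ n → seq √5 n ℚ.≤ 9/4) (15/7≤√5 : Eventually (λ n → 15/7 ℚ.≤ seq √5 n)) (2≤√5 : Eventually (λ n → two ℚ.≤ seq √5 n))
  (2≤π : ∀ n → two ℚ.≤ seq π n) (π-close : ∀ k → π ⊞ ⊟ ι (wallis k) ⊑ four ℚ.* rec k)
  (0<π : 0ℝ < π) (0<2 : 0ℝ < fromℕ 2) (0<4[√5-2] : 0ℝ < fromℕ 4 * (√5 - fromℕ 2)) where

  open Comparison √5 π √5² √5≤9/4 2≤√5 2≤π π-close public using (limit; limit-zero; limit-suc; compare)

  -- The constant `c` over an abstract √5 and π, so that their defining sequences are never unfolded
  -- in the computations with it.
  constant : ℕ → ℝ
  constant zero      = (fromℕ 2 + √5) / fromℕ 2 [ 0<2 ] * √ ((fromℕ 7 * √5 - fromℕ 15) / π [ 0<π ])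
  constant m@(suc _) = (fromℕ 4 * fromℕ m + fromℕ 3 - √5) / (fromℕ 4 * (√5 - fromℕ 2)) [ 0<4[√5-2] ] * √ ((fromℕ 7 * √5 - fromℕ 15) / π [ 0<π ])

  -- Required because `√` squares back only nonnegative terms; 15/7 is the zero of 7r - 15.
  nonNeg-radicand : NonNeg (fromℕ 7 * √5 - fromℕ 15)
  nonNeg-radicand = nonNeg (eventually-map (λ n → lemma (seq √5 n)) 15/7≤√5)
    where
    lemma : ∀ r → 15/7 ℚ.≤ r → 0ℚ ℚ.≤ 7ℚ ℚ.* r ℚ.+ ℚ.- 15ℚ
    lemma r 15/7≤r = ℚ.+-monoˡ-≤ (ℚ.- 15ℚ) {15ℚ} (*-monoˡ-≤ {7ℚ} {15/7} (ℚ.nonNegative⁻¹ 7ℚ) 15/7≤r)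

  radicand : ℝ
  radicand = ι 7ℚ ⊠ √5 ⊞ ⊟ ι 15ℚ

  radicand≈ : fromℕ 7 * √5 - fromℕ 15 ≈ radicand
  radicand≈ = minus-≈ (fromℕ 7 * √5) (fromℕ 15) (*-≈ (fromℕ 7) √5 (fromℚ≈ 7ℚ) refl) (fromℚ≈ 15ℚ)

  √radicand/π-square : √ ((fromℕ 7 * √5 - fromℕ 15) / π [ 0<π ]) ⊠ √ ((fromℕ 7 * √5 - fromℕ 15) / π [ 0<π ]) ≈ radicand ⊠ recip π 0<π
  √radicand/π-square = trans (√-square ((fromℕ 7 * √5 - fromℕ 15) / π [ 0<π ])
      (NonNeg.eventually (nonNeg-/ (fromℕ 7 * √5 - fromℕ 15) π 0<π nonNeg-radicand)))
    (/-≈ (fromℕ 7 * √5 - fromℕ 15) π 0<π radicand≈)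

  *√radicand/π-square : ∀ x {x′} → x ≈ x′ →
    (x * √ ((fromℕ 7 * √5 - fromℕ 15) / π [ 0<π ])) ⊠ (x * √ ((fromℕ 7 * √5 - fromℕ 15) / π [ 0<π ])) ⊠ π ≈ x′ ⊠ x′ ⊠ radicand
  *√radicand/π-square x {x′} p = trans (*-congʳ (*-cong factor factor))
      (c²π x′ (√ ((fromℕ 7 * √5 - fromℕ 15) / π [ 0<π ])) radicand (recip π 0<π) π √radicand/π-square (recip-inverse π 0<π))
    where
    factor : x * √ ((fromℕ 7 * √5 - fromℕ 15) / π [ 0<π ]) ≈ x′ ⊠ √ ((fromℕ 7 * √5 - fromℕ 15) / π [ 0<π ])
    factor = *-≈ x (√ ((fromℕ 7 * √5 - fromℕ 15) / π [ 0<π ])) p refl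

  constant²π : ∀ m → constant m ⊠ constant m ⊠ π ≈ limit m
  constant²π zero = trans
    (*√radicand/π-square ((fromℕ 2 + √5) / fromℕ 2 [ 0<2 ]) (/-≈ (fromℕ 2 + √5) (fromℕ 2) 0<2 (+-≈ (fromℕ 2) √5 (fromℚ≈ two) refl)))
    (limit-zero (recip (fromℕ 2) 0<2) (trans (*-congʳ (sym (fromℚ≈ two))) (recip-inverse (fromℕ 2) 0<2)))
  constant²π (suc h) = trans
    (*√radicand/π-square ((fromℕ 4 * fromℕ (suc h) + fromℕ 3 - √5) / (fromℕ 4 * (√5 - fromℕ 2)) [ 0<4[√5-2] ])
      (/-≈ (fromℕ 4 * fromℕ (suc h) + fromℕ 3 - √5) (fromℕ 4 * (√5 - fromℕ 2)) 0<4[√5-2] (minus-≈ (fromℕ 4 * fromℕ (suc h) + fromℕ 3) √5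
        (+-≈ (fromℕ 4 * fromℕ (suc h)) (fromℕ 3) (*-≈ (fromℕ 4) (fromℕ (suc h)) (fromℚ≈ 4ℚ) (fromℕ≈ (suc h))) (fromℚ≈ 3ℚ)) refl)))
    (limit-suc h (recip (fromℕ 4 * (√5 - fromℕ 2)) 0<4[√5-2]) (trans (*-congʳ (sym d≈)) (recip-inverse (fromℕ 4 * (√5 - fromℕ 2)) 0<4[√5-2])))
    where
    d≈ : fromℕ 4 * (√5 - fromℕ 2) ≈ ι 4ℚ ⊠ (√5 ⊞ ⊟ ι two)
    d≈ = *-≈ (fromℕ 4) (√5 - fromℕ 2) (fromℚ≈ 4ℚ) (minus-≈ √5 (fromℕ 2) refl (fromℚ≈ two))

  nonNeg-√radicand/π : NonNeg (√ ((fromℕ 7 * √5 - fromℕ 15) / π [ 0<π ]))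
  nonNeg-√radicand/π = nonNeg-√ ((fromℕ 7 * √5 - fromℕ 15) / π [ 0<π ])

  nonNeg-constant : ∀ m → NonNeg (constant m)
  nonNeg-constant zero = nonNeg-* ((fromℕ 2 + √5) / fromℕ 2 [ 0<2 ]) (√ ((fromℕ 7 * √5 - fromℕ 15) / π [ 0<π ]))
      (nonNeg-/ (fromℕ 2 + √5) (fromℕ 2) 0<2 (nonNeg (eventually-map (λ n → lemma (seq √5 n)) 2≤√5))) nonNeg-√radicand/π
    where
    lemma : ∀ r → two ℚ.≤ r → 0ℚ ℚ.≤ two ℚ.+ r
    lemma r 2≤r = 0≤-+ (ℚ.nonNegative⁻¹ two) (ℚ.≤-trans (ℚ.nonNegative⁻¹ two) 2≤r)
  nonNeg-constant (suc h) = nonNeg-* ((fromℕ 4 * fromℕ (suc h) + fromℕ 3 - √5) / (fromℕ 4 * (√5 - fromℕ 2)) [ 0<4[√5-2] ]) (√ ((fromℕ 7 * √5 - fromℕ 15) / π [ 0<π ]))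
      (nonNeg-/ (fromℕ 4 * fromℕ (suc h) + fromℕ 3 - √5) (fromℕ 4 * (√5 - fromℕ 2)) 0<4[√5-2]
        (nonNeg (always (λ n → lemma (ℤ.+ suc h ℚ./ 1) (seq √5 n) (≡.subst (0ℚ ℚ.≤_) (♮-/1 (suc h)) (0≤♮ (suc h))) (√5≤9/4 n))))) nonNeg-√radicand/π
    where
    open +-*-Solver
    lemma : ∀ t r → 0ℚ ℚ.≤ t → r ℚ.≤ 9/4 → 0ℚ ℚ.≤ 4ℚ ℚ.* t ℚ.+ 3ℚ ℚ.+ ℚ.- r
    lemma t r 0≤t r≤ = ℚ.≤-trans (ℚ.≤-reflexive (≡.sym (ℚ.+-inverseʳ r))) (ℚ.+-monoˡ-≤ (ℚ.- r) (ℚ.≤-trans r≤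
      (≤-by {9/4} {4ℚ ℚ.* t ℚ.+ 3ℚ} (4ℚ ℚ.* t ℚ.+ (3ℚ ℚ.- 9/4)) (0≤-+ (*-nonNeg (ℚ.nonNegative⁻¹ 4ℚ) 0≤t) (ℚ.nonNegative⁻¹ (3ℚ ℚ.- 9/4)))
        (solve 1 (λ t → con 9/4 :+ (con 4ℚ :* t :+ con (3ℚ ℚ.- 9/4)) := con 4ℚ :* t :+ con 3ℚ) ≡.refl t))))

  quotient²nπ : ∀ m n (x s : ℝ) (0<s : 0ℝ < s) → s ⊠ s ≈ ι (♮ n) → x ⊠ x ⊠ π ≈ limit m →
    (x / s [ 0<s ]) ⊠ (x / s [ 0<s ]) ⊠ (ι (♮ n) ⊠ π) ≈ limit m
  quotient²nπ m n x s 0<s s² x² = trans (*-congʳ (*-cong y≈ y≈)) (trans ([c/s]²nπ x (recip s 0<s) s (ι (♮ n)) π s² (recip-inverse s 0<s)) x²)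
    where
    y≈ : x / s [ 0<s ] ≈ x ⊠ recip s 0<s
    y≈ = /-≈ x s 0<s refl

  relative-error : ∀ m ε → 0ℚ ℚ.< ε → Eventually (λ n → ∀ (x s : ℝ) (0<s : 0ℝ < s) → 0ℚ ℚ.< ♮ n → s ⊠ s ≈ ι (♮ n) →
    x ⊠ x ⊠ π ≈ limit m → NonNeg x → ∣ fromℚ (probStaysAbove m n) - x / s [ 0<s ] ∣ ≤ fromℚ ε * ∣ x / s [ 0<s ] ∣)
  relative-error m ε 0<ε = eventually-map
    (λ n h x s 0<s 0<n s² x² 0≤x ε′ 0<ε′ → eventually-map
      (λ j le → ℚ.≤-trans le (≤-by {ε ℚ.* ℚ.∣ seq (x / s [ 0<s ]) j ∣} ε′ (ℚ.<⇒≤ 0<ε′) ≡.refl))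
      (h (x / s [ 0<s ]) 0<n (quotient²nπ m n x s 0<s s² x²) (NonNeg.eventually (nonNeg-/ x s 0<s 0≤x))))
    (compare m (probStaysAbove m) (prob-nonNeg m) (prob-ratio m) ε 0<ε)

open Positivity

√5-lower : ∀ {p} → fromℚ p < √5 → Eventually (λ n → p ℚ.≤ seq √5 n)
√5-lower {p} (δ , 0<δ , M , h) = M , λ n M≤n → ℚ.≤-trans (≤-by {p} {p ℚ.+ δ} δ (ℚ.<⇒≤ 0<δ) ≡.refl) (h n M≤n)

√5≤9/4 : ∀ n → seq √5 n ℚ.≤ 9/4
√5≤9/4 n = square-cancel-≤ (ℚ.nonNegative⁻¹ 9/4)
  (ℚ.≤-<-trans (sqrt-approx-lower n (ℤ.+ 5 ℚ./ 1)) (toWitness {a? = (0ℚ ℚ.⊔ (ℤ.+ 5 ℚ./ 1)) ℚ.<? 9/4 ℚ.* 9/4} tt))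

√ℕ-square : ∀ n → √ (fromℕ n) ⊠ √ (fromℕ n) ≈ ι (♮ n)
√ℕ-square n = trans (√-square (fromℕ n) (always (λ _ → ≡.subst (0ℚ ℚ.≤_) (♮-/1 n) (0≤♮ n)))) (fromℕ≈ n)

√5² : √5 ⊠ √5 ≈ ι (ℤ.+ 5 ℚ./ 1)
√5² = trans (√ℕ-square 5) (NormedAlgebra.ι-cong ℝ-normed (♮-/1 5))

15/7<√5 : fromℚ 15/7 < √5
15/7<√5 = √-lower (fromℕ 5) 15/7 δ (toWitness {a? = 0ℚ ℚ.<? δ} tt)
  (λ _ → toWitness {a? = (15/7 ℚ.+ δ ℚ.+ δ) ℚ.* (15/7 ℚ.+ δ ℚ.+ δ) ℚ.≤? ℤ.+ 5 ℚ./ 1} tt)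
  where
  δ : ℚ
  -- Small enough that (15/7 + 2δ)² is still at most 5.
  δ = ℤ.+ 1 ℚ./ 50

open ClosedForm √5 π √5² √5≤9/4 (√5-lower 15/7<√5) (√5-lower √5>2) 2≤wallis π-close π-positive
  (fromℚ-positive (ℤ.+ 2 ℚ./ 1) (toWitness {a? = 0ℚ ℚ.<? ℤ.+ 2 ℚ./ 1} tt))
  (*-positive (fromℕ 4) (√5 - fromℕ 2) (fromℚ-positive (ℤ.+ 4 ℚ./ 1) (toWitness {a? = 0ℚ ℚ.<? ℤ.+ 4 ℚ./ 1} tt)) √5-2-positive)

c²π≈limit : ∀ m → c m ⊠ c m ⊠ π ≈ limit m
c²π≈limit zero    = constant²π 0
c²π≈limit (suc h) = constant²π (suc h)

nonNeg-c : ∀ m → NonNeg (c m)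
nonNeg-c zero    = nonNeg-constant 0
nonNeg-c (suc h) = nonNeg-constant (suc h)

0<♮ : ∀ n → .{{ℕ.NonZero n}} → 0ℚ ℚ.< ♮ n
0<♮ (suc n) = 0<♮suc n

corollary4p1 : (m : ℕ) →
    (λ n → fromℚ (probStaysAbove m n)) ∼ (λ n → c m / √ (fromℕ n) [ Positivity.√-positive n ])
corollary4p1 m ε 0<ε = proj₁ (relative-error m ε 0<ε) , λ n {{nz}} N≤n →
  proj₂ (relative-error m ε 0<ε) n N≤n (c m) (√ (fromℕ n)) (√-positive n {{nz}}) (0<♮ n {{nz}}) (√ℕ-square n) (c²π≈limit m) (nonNeg-c m)
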